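{- Let $n\ge 3$ and let $W_n=K_1+C_n$ be the wheel, i.e. the join of a single vertex with the cycle graph $C_n$ on $n$ vertices. Fix any total ordering of $E(W_n)$ and any field $\Bbbk$. Then $$h_{W_n}(z)=(1+z)^n-z^{n-1}-z^n,$$ $$\mathrm{Hilb}(\Bbbk[\mathrm{BC}(W_n)];z)=\frac{(1+z)^n-z^{n-1}-z^n}{(1-z)^n}.$$
   Context: For a finite connected loopless graph $G$ with a fixed total order on $E(G)$, a broken circuit is a set $C\setminus\{\max C\}$, where $C$ is the edge set of a cycle of $G$ and $\max C$ is its largest edge. The broken-circuit complex $\mathrm{BC}(G)$ is the simplicial complex on $E(G)$ whose faces are the edge sets containing no broken circuit. Its Stanley--Reisner ring is $\Bbbk[\mathrm{BC}(G)]=\Bbbk[x_e:e\in E(G)]/I_{\mathrm{BC}(G)}$, with $I_{\mathrm{BC}(G)}$ generated by the monomials $\prod_{e\in C\setminus\{\max C\}}x_e$ over all cycles $C$ of $G$; it is graded by $\deg x_e=1$, and $\mathrm{Hilb}$ denotes its Hilbert series. With $r=|V(G)|-1$ and $b_i$ the number of faces of $\mathrm{BC}(G)$ having exactly $i$ elements, the $h$-polynomial of $\mathrm{BC}(G)$ is $h_G(z)=\sum_{i=0}^{r}b_i z^i(1-z)^{r-i}$. -}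

module Defs where

open import Algebra.Bundles using (CommutativeRing)
open import Data.Bool.Base using (if_then_else_)
import Data.Bool.Properties as Bool
open import Data.Fin.Base using (Fin; zero; suc; toℕ; fromℕ<; splitAt; remQuot; _↑ˡ_; _↑ʳ_)
import Data.Fin.Properties as Fin
open import Data.Fin.Subset using (Subset; inside; outside; _∈_; _⊆_; ⁅_⁆; ⋃; ∣_∣)
  renaming (_-_ to _∖_)
open import Data.Fin.Subset.Properties using (_∈?_; _⊆?_; anySubset?)
import Data.Integer.Base as ℤ
open ℤ using (ℤ; +_; 0ℤ; 1ℤ)
open import Data.Integer.Properties using (+-0-commutativeMonoid)
open import Data.List.Base using (List; []; _∷_; _++_; map; concat; tabulate; filter; length; cartesianProductWith)
open import Data.Nat.Base as ℕ using (ℕ; zero; suc; _∸_)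
open import Data.Nat.DivMod using (_mod_)
import Data.Nat.Properties as ℕ
open import Data.Product.Base using (Σ; ∃; _×_; _,_; proj₁; proj₂)
open import Data.Product.Properties using (≡-dec)
open import Data.Sum.Base using (_⊎_; [_,_]′)
open import Data.Vec.Base as Vec using (Vec; []; _∷_; lookup; zipWith; toList)
import Data.Vec.Properties as Vec
import Data.Vec.Relation.Unary.AllPairs as AllPairs
open import Data.Vec.Relation.Unary.Unique.Propositional using (Unique)
open import Data.Vec.Relation.Unary.Unique.Propositional.Properties using (lookup-injective)
open import Function.Base using (_∘_)
open import Level using (Level; _⊔_)
open import Relation.Binary.Consequences using (total∧dec⇒dec)
open import Relation.Binary.Core using (Rel)
open import Relation.Binary.Definitions using (Decidable)
open import Relation.Binary.PropositionalEquality
  using (_≡_; _≢_; _≗_; sym; subst)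
open import Relation.Binary.Structures using (IsTotalOrder)
open import Relation.Nullary.Decidable using (Dec; yes; no; ¬?; map′; _×-dec_; _⊎-dec_; _→-dec_)
open import Relation.Nullary.Negation using (¬_)
import Relation.Unary as U

open import Algebra.Properties.CommutativeMonoid.Sum +-0-commutativeMonoid
  using (sum⁺-syntax)

-- Finite multigraphs.  The order of the two endpoints of an edge carries
-- no meaning: it is forgotten by `Joins`.  Loops are not excluded here
-- (a loop is a cycle of length 1); wheels have none.

record Graph : Set where
  field
    #V   : ℕ
    #E   : ℕ
    ends : Fin #E → Fin #V × Fin #V

open Graph public

Vertex Edge : Graph → Set
Vertex G = Fin (#V G)
Edge   G = Fin (#E G)

Joins : (G : Graph) → Edge G → Vertex G → Vertex G → Set
Joins G e u v = ends G e ≡ (u , v) ⊎ ends G e ≡ (v , u)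

next : ∀ {n} → Fin n → Fin n
next {suc n} i = suc (toℕ i) mod suc n

-- Edge i of the cycle graph joins i and i + 1 mod n; this is the usual
-- simple cycle when n ≥ 3.

cycleGraph : ℕ → Graph
cycleGraph n = record { #V = n ; #E = n ; ends = λ i → i , next i }

K₁ : Graph
K₁ = record { #V = 1 ; #E = 0 ; ends = λ () }

-- The join: the disjoint union of G and H together with one edge
-- between u and v for every vertex u of G and v of H.

joinGraph : Graph → Graph → Graph
joinGraph G H = record
  { #V   = #V G ℕ.+ #V H
  ; #E   = #E G ℕ.+ (#E H ℕ.+ #V G ℕ.* #V H)
  ; ends = [ endsG , [ endsH , endsGH ]′ ∘ splitAt (#E H) ]′ ∘ splitAt (#E G)
  }
  where
  inG : Vertex G → Fin (#V G ℕ.+ #V H)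
  inG u = u ↑ˡ #V H

  inH : Vertex H → Fin (#V G ℕ.+ #V H)
  inH v = #V G ↑ʳ v

  endsG : Edge G → Fin (#V G ℕ.+ #V H) × Fin (#V G ℕ.+ #V H)
  endsG e = inG (proj₁ (ends G e)) , inG (proj₂ (ends G e))

  endsH : Edge H → Fin (#V G ℕ.+ #V H) × Fin (#V G ℕ.+ #V H)
  endsH e = inH (proj₁ (ends H e)) , inH (proj₂ (ends H e))

  endsGH : Fin (#V G ℕ.* #V H) → Fin (#V G ℕ.+ #V H) × Fin (#V G ℕ.+ #V H)
  endsGH p = inG (proj₁ (remQuot {#V G} (#V H) p)) , inH (proj₂ (remQuot {#V G} (#V H) p))

wheel : ℕ → Graph
wheel n = joinGraph K₁ (cycleGraph n)

-- A cycle of length k + 1 is given by its vertices v₀, …, vₖ and its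
-- edges e₀, …, eₖ, where eᵢ joins vᵢ and vᵢ₊₁ (indices mod k + 1).
-- Distinctness of the edges only matters in length 2.

IsCycle : (G : Graph) {k : ℕ} → Vec (Vertex G) (suc k) → Vec (Edge G) (suc k) → Set
IsCycle G vs es =
  Unique vs × Unique es ×
  (∀ i → Joins G (lookup es i) (lookup vs i) (lookup vs (next i)))

edgeSet : ∀ {m n} → Vec (Fin m) n → Subset m
edgeSet es = ⋃ (toList (Vec.map ⁅_⁆ es))

IsCycleEdgeSet : (G : Graph) → Subset (#E G) → Set
IsCycleEdgeSet G C =
  ∃ λ k → Σ (Vec (Vertex G) (suc k)) λ vs → Σ (Vec (Edge G) (suc k)) λ es →
  IsCycle G vs es × edgeSet es ≡ C

module _ (G : Graph) {ℓ : Level} (_≤_ : Rel (Edge G) ℓ) where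

  IsMax : Subset (#E G) → Edge G → Set ℓ
  IsMax C e = e ∈ C × (∀ f → f ∈ C → f ≤ e)

  IsBrokenCircuit : Subset (#E G) → Set ℓ
  IsBrokenCircuit B =
    Σ (Subset (#E G)) λ C → Σ (Edge G) λ e →
    IsCycleEdgeSet G C × IsMax C e × B ≡ C ∖ e

  IsFace : Subset (#E G) → Set ℓ
  IsFace S = ¬ (Σ (Subset (#E G)) λ B → IsBrokenCircuit B × B ⊆ S)

-- The deciders below serve to count faces in #faces.

anyVec? : ∀ {n p} k {P : U.Pred (Vec (Fin n) k) p} → U.Decidable P → Dec (∃ P)
anyVec? zero    P? = map′ (λ p → [] , p) (λ { ([] , p) → p }) (P? [])
anyVec? (suc k) P? =
  map′ (λ (x , xs , p) → (x ∷ xs) , p)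
       (λ { ((x ∷ xs) , p) → x , xs , p })
       (Fin.any? λ x → anyVec? k λ xs → P? (x ∷ xs))

joins? : ∀ G e u v → Dec (Joins G e u v)
joins? G e u v =
  ≡-dec Fin._≟_ Fin._≟_ (ends G e) (u , v) ⊎-dec ≡-dec Fin._≟_ Fin._≟_ (ends G e) (v , u)

unique? : ∀ {n k} (xs : Vec (Fin n) k) → Dec (Unique xs)
unique? = AllPairs.allPairs? (λ x y → ¬? (x Fin.≟ y))

isCycle? : ∀ G {k} (vs : Vec (Vertex G) (suc k)) (es : Vec (Edge G) (suc k)) → Dec (IsCycle G vs es)
isCycle? G vs es =
  unique? vs ×-dec unique? es ×-dec
  Fin.all? (λ i → joins? G (lookup es i) (lookup vs i) (lookup vs (next i)))

isCycleEdgeSet? : ∀ G → U.Decidable (IsCycleEdgeSet G)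
isCycleEdgeSet? G C =
  map′ (λ (k , w) → toℕ k , w) bound
       (Fin.any? {n = #V G} λ k → ofLength? (toℕ k))
  where
  OfLength : ℕ → Set
  OfLength k =
    Σ (Vec (Vertex G) (suc k)) λ vs → Σ (Vec (Edge G) (suc k)) λ es →
    IsCycle G vs es × edgeSet es ≡ C

  ofLength? : U.Decidable OfLength
  ofLength? k =
    anyVec? (suc k) λ vs → anyVec? (suc k) λ es →
    isCycle? G vs es ×-dec Vec.≡-dec Bool._≟_ (edgeSet es) C

  bound : ∃ OfLength → ∃ λ (k : Fin (#V G)) → OfLength (toℕ k)
  bound (k , w@(vs , es , (vs! , _) , _)) =
    fromℕ< k<#V , subst OfLength (sym (Fin.toℕ-fromℕ< k<#V)) w
    where
    k<#V : k ℕ.< #V G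
    k<#V = Fin.injective⇒≤ {f = lookup vs} (lookup-injective vs! _ _)

module _ (G : Graph) {ℓ : Level} {_≤_ : Rel (Edge G) ℓ} (ord : IsTotalOrder _≡_ _≤_) where

  private
    module ≤ = IsTotalOrder ord

    _≤?_ : Decidable _≤_
    _≤?_ = total∧dec⇒dec ≤.reflexive ≤.antisym ≤.total Fin._≟_

  isBrokenCircuit? : U.Decidable (IsBrokenCircuit G _≤_)
  isBrokenCircuit? B =
    anySubset? λ C → Fin.any? λ e →
    isCycleEdgeSet? G C ×-dec
    ((e ∈? C) ×-dec Fin.all? λ f → (f ∈? C) →-dec (f ≤? e)) ×-dec
    Vec.≡-dec Bool._≟_ B (C ∖ e)

  isFace? : U.Decidable (IsFace G _≤_)
  isFace? S = ¬? (anySubset? λ B → isBrokenCircuit? B ×-dec (B ⊆? S))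

allSubsets : ∀ n → List (Subset n)
allSubsets zero    = [] ∷ []
allSubsets (suc n) = map (outside ∷_) (allSubsets n) ++ map (inside ∷_) (allSubsets n)

#faces : (G : Graph) {ℓ : Level} {_≤_ : Rel (Edge G) ℓ} → IsTotalOrder _≡_ _≤_ → ℕ → ℕ
#faces G ord i = length (filter (λ S → (∣ S ∣ ℕ.≟ i) ×-dec isFace? G ord S) (allSubsets (#E G)))

-- ℤ[[z]], a series being its sequence of coefficients and equality being
-- _≗_.  Polynomials are regarded as elements of ℤ[[z]]; since ℤ[z] embeds
-- there, an equation between polynomials means the same in either ring.
-- A series F equals p / q, for q with constant term 1 (hence a unit),
-- exactly when F ⊛ q ≗ p.

Series : Set
Series = ℕ → ℤ

infixl 6 _⊕_ _⊖_
infixl 7 _⊛_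
infixr 8 _^ˢ_

𝟙 𝕫 : Series
𝟙 zero    = 1ℤ
𝟙 (suc _) = 0ℤ
𝕫 zero          = 0ℤ
𝕫 (suc zero)    = 1ℤ
𝕫 (suc (suc _)) = 0ℤ

_⊕_ _⊖_ _⊛_ : Series → Series → Series
(f ⊕ g) d = f d ℤ.+ g d
(f ⊖ g) d = f d ℤ.- g d
(f ⊛ g) d = ∑[ i ≤ d ] (f (toℕ i) ℤ.* g (d ∸ toℕ i))

_^ˢ_ : Series → ℕ → Series
f ^ˢ zero  = 𝟙
f ^ˢ suc n = f ⊛ f ^ˢ n

rank : Graph → ℕ
rank G = #V G ∸ 1

hPolynomial : (G : Graph) {ℓ : Level} {_≤_ : Rel (Edge G) ℓ} → IsTotalOrder _≡_ _≤_ → Series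
hPolynomial G ord d =
  ∑[ i ≤ rank G ]
    (+ #faces G ord (toℕ i) ℤ.* (𝕫 ^ˢ toℕ i ⊛ (𝟙 ⊖ 𝕫) ^ˢ (rank G ∸ toℕ i)) d)

Monomial : ℕ → Set
Monomial N = Vec ℕ N

degree : ∀ {N} → Monomial N → ℕ
degree = Vec.sum

module Polynomials {c ℓ : Level} (R : CommutativeRing c ℓ) (N : ℕ) where

  open CommutativeRing R using (Carrier; _≈_; _+_; _*_; -_; 0#; 1#)

  -- A polynomial is a formal sum of terms, in which a monomial may occur
  -- repeatedly or with coefficient zero; polynomials are identified when
  -- all their coefficients agree.

  Poly : Set c
  Poly = List (Carrier × Monomial N)

  coeff : Poly → Monomial N → Carrier
  coeff []            m = 0#
  coeff ((a , m′) ∷ p) m with Vec.≡-dec ℕ._≟_ m′ m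
  ... | yes _ = a + coeff p m
  ... | no  _ = coeff p m

  infix 4 _≈ₚ_
  _≈ₚ_ : Rel Poly ℓ
  p ≈ₚ q = ∀ m → coeff p m ≈ coeff q m

  infixl 6 _+ₚ_ _-ₚ_
  infixl 7 _*ₚ_ _∙ₚ_

  _+ₚ_ _-ₚ_ _*ₚ_ : Poly → Poly → Poly
  p +ₚ q = p ++ q
  p -ₚ q = p ++ map (λ (a , m) → - a , m) q
  p *ₚ q = cartesianProductWith (λ (a , m) (b , m′) → a * b , zipWith ℕ._+_ m m′) p q

  _∙ₚ_ : Carrier → Poly → Poly
  a ∙ₚ p = map (λ (b , m) → a * b , m) p

  linearCombination : ∀ {k} → (Fin k → Carrier) → (Fin k → Poly) → Poly
  linearCombination a b = concat (tabulate λ i → a i ∙ₚ b i)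

  Homogeneous : ℕ → Poly → Set ℓ
  Homogeneous d p = ∀ m → degree m ≢ d → coeff p m ≈ 0#

  data Ideal {g : Level} (Gen : Poly → Set g) : Poly → Set (c ⊔ ℓ ⊔ g) where
    gen   : ∀ {p} → Gen p → Ideal Gen p
    zero  : Ideal Gen []
    add   : ∀ {p q} → Ideal Gen p → Ideal Gen q → Ideal Gen (p +ₚ q)
    mul   : ∀ p {q} → Ideal Gen q → Ideal Gen (p *ₚ q)
    resp  : ∀ {p q} → p ≈ₚ q → Ideal Gen p → Ideal Gen q

  -- For a homogeneous ideal I, the degree-d component of R[x]/I consists
  -- of the classes of homogeneous polynomials of degree d.  It has
  -- dimension k when it has a basis of k elements; over a field, k is
  -- determined by I and d.

  record GradedDimension {i : Level} (I : Poly → Set i) (d k : ℕ) : Set (c ⊔ ℓ ⊔ i) where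
    field
      basis       : Fin k → Poly
      homogeneous : ∀ j → Homogeneous d (basis j)
      independent : ∀ (a : Fin k → Carrier) → I (linearCombination a basis) → ∀ j → a j ≈ 0#
      spanning    : ∀ p → Homogeneous d p →
                    ∃ λ (a : Fin k → Carrier) → I (p -ₚ linearCombination a basis)

  -- The monomial ∏ x_e over e ∈ B, as a polynomial with a single term.

  squarefree : Subset N → Poly
  squarefree B = (1# , Vec.map (λ b → if b then 1 else 0) B) ∷ []

  IsHilbertFunction : ∀ {i} → (Poly → Set i) → (ℕ → ℕ) → Set (c ⊔ ℓ ⊔ i)
  IsHilbertFunction I H = ∀ d → GradedDimension I d (H d)

module StanleyReisner {c ℓ : Level} (R : CommutativeRing c ℓ)
                      (G : Graph) {o : Level} (_≤_ : Rel (Edge G) o) where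

  open Polynomials R (#E G) public

  IsGenerator : Poly → Set (c ⊔ o)
  IsGenerator p = Σ (Subset (#E G)) λ B → IsBrokenCircuit G _≤_ B × p ≡ squarefree B

  I-BC : Poly → Set (c ⊔ ℓ ⊔ o)
  I-BC = Ideal IsGenerator

  IsHilbertSeries : Series → Set (c ⊔ ℓ ⊔ o)
  IsHilbertSeries F = ∃ λ (H : ℕ → ℕ) → IsHilbertFunction I-BC H × F ≗ (λ d → + H d)

{-# OPTIONS --safe #-}
module Submission where

-- Colour the vertices of W_n with q colours, the hub with colour 0.
-- Summing (−1)^|S| over the pairs of an edge set S and a colouring constant on the edges of S
-- counts the proper colourings; toggling the least edge that closes a broken circuit in S
-- cancels all S that are not faces, whatever the order is. A face is a forest, so q^(n − |S|)
-- colourings are constant on it, and therefore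
--   Σ_i (−1)^i b_i q^(n − i) = (q − 2)ⁿ − (−1)^(n − 1) (q − 2)   for all q ≥ 1.
-- This determines the b_i: Σ_i b_i xⁱ y^(n − i) = (y + 2x)ⁿ − x^(n − 1) y − 2xⁿ, and x = z,
-- y = 1 − z gives h. A polynomial lies in I_BC exactly when its coefficients at the monomials
-- supported on faces vanish, so those monomials form a basis of the quotient; a face S
-- supports monomials with series (z / (1 − z))^|S|.

open import Defs
open import Algebra.Apartness.Bundles using (HeytingField; HeytingCommutativeRing)
open import Algebra.Bundles using (CommutativeRing)
import Algebra.Properties.Ring as RingProperties
open import Algebra.Structures using (IsCommutativeRing)
open import Data.Bool.Base using (if_then_else_; not)
import Data.Bool.Properties as Bool
open import Data.Fin.Base as Fin using (Fin; zero; suc; toℕ; fromℕ; fromℕ<; inject₁; _↑ˡ_; _↑ʳ_)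
import Data.Fin.Permutation as Perm
open Perm using (Permutation′; _⟨$⟩ʳ_; transpose)
import Data.Fin.Properties as Fin
open import Data.Fin.Relation.Unary.Top using (view; ‵fromℕ; ‵inject₁)
open import Data.Fin.Subset using (Subset; inside; outside; _∈_; _∉_; _⊆_; ⁅_⁆; ∣_∣; Lift)
  renaming (_-_ to _∖_)
open import Data.Fin.Subset.Properties
  using (_∈?_; _⊆?_; anySubset?; Lift?; ∉⊥; x∈⁅x⁆; x∈⁅y⁆⇒x≡y; x∈p∪q⁻; x∈p∪q⁺; p─q⊆p; x∈p∧x≢y⇒x∈p-y;
         ⊆-refl; ⊆-trans; drop-∷-⊆)
import Data.Integer.Base as ℤ
open ℤ using (ℤ; 0ℤ; 1ℤ; -1ℤ; _+_; _*_; -_; _-_; _^_)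
import Data.Integer.Properties as ℤ
open import Data.Integer.Tactic.RingSolver using (solve-∀)
open import Data.List.Base as List
  using (List; []; _∷_; _++_; map; concatMap; filter; length; tabulate; allFin; cartesianProductWith)
open import Data.List.Membership.Propositional using (find; lose) renaming (_∈_ to _∈ₗ_; _∉_ to _∉ₗ_)
open import Data.List.Membership.Propositional.Properties
  using (∈-allFin; ∈-map⁺; ∈-map⁻; ∈-++⁺ˡ; ∈-++⁺ʳ; ∈-++⁻; ∈-filter⁺; ∈-filter⁻; ∈-lookup; ∈-concatMap⁺; ∈-concatMap⁻)
import Data.List.Properties as List using (length-map; length-++)
open import Data.List.Relation.Unary.All as All using (All; []; _∷_)
import Data.List.Relation.Unary.All.Properties as All using (map⁺; all-filter)
open import Data.List.Relation.Unary.AllPairs as AllPairs using ([]; _∷_)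
import Data.List.Relation.Unary.AllPairs.Properties as AllPairs using (map⁺)
open import Data.List.Relation.Unary.Any as Any using (here; there)
import Data.List.Relation.Unary.Any.Properties as Any using (lookup-index)
import Data.List.Relation.Unary.Unique.Propositional as List using (Unique)
import Data.List.Relation.Unary.Unique.Propositional.Properties as List
  using (map⁺; ++⁺; concat⁺; filter⁺; Unique[x∷xs]⇒x∉xs)
open import Data.Nat.Base as ℕ using (ℕ; zero; suc; _∸_; _≤_)
import Data.Nat.Combinatorics as ℕ using (_C_)
open import Data.Nat.DivMod using (m<n⇒m%n≡m; n%n≡0; m%n<n)
import Data.Nat.Properties as ℕ
open import Data.Product.Base using (Σ; ∃; _×_; _,_; proj₁; proj₂; map₁)
open import Data.Sum.Base using (_⊎_; inj₁; inj₂; [_,_]′)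
open import Data.Vec.Base as Vec using (Vec; []; _∷_; _∷ʳ_; lookup; updateAt; zipWith; here; there)
import Data.Vec.Properties as Vec
import Data.Vec.Relation.Unary.All as VecAll using (All; []; _∷_)
import Data.Vec.Relation.Unary.All.Properties as VecAll using (lookup⁺; lookup⁻)
import Data.Vec.Relation.Unary.AllPairs as VecAllPairs using ([]; _∷_)
open import Data.Vec.Relation.Unary.Unique.Propositional using (Unique)
open import Data.Vec.Relation.Unary.Unique.Propositional.Properties using (lookup-injective)
open import Function.Base using (_∘_; id)
open import Function.Bundles using (module Injection)
open import Function.Properties.Inverse using (↔⇒↣)
open import Level using (Level; 0ℓ)
open import Relation.Binary.Consequences using (total∧dec⇒dec)
import Relation.Binary.Construct.Flip.EqAndOrd as Flip
open import Relation.Binary.Construct.Closure.ReflexiveTransitive as Star using (Star; ε; _◅_; _◅◅_)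
open import Relation.Binary.Core using (Rel)
import Relation.Binary.Definitions as Binary
open import Relation.Binary.PropositionalEquality
  using (_≡_; _≢_; _≗_; refl; sym; trans; cong; cong₂; subst; module ≡-Reasoning)
import Relation.Binary.Reasoning.Setoid as SetoidReasoning
open import Relation.Binary.Structures using (IsTotalOrder)
open import Relation.Nullary.Decidable using (Dec; yes; no; does; ¬?; decidable-stable; _×-dec_; _→-dec_)
open import Relation.Nullary.Negation using (¬_; contradiction)
import Relation.Unary as U
open import Algebra.Properties.Semiring.Sum ℤ.+-*-semiring
  using (sum; sum-cong-≗; ∑-distrib-+; *-distribˡ-sum; *-distribʳ-sum; sum-init-last; sum-permute)

-- Deletion and contraction would change the graph, its cycles and the order on its edges. Summing
-- over colourings keeps the graph fixed: the cancellation takes place inside each single colouring,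
-- for any graph, and the shape of the wheel enters through its hub and the count of proper
-- colourings.
--
-- Fixing the colour of the hub divides every count by the number of colours, which lowers the
-- exponents from n + 1 - |S| to n - |S|. Both sides of the identity are then forms of degree n at x
-- = -1, y = q. Such forms take values in power series here, so that one notion serves twice:
-- constant series give the integer identities from which the coefficients are recovered, and z, 1 -
-- z give h.
--
-- The exponent n - |S| is only meaningful once |S| ≤ n is known for faces. The counts are therefore
-- first proved in the multiplicative form q^|S| · count = q^(number of vertices), and the bound is
-- read off from the case of two colours.

private variable
  ℓa ℓb ℓc ℓp ℓq : Level
  A : Set ℓa
  B : Set ℓb
  C : Set ℓc
  P : Set ℓp
  Q : Set ℓq

-- Indicators and finite sums

⟦_⟧ : Dec P → ℤ
⟦ P? ⟧ = if does P? then 1ℤ else 0ℤ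

⟦⟧-yes : (P? : Dec P) → P → ⟦ P? ⟧ ≡ 1ℤ
⟦⟧-yes (yes _) _ = refl
⟦⟧-yes (no ¬p) p = contradiction p ¬p

⟦⟧-no : (P? : Dec P) → ¬ P → ⟦ P? ⟧ ≡ 0ℤ
⟦⟧-no (yes p) ¬p = contradiction p ¬p
⟦⟧-no (no _)  _  = refl

⟦⟧-cong : (P? : Dec P) (Q? : Dec Q) → (P → Q) → (Q → P) → ⟦ P? ⟧ ≡ ⟦ Q? ⟧
⟦⟧-cong (yes p) Q? f g = sym (⟦⟧-yes Q? (f p))
⟦⟧-cong (no ¬p) Q? f g = sym (⟦⟧-no Q? (¬p ∘ g))

⟦⟧-× : (P? : Dec P) (Q? : Dec Q) → ⟦ P? ×-dec Q? ⟧ ≡ ⟦ P? ⟧ * ⟦ Q? ⟧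
⟦⟧-× (yes _) Q? = sym (ℤ.*-identityˡ _)
⟦⟧-× (no _)  Q? = refl

-- Lets a summand be rewritten under a hypothesis that holds only where the indicator is nonzero, so
-- that sums over all subsets can use facts about faces.
⟦⟧-*-cong : (P? : Dec P) {x y : ℤ} → (P → x ≡ y) → ⟦ P? ⟧ * x ≡ ⟦ P? ⟧ * y
⟦⟧-*-cong (yes p) x≡y = cong (1ℤ *_) (x≡y p)
⟦⟧-*-cong (no _)  x≡y = refl

∑ₗ : List A → (A → ℤ) → ℤ
∑ₗ []       f = 0ℤ
∑ₗ (x ∷ xs) f = f x + ∑ₗ xs f

∑ₗ-cong : (xs : List A) {f g : A → ℤ} → f ≗ g → ∑ₗ xs f ≡ ∑ₗ xs g
∑ₗ-cong []       f≗g = refl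
∑ₗ-cong (x ∷ xs) f≗g = cong₂ _+_ (f≗g x) (∑ₗ-cong xs f≗g)

∑ₗ-zero : (xs : List A) → ∑ₗ xs (λ _ → 0ℤ) ≡ 0ℤ
∑ₗ-zero []       = refl
∑ₗ-zero (x ∷ xs) = trans (ℤ.+-identityˡ _) (∑ₗ-zero xs)

+-interchange : ∀ w x y z → (w + x) + (y + z) ≡ (w + y) + (x + z)
+-interchange = solve-∀

∑ₗ-+ : (xs : List A) (f g : A → ℤ) → ∑ₗ xs (λ x → f x + g x) ≡ ∑ₗ xs f + ∑ₗ xs g
∑ₗ-+ []       f g = refl
∑ₗ-+ (x ∷ xs) f g =
  trans (cong (f x + g x +_) (∑ₗ-+ xs f g)) (+-interchange (f x) (g x) _ _)

*-∑ₗ : ∀ c (xs : List A) (f : A → ℤ) → c * ∑ₗ xs f ≡ ∑ₗ xs (λ x → c * f x)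
*-∑ₗ c []       f = ℤ.*-zeroʳ c
*-∑ₗ c (x ∷ xs) f = trans (ℤ.*-distribˡ-+ c _ _) (cong (c * f x +_) (*-∑ₗ c xs f))

∑ₗ-* : ∀ c (xs : List A) (f : A → ℤ) → ∑ₗ xs f * c ≡ ∑ₗ xs (λ x → f x * c)
∑ₗ-* c xs f = trans (ℤ.*-comm _ c) (trans (*-∑ₗ c xs f) (∑ₗ-cong xs λ x → ℤ.*-comm c (f x)))

∑ₗ-neg : (xs : List A) (f : A → ℤ) → ∑ₗ xs (λ x → - f x) ≡ - ∑ₗ xs f
∑ₗ-neg []       f = refl
∑ₗ-neg (x ∷ xs) f = trans (cong (_+_ (- f x)) (∑ₗ-neg xs f)) (sym (ℤ.neg-distrib-+ (f x) _))

∑ₗ-swap : (xs : List A) (ys : List B) (f : A → B → ℤ) →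
          ∑ₗ xs (λ x → ∑ₗ ys (f x)) ≡ ∑ₗ ys (λ y → ∑ₗ xs (λ x → f x y))
∑ₗ-swap []       ys f = sym (∑ₗ-zero ys)
∑ₗ-swap (x ∷ xs) ys f =
  trans (cong (∑ₗ ys (f x) +_) (∑ₗ-swap xs ys f)) (sym (∑ₗ-+ ys (f x) _))

∑ₗ-map : (h : A → B) (xs : List A) (f : B → ℤ) → ∑ₗ (map h xs) f ≡ ∑ₗ xs (f ∘ h)
∑ₗ-map h []       f = refl
∑ₗ-map h (x ∷ xs) f = cong (f (h x) +_) (∑ₗ-map h xs f)

∑ₗ-++ : (xs ys : List A) (f : A → ℤ) → ∑ₗ (xs ++ ys) f ≡ ∑ₗ xs f + ∑ₗ ys f
∑ₗ-++ []       ys f = sym (ℤ.+-identityˡ _)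
∑ₗ-++ (x ∷ xs) ys f = trans (cong (f x +_) (∑ₗ-++ xs ys f)) (sym (ℤ.+-assoc (f x) _ _))

∑ₗ-concatMap : (h : A → List B) (xs : List A) (f : B → ℤ) →
               ∑ₗ (concatMap h xs) f ≡ ∑ₗ xs (λ x → ∑ₗ (h x) f)
∑ₗ-concatMap h []       f = refl
∑ₗ-concatMap h (x ∷ xs) f =
  trans (∑ₗ-++ (h x) _ f) (cong (∑ₗ (h x) f +_) (∑ₗ-concatMap h xs f))

∑ₗ-filter : {P : A → Set ℓp} (P? : U.Decidable P) (xs : List A) (f : A → ℤ) →
            ∑ₗ (filter P? xs) f ≡ ∑ₗ xs (λ x → ⟦ P? x ⟧ * f x)
∑ₗ-filter P? []       f = refl
∑ₗ-filter P? (x ∷ xs) f with P? x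
... | yes _ = cong₂ _+_ (sym (ℤ.*-identityˡ (f x))) (∑ₗ-filter P? xs f)
... | no  _ = trans (∑ₗ-filter P? xs f) (sym (ℤ.+-identityˡ _))

length-∑ₗ : (xs : List A) → ℤ.+ length xs ≡ ∑ₗ xs (λ _ → 1ℤ)
length-∑ₗ []       = refl
length-∑ₗ (x ∷ xs) = cong (1ℤ +_) (length-∑ₗ xs)

length-filter-∑ₗ : {P : A → Set ℓp} (P? : U.Decidable P) (xs : List A) →
                   ℤ.+ length (filter P? xs) ≡ ∑ₗ xs (⟦_⟧ ∘ P?)
length-filter-∑ₗ P? xs =
  trans (length-∑ₗ (filter P? xs))
 (trans (∑ₗ-filter P? xs _) (∑ₗ-cong xs λ x → ℤ.*-identityʳ _))

∑ₗ-tabulate : ∀ {n} (h : Fin n → A) (f : A → ℤ) → ∑ₗ (tabulate h) f ≡ sum (f ∘ h)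
∑ₗ-tabulate {n = zero}  h f = refl
∑ₗ-tabulate {n = suc n} h f = cong (f (h zero) +_) (∑ₗ-tabulate (h ∘ suc) f)

sum-∑ₗ-swap : ∀ {n} (xs : List A) (f : Fin n → A → ℤ) →
              sum (λ i → ∑ₗ xs (f i)) ≡ ∑ₗ xs (λ x → sum (λ i → f i x))
sum-∑ₗ-swap {n = n} xs f = begin
  sum (λ i → ∑ₗ xs (f i))                ≡⟨ ∑ₗ-tabulate {n = n} id (λ i → ∑ₗ xs (f i)) ⟨
  ∑ₗ (allFin n) (λ i → ∑ₗ xs (f i))      ≡⟨ ∑ₗ-swap (allFin n) xs f ⟩
  ∑ₗ xs (λ x → ∑ₗ (allFin n) λ i → f i x) ≡⟨ ∑ₗ-cong xs (λ x → ∑ₗ-tabulate {n = n} id (λ i → f i x)) ⟩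
  ∑ₗ xs (λ x → sum (λ i → f i x))        ∎
  where open ≡-Reasoning

sum-zero : ∀ n {f : Fin n → ℤ} → (∀ i → f i ≡ 0ℤ) → sum f ≡ 0ℤ
sum-zero zero    f≡0 = refl
sum-zero (suc n) f≡0 = cong₂ _+_ (f≡0 zero) (sum-zero n (f≡0 ∘ suc))

sum-singleton : ∀ {n} (i : Fin n) {f : Fin n → ℤ} → (∀ j → j ≢ i → f j ≡ 0ℤ) → sum f ≡ f i
sum-singleton {suc n} zero    {f} f≡0 =
  trans (cong (f zero +_) (sum-zero n λ j → f≡0 (suc j) λ ())) (ℤ.+-identityʳ _)
sum-singleton {suc n} (suc i) {f} f≡0 =
  trans (cong₂ _+_ (f≡0 zero λ ()) (sum-singleton i λ j j≢i → f≡0 (suc j) λ { refl → j≢i refl }))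
        (ℤ.+-identityˡ _)

-- The ring of power series

infix 4 _≈ˢ_
_≈ˢ_ : Series → Series → Set
_≈ˢ_ = _≗_

tail : Series → Series
tail f = f ∘ suc

infixr 7 _·_
_·_ : ℤ → Series → Series
(c · f) d = c * f d

𝟘 : Series
𝟘 _ = 0ℤ

⊖_ : Series → Series
(⊖ f) d = - f d

⊛-cong : ∀ {f f′ g g′} → f ≗ f′ → g ≗ g′ → f ⊛ g ≗ f′ ⊛ g′
⊛-cong f≗ g≗ d = sum-cong-≗ {suc d} λ i → cong₂ _*_ (f≗ (toℕ i)) (g≗ (d ∸ toℕ i))

⊛-congˡ : ∀ f {g g′} → g ≗ g′ → f ⊛ g ≗ f ⊛ g′
⊛-congˡ f g≗ = ⊛-cong {f} (λ _ → refl) g≗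

⊛-congʳ : ∀ g {f f′} → f ≗ f′ → f ⊛ g ≗ f′ ⊛ g
⊛-congʳ g f≗ = ⊛-cong {g = g} f≗ (λ _ → refl)

⊛-head : ∀ f g → (f ⊛ g) 0 ≡ f 0 * g 0
⊛-head f g = ℤ.+-identityʳ _

⊛-distribʳ : ∀ f g h → (g ⊕ h) ⊛ f ≗ g ⊛ f ⊕ h ⊛ f
⊛-distribʳ f g h d =
  trans (sum-cong-≗ {suc d} λ i → ℤ.*-distribʳ-+ (f (d ∸ toℕ i)) (g (toℕ i)) (h (toℕ i)))
        (∑-distrib-+ {suc d} (λ i → g (toℕ i) * f (d ∸ toℕ i)) (λ i → h (toℕ i) * f (d ∸ toℕ i)))

·-⊛ : ∀ c f g → (c · f) ⊛ g ≗ c · (f ⊛ g)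
·-⊛ c f g d =
  trans (sum-cong-≗ {suc d} λ i → ℤ.*-assoc c (f (toℕ i)) (g (d ∸ toℕ i)))
        (sym (*-distribˡ-sum {suc d} c λ i → f (toℕ i) * g (d ∸ toℕ i)))

⊛-zeroˡ : ∀ f → 𝟘 ⊛ f ≗ 𝟘
⊛-zeroˡ f d = sum-zero (suc d) λ _ → refl

⊛-identityˡ : ∀ f → 𝟙 ⊛ f ≗ f
⊛-identityˡ f zero    = trans (ℤ.+-identityʳ _) (ℤ.*-identityˡ _)
⊛-identityˡ f (suc d) =
  trans (cong₂ _+_ (ℤ.*-identityˡ (f (suc d))) (⊛-zeroˡ f d)) (ℤ.+-identityʳ _)

-- By definition (f ⊛ g)(d + 1) is f₀ g(d + 1) plus (tail f ⊛ g)(d). This recursion peels the left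
-- factor only, so the induction hypothesis has to bring the other factor to the left before `swap`
-- can peel it too.
⊛-comm : ∀ f g → f ⊛ g ≗ g ⊛ f
⊛-comm f g zero    = cong (_+ 0ℤ) (ℤ.*-comm (f 0) (g 0))
⊛-comm f g (suc d) = begin
  f 0 * g (suc d) + (tail f ⊛ g) d ≡⟨ cong (f 0 * g (suc d) +_) (⊛-comm (tail f) g d) ⟩
  f 0 * g (suc d) + (g ⊛ tail f) d ≡⟨ swap d ⟩
  g 0 * f (suc d) + (tail g ⊛ f) d ∎
  where
  open ≡-Reasoning
  swap-terms : ∀ x y z → x + (y + z) ≡ y + (x + z)
  swap-terms = solve-∀
  boundary : ∀ w x y z → w * x + (y * z + 0ℤ) ≡ y * z + (x * w + 0ℤ)
  boundary = solve-∀
  swap : ∀ d → f 0 * g (suc d) + (g ⊛ tail f) d ≡ g 0 * f (suc d) + (tail g ⊛ f) d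
  swap zero    = boundary (f 0) (g 1) (g 0) (f 1)
  swap (suc d) = begin
    f 0 * g (2 ℕ.+ d) + (g 0 * f (2 ℕ.+ d) + (tail g ⊛ tail f) d)
      ≡⟨ swap-terms (f 0 * g (2 ℕ.+ d)) (g 0 * f (2 ℕ.+ d)) ((tail g ⊛ tail f) d) ⟩
    g 0 * f (2 ℕ.+ d) + (f 0 * g (2 ℕ.+ d) + (tail g ⊛ tail f) d)
      ≡⟨ cong (λ s → g 0 * f (2 ℕ.+ d) + (f 0 * g (2 ℕ.+ d) + s)) (⊛-comm (tail g) (tail f) d) ⟩
    g 0 * f (2 ℕ.+ d) + (f ⊛ tail g) (suc d)
      ≡⟨ cong (g 0 * f (2 ℕ.+ d) +_) (⊛-comm f (tail g) (suc d)) ⟩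
    g 0 * f (2 ℕ.+ d) + (tail g ⊛ f) (suc d) ∎

⊛-assoc : ∀ f g h → (f ⊛ g) ⊛ h ≗ f ⊛ (g ⊛ h)
⊛-assoc f g h zero    = trivial (f 0) (g 0) (h 0)
  where
  trivial : ∀ x y z → (x * y + 0ℤ) * z + 0ℤ ≡ x * (y * z + 0ℤ) + 0ℤ
  trivial = solve-∀
⊛-assoc f g h (suc d) = begin
  (f 0 * g 0 + 0ℤ) * h (suc d) + ((f 0 · tail g ⊕ tail f ⊛ g) ⊛ h) d
    ≡⟨ cong ((f 0 * g 0 + 0ℤ) * h (suc d) +_) (⊛-distribʳ h (f 0 · tail g) (tail f ⊛ g) d) ⟩
  (f 0 * g 0 + 0ℤ) * h (suc d) + (((f 0 · tail g) ⊛ h) d + ((tail f ⊛ g) ⊛ h) d)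
    ≡⟨ cong₂ (λ x y → (f 0 * g 0 + 0ℤ) * h (suc d) + (x + y)) (·-⊛ (f 0) (tail g) h d) (⊛-assoc (tail f) g h d) ⟩
  (f 0 * g 0 + 0ℤ) * h (suc d) + (f 0 * (tail g ⊛ h) d + (tail f ⊛ (g ⊛ h)) d)
    ≡⟨ regroup (f 0) (g 0) (h (suc d)) _ _ ⟩
  f 0 * (g 0 * h (suc d) + (tail g ⊛ h) d) + (tail f ⊛ (g ⊛ h)) d ∎
  where
  open ≡-Reasoning
  regroup : ∀ x y z s t → (x * y + 0ℤ) * z + (x * s + t) ≡ x * (y * z + s) + t
  regroup = solve-∀

-- Makes the binomial theorem applicable to power series, in `form-binomial`.
⊛-isCommutativeRing : IsCommutativeRing _≈ˢ_ _⊕_ _⊛_ ⊖_ 𝟘 𝟙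
⊛-isCommutativeRing = record
  { isRing = record
    { +-isAbelianGroup = record
      { isGroup = record
        { isMonoid = record
          { isSemigroup = record
            { isMagma = record
              { isEquivalence = record
                { refl = λ _ → refl ; sym = λ e d → sym (e d) ; trans = λ e e′ d → trans (e d) (e′ d) }
              ; ∙-cong = λ e e′ d → cong₂ _+_ (e d) (e′ d) }
            ; assoc = λ f g h d → ℤ.+-assoc (f d) (g d) (h d) }
          ; identity = (λ f d → ℤ.+-identityˡ (f d)) , (λ f d → ℤ.+-identityʳ (f d)) }
        ; inverse = (λ f d → ℤ.+-inverseˡ (f d)) , (λ f d → ℤ.+-inverseʳ (f d))
        ; ⁻¹-cong = λ e d → cong -_ (e d) }
      ; comm = λ f g d → ℤ.+-comm (f d) (g d) }
    ; *-cong = ⊛-cong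
    ; *-assoc = ⊛-assoc
    ; *-identity = ⊛-identityˡ , λ f d → trans (⊛-comm f 𝟙 d) (⊛-identityˡ f d)
    ; distrib =
        (λ f g h d → trans (⊛-comm f (g ⊕ h) d)
                    (trans (⊛-distribʳ f g h d) (cong₂ _+_ (⊛-comm g f d) (⊛-comm h f d))))
      , ⊛-distribʳ }
  ; *-comm = ⊛-comm }

series : CommutativeRing 0ℓ 0ℓ
series = record { isCommutativeRing = ⊛-isCommutativeRing }

𝕫-⊛-tail : ∀ f → tail (𝕫 ⊛ f) ≗ f
𝕫-⊛-tail f d = trans (ℤ.+-identityˡ ((tail 𝕫 ⊛ f) d))
  (trans (⊛-congʳ f {tail 𝕫} {𝟙} (λ { zero → refl ; (suc _) → refl }) d) (⊛-identityˡ f d))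

1-z-⊛ : ∀ f → (𝟙 ⊖ 𝕫) ⊛ f ≗ f ⊖ 𝕫 ⊛ f
1-z-⊛ f e = trans (⊛-distribʳ f 𝟙 (⊖ 𝕫) e)
  (cong₂ _+_ (⊛-identityˡ f e)
    (trans (⊛-congʳ f (λ i → sym (ℤ.-1*i≡-i (𝕫 i))) e)
    (trans (·-⊛ -1ℤ 𝕫 f e) (ℤ.-1*i≡-i ((𝕫 ⊛ f) e)))))

-- Homogeneous forms evaluated at power series

module 𝕊 = CommutativeRing series
import Algebra.Definitions.RawMonoid 𝕊.+-rawMonoid as Multˢ
import Algebra.Properties.CommutativeSemiring.Binomial 𝕊.commutativeSemiring as Binomialˢ
import Algebra.Properties.Semiring.Exp 𝕊.semiring as Expˢ
import Algebra.Properties.Semiring.Sum 𝕊.semiring as Sumˢ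

-- Homogeneous in x and y, so that the same coefficients can be evaluated at the constant series -1
-- and q, where they count colourings, and at 𝕫 and 𝟙 ⊖ 𝕫, where they give the h-polynomial.
form : (ℕ → ℤ) → ℕ → Series → Series → Series
form a n x y d = sum {suc n} λ i → a (toℕ i) * (x ^ˢ toℕ i ⊛ y ^ˢ (n ∸ toℕ i)) d

form-cong : ∀ {a b} n x y → (∀ i → i ℕ.≤ n → a i ≡ b i) → form a n x y ≗ form b n x y
form-cong n x y a≡b d = sum-cong-≗ {suc n} λ i →
  cong (_* (x ^ˢ toℕ i ⊛ y ^ˢ (n ∸ toℕ i)) d) (a≡b (toℕ i) (Fin.toℕ≤pred[n] i))

form-+ : ∀ a b n x y → form (λ i → a i + b i) n x y ≗ form a n x y ⊕ form b n x y
form-+ a b n x y d =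
  trans (sum-cong-≗ {suc n} λ i → ℤ.*-distribʳ-+ (term i) (a (toℕ i)) (b (toℕ i)))
        (∑-distrib-+ {suc n} (λ i → a (toℕ i) * term i) (λ i → b (toℕ i) * term i))
  where
  term : Fin (suc n) → ℤ
  term i = (x ^ˢ toℕ i ⊛ y ^ˢ (n ∸ toℕ i)) d

form-· : ∀ c a n x y → form (λ i → c * a i) n x y ≗ c · form a n x y
form-· c a n x y d =
  trans (sum-cong-≗ {suc n} λ i → ℤ.*-assoc c (a (toℕ i)) (term i))
        (sym (*-distribˡ-sum {suc n} c λ i → a (toℕ i) * term i))
  where
  term : Fin (suc n) → ℤ
  term i = (x ^ˢ toℕ i ⊛ y ^ˢ (n ∸ toℕ i)) d

form-monomial : ∀ {j} n x y → j ℕ.≤ n → form (λ i → ⟦ j ℕ.≟ i ⟧) n x y ≗ x ^ˢ j ⊛ y ^ˢ (n ∸ j)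
form-monomial {j} n x y j≤n d = begin
  sum {suc n} (λ i → ⟦ j ℕ.≟ toℕ i ⟧ * term (toℕ i))
    ≡⟨ sum-singleton k (λ i i≢k → trans (cong (_* term (toℕ i)) (⟦⟧-no (j ℕ.≟ toℕ i) (i≢k ∘ at i)))
                                        (ℤ.*-zeroˡ (term (toℕ i)))) ⟩
  ⟦ j ℕ.≟ toℕ k ⟧ * term (toℕ k)
    ≡⟨ cong (_* term (toℕ k)) (⟦⟧-yes (j ℕ.≟ toℕ k) (sym (Fin.toℕ-fromℕ< (ℕ.s≤s j≤n)))) ⟩
  1ℤ * term (toℕ k) ≡⟨ ℤ.*-identityˡ (term (toℕ k)) ⟩
  term (toℕ k)      ≡⟨ cong term (Fin.toℕ-fromℕ< (ℕ.s≤s j≤n)) ⟩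
  term j            ∎
  where
  open ≡-Reasoning
  k : Fin (suc n)
  k = fromℕ< (ℕ.s≤s j≤n)
  term : ℕ → ℤ
  term i = (x ^ˢ i ⊛ y ^ˢ (n ∸ i)) d
  at : ∀ i → j ≡ toℕ i → i ≡ k
  at i j≡i = Fin.toℕ-injective (trans (sym j≡i) (sym (Fin.toℕ-fromℕ< (ℕ.s≤s j≤n))))

^ˢ-cong : ∀ {f g} n → f ≗ g → f ^ˢ n ≗ g ^ˢ n
^ˢ-cong zero    f≗g d = refl
^ˢ-cong (suc n) f≗g d = ⊛-cong f≗g (^ˢ-cong n f≗g) d

^ˢ≗^ : ∀ f n → f ^ˢ n ≗ f Expˢ.^ n
^ˢ≗^ f zero    d = refl
^ˢ≗^ f (suc n) d = ⊛-congˡ f (^ˢ≗^ f n) d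

⊛-· : ∀ c f g → f ⊛ (c · g) ≗ c · (f ⊛ g)
⊛-· c f g d = trans (⊛-comm f (c · g) d)
             (trans (·-⊛ c g f d) (cong (c *_) (⊛-comm g f d)))

·-^ˢ : ∀ c f n → (c · f) ^ˢ n ≗ (c ^ n) · f ^ˢ n
·-^ˢ c f zero    d = sym (ℤ.*-identityˡ (𝟙 d))
·-^ˢ c f (suc n) d = begin
  ((c · f) ⊛ (c · f) ^ˢ n) d      ≡⟨ ⊛-congˡ (c · f) (·-^ˢ c f n) d ⟩
  ((c · f) ⊛ ((c ^ n) · f ^ˢ n)) d  ≡⟨ ·-⊛ c f ((c ^ n) · f ^ˢ n) d ⟩
  c * (f ⊛ ((c ^ n) · f ^ˢ n)) d    ≡⟨ cong (c *_) (⊛-· (c ^ n) f (f ^ˢ n) d) ⟩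
  c * ((c ^ n) * (f ⊛ f ^ˢ n) d)    ≡⟨ ℤ.*-assoc c (c ^ n) ((f ⊛ f ^ˢ n) d) ⟨
  c * (c ^ n) * (f ⊛ f ^ˢ n) d      ∎
  where open ≡-Reasoning

sumˢ-coefficient : ∀ n (F : Fin n → Series) d → Sumˢ.sum F d ≡ sum (λ i → F i d)
sumˢ-coefficient zero    F d = refl
sumˢ-coefficient (suc n) F d = cong (F zero d +_) (sumˢ-coefficient n (F ∘ suc) d)

×ˢ-coefficient : ∀ m f d → (m Multˢ.× f) d ≡ ℤ.+ m * f d
×ˢ-coefficient zero    f d = sym (ℤ.*-zeroˡ (f d))
×ˢ-coefficient (suc m) f d = trans (cong (f d +_) (×ˢ-coefficient m f d)) (sym (ℤ.suc-* (ℤ.+ m) (f d)))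

form-binomial : ∀ c n x y → form (λ i → ℤ.+ (n ℕ.C i) * c ^ i) n x y ≗ (c · x ⊕ y) ^ˢ n
form-binomial c n x y d = sym (begin
  ((c · x ⊕ y) ^ˢ n) d                          ≡⟨ ^ˢ≗^ (c · x ⊕ y) n d ⟩
  ((c · x ⊕ y) Expˢ.^ n) d                      ≡⟨ Binomialˢ.theorem n (c · x) y d ⟩
  Binomialˢ.binomialExpansion (c · x) y n d     ≡⟨ sumˢ-coefficient (suc n) (Binomialˢ.binomialTerm (c · x) y n) d ⟩
  sum (λ i → Binomialˢ.binomialTerm (c · x) y n i d) ≡⟨ sum-cong-≗ {suc n} (λ i → term (toℕ i)) ⟩
  form (λ i → ℤ.+ (n ℕ.C i) * c ^ i) n x y d      ∎)
  where
  open ≡-Reasoning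
  term : ∀ i → ((n ℕ.C i) Multˢ.× ((c · x) Expˢ.^ i ⊛ y Expˢ.^ (n ∸ i))) d ≡
               ℤ.+ (n ℕ.C i) * c ^ i * (x ^ˢ i ⊛ y ^ˢ (n ∸ i)) d
  term i = begin
    ((n ℕ.C i) Multˢ.× ((c · x) Expˢ.^ i ⊛ y Expˢ.^ (n ∸ i))) d
      ≡⟨ ×ˢ-coefficient (n ℕ.C i) ((c · x) Expˢ.^ i ⊛ y Expˢ.^ (n ∸ i)) d ⟩
    ℤ.+ (n ℕ.C i) * ((c · x) Expˢ.^ i ⊛ y Expˢ.^ (n ∸ i)) d
      ≡⟨ cong (ℤ.+ (n ℕ.C i) *_) (⊛-cong (λ e → sym (^ˢ≗^ (c · x) i e)) (λ e → sym (^ˢ≗^ y (n ∸ i) e)) d) ⟩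
    ℤ.+ (n ℕ.C i) * ((c · x) ^ˢ i ⊛ y ^ˢ (n ∸ i)) d
      ≡⟨ cong (ℤ.+ (n ℕ.C i) *_) (⊛-congʳ (y ^ˢ (n ∸ i)) (·-^ˢ c x i) d) ⟩
    ℤ.+ (n ℕ.C i) * (((c ^ i) · x ^ˢ i) ⊛ y ^ˢ (n ∸ i)) d
      ≡⟨ cong (ℤ.+ (n ℕ.C i) *_) (·-⊛ (c ^ i) (x ^ˢ i) (y ^ˢ (n ∸ i)) d) ⟩
    ℤ.+ (n ℕ.C i) * (c ^ i * (x ^ˢ i ⊛ y ^ˢ (n ∸ i)) d)
      ≡⟨ ℤ.*-assoc (ℤ.+ (n ℕ.C i)) (c ^ i) _ ⟨
    ℤ.+ (n ℕ.C i) * c ^ i * (x ^ˢ i ⊛ y ^ˢ (n ∸ i)) d ∎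

^ˢ-head : ∀ f n → (f ^ˢ n) 0 ≡ f 0 ^ n
^ˢ-head f zero    = refl
^ˢ-head f (suc n) = trans (⊛-head f (f ^ˢ n)) (cong (f 0 *_) (^ˢ-head f n))

form-head : ∀ a n x y → form a n x y 0 ≡ sum {suc n} λ i → a (toℕ i) * (x 0 ^ toℕ i * y 0 ^ (n ∸ toℕ i))
form-head a n x y = sum-cong-≗ {suc n} λ i → cong (a (toℕ i) *_)
  (trans (⊛-head (x ^ˢ toℕ i) (y ^ˢ (n ∸ toℕ i)))
         (cong₂ _*_ (^ˢ-head x (toℕ i)) (^ˢ-head y (n ∸ toℕ i))))

-- Integer polynomials determined by their values at positive integers

evaluate : (ℕ → ℤ) → ℕ → ℤ → ℤ
evaluate c n q = sum {suc n} λ i → c (toℕ i) * q ^ (n ∸ toℕ i)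

-- Horner's rule: the coefficients are listed from the leading one, `c 0`, down to the constant one.
evaluate-suc : ∀ c n q → evaluate c (suc n) q ≡ q * evaluate c n q + c (suc n)
evaluate-suc c n q = begin
  evaluate c (suc n) q
    ≡⟨ sum-init-last {suc n} (λ i → c (toℕ i) * q ^ (suc n ∸ toℕ i)) ⟩
  sum (λ (i : Fin (suc n)) → c (toℕ (inject₁ i)) * q ^ (suc n ∸ toℕ (inject₁ i)))
    + c (toℕ (fromℕ (suc n))) * q ^ (suc n ∸ toℕ (fromℕ (suc n)))
    ≡⟨ cong₂ _+_ (sum-cong-≗ {suc n} first) last ⟩
  sum (λ (i : Fin (suc n)) → q * (c (toℕ i) * q ^ (n ∸ toℕ i))) + c (suc n)
    ≡⟨ cong (_+ c (suc n)) (*-distribˡ-sum {suc n} q λ i → c (toℕ i) * q ^ (n ∸ toℕ i)) ⟨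
  q * evaluate c n q + c (suc n) ∎
  where
  open ≡-Reasoning
  pull : ∀ x y z → x * (y * z) ≡ y * (x * z)
  pull = solve-∀
  first : (i : Fin (suc n)) → c (toℕ (inject₁ i)) * q ^ (suc n ∸ toℕ (inject₁ i)) ≡
                              q * (c (toℕ i) * q ^ (n ∸ toℕ i))
  first i = begin
    c (toℕ (inject₁ i)) * q ^ (suc n ∸ toℕ (inject₁ i))
      ≡⟨ cong (λ j → c j * q ^ (suc n ∸ j)) (Fin.toℕ-inject₁ i) ⟩
    c (toℕ i) * q ^ (suc n ∸ toℕ i)
      ≡⟨ cong (λ k → c (toℕ i) * q ^ k) (ℕ.+-∸-assoc 1 (Fin.toℕ≤pred[n] i)) ⟩
    c (toℕ i) * (q * q ^ (n ∸ toℕ i)) ≡⟨ pull (c (toℕ i)) q (q ^ (n ∸ toℕ i)) ⟩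
    q * (c (toℕ i) * q ^ (n ∸ toℕ i)) ∎
  last : c (toℕ (fromℕ (suc n))) * q ^ (suc n ∸ toℕ (fromℕ (suc n))) ≡ c (suc n)
  last = begin
    c (toℕ (fromℕ (suc n))) * q ^ (suc n ∸ toℕ (fromℕ (suc n)))
      ≡⟨ cong (λ j → c j * q ^ (suc n ∸ j)) (Fin.toℕ-fromℕ (suc n)) ⟩
    c (suc n) * q ^ (n ∸ n) ≡⟨ cong (λ k → c (suc n) * q ^ k) (ℕ.n∸n≡0 n) ⟩
    c (suc n) * 1ℤ          ≡⟨ ℤ.*-identityʳ (c (suc n)) ⟩
    c (suc n)               ∎

-- The constant coefficient is divisible by every q ≥ 1, hence zero.
evaluate-zero : ∀ c n → (∀ k → evaluate c n (ℤ.+ suc k) ≡ 0ℤ) → ∀ i → i ℕ.≤ n → c i ≡ 0ℤ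
evaluate-zero c zero    vanishes zero    i≤n = begin
  c 0                 ≡⟨ ℤ.*-identityʳ (c 0) ⟨
  c 0 * 1ℤ            ≡⟨ ℤ.+-identityʳ (c 0 * 1ℤ) ⟨
  c 0 * 1ℤ + 0ℤ       ≡⟨ vanishes 0 ⟩
  0ℤ                  ∎
  where open ≡-Reasoning
evaluate-zero c (suc n) vanishes i i≤n = by-cases (ℕ.m≤n⇒m<n∨m≡n i≤n)
  where
  open ≡-Reasoning
  step : ∀ k → ℤ.+ suc k * evaluate c n (ℤ.+ suc k) + c (suc n) ≡ 0ℤ
  step k = trans (sym (evaluate-suc c n (ℤ.+ suc k))) (vanishes k)

  -- The value at q = K + 1 makes K = |c (n + 1)| a multiple of K + 1, which only K = 0 can be.
  K : ℕ
  K = ℤ.∣ c (suc n) ∣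

  value : ℤ
  value = evaluate c n (ℤ.+ suc K)

  abs : K ≡ suc K ℕ.* ℤ.∣ value ∣
  abs = begin
    ℤ.∣ c (suc n) ∣                                ≡⟨ ℤ.∣-i∣≡∣i∣ (c (suc n)) ⟨
    ℤ.∣ - c (suc n) ∣                              ≡⟨ cong ℤ.∣_∣ (isolate (ℤ.+ suc K * value) (c (suc n)) (step K)) ⟨
    ℤ.∣ ℤ.+ suc K * value ∣                        ≡⟨ ℤ.abs-* (ℤ.+ suc K) value ⟩
    suc K ℕ.* ℤ.∣ value ∣ ∎
    where
    isolate : ∀ x y → x + y ≡ 0ℤ → x ≡ - y
    isolate x y x+y≡0 = trans (trans (add-sub x y) (cong (_- y) x+y≡0)) (ℤ.+-identityˡ (- y))
      where
      add-sub : ∀ x y → x ≡ x + y - y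
      add-sub = solve-∀

  K≡0 : ∀ v → K ≡ suc K ℕ.* v → K ≡ 0
  K≡0 zero    K≡ = trans K≡ (ℕ.*-zeroʳ (suc K))
  K≡0 (suc v) K≡ = contradiction (ℕ.≤-trans (ℕ.m≤m*n (suc K) (suc v)) (ℕ.≤-reflexive (sym K≡))) (ℕ.<-irrefl refl)

  c≡0 : c (suc n) ≡ 0ℤ
  c≡0 = ℤ.∣i∣≡0⇒i≡0 (K≡0 ℤ.∣ value ∣ abs)

  -- With the constant coefficient gone, q = k + 1 cancels from Horner's rule and the induction
  -- applies to the remaining coefficients.
  vanishes′ : ∀ k → evaluate c n (ℤ.+ suc k) ≡ 0ℤ
  vanishes′ k = ℤ.*-cancelˡ-≡ (ℤ.+ suc k) _ _ (begin
    ℤ.+ suc k * evaluate c n (ℤ.+ suc k)              ≡⟨ ℤ.+-identityʳ _ ⟨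
    ℤ.+ suc k * evaluate c n (ℤ.+ suc k) + 0ℤ         ≡⟨ cong (_+_ (ℤ.+ suc k * evaluate c n (ℤ.+ suc k))) c≡0 ⟨
    ℤ.+ suc k * evaluate c n (ℤ.+ suc k) + c (suc n)  ≡⟨ step k ⟩
    0ℤ                                                ≡⟨ ℤ.*-zeroʳ (ℤ.+ suc k) ⟨
    ℤ.+ suc k * 0ℤ                                    ∎)

  by-cases : i ℕ.< suc n ⊎ i ≡ suc n → c i ≡ 0ℤ
  by-cases (inj₁ i<1+n) = evaluate-zero c n vanishes′ i (ℕ.≤-pred i<1+n)
  by-cases (inj₂ refl)  = c≡0

constant : ℤ → Series
constant c = c · 𝟙

-1^i≢0 : ∀ i {x} → x * -1ℤ ^ i ≡ 0ℤ → x ≡ 0ℤ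
-1^i≢0 zero    {x} eq = trans (sym (ℤ.*-identityʳ x)) eq
-1^i≢0 (suc i) {x} eq = trans (sym (ℤ.neg-involutive x)) (cong -_ (-1^i≢0 i (trans (flip x (-1ℤ ^ i)) eq)))
  where
  flip : ∀ x y → - x * y ≡ x * (-1ℤ * y)
  flip = solve-∀

-- At x = -1 and y = q the difference of the two forms is the polynomial in q with coefficients (a i
-- - b i)(-1)ⁱ, so `evaluate-zero` applies. The index 0 picks the only coefficient of a constant
-- series that can be nonzero.
form-injective : ∀ a b n →
  (∀ k → form a n (constant -1ℤ) (constant (ℤ.+ suc k)) 0 ≡ form b n (constant -1ℤ) (constant (ℤ.+ suc k)) 0) →
  ∀ i → i ℕ.≤ n → a i ≡ b i
form-injective a b n eq i i≤n = ℤ.i-j≡0⇒i≡j (a i) (b i) (-1^i≢0 i (evaluate-zero c n vanishes i i≤n))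
  where
  open ≡-Reasoning
  c : ℕ → ℤ
  c i = (a i - b i) * -1ℤ ^ i
  vanishes : ∀ k → evaluate c n (ℤ.+ suc k) ≡ 0ℤ
  vanishes k = begin
    evaluate c n q ≡⟨ sum-cong-≗ {suc n} (λ i → ℤ.*-assoc (a (toℕ i) - b (toℕ i)) (-1ℤ ^ toℕ i) (q ^ (n ∸ toℕ i))) ⟩
    sum {suc n} (λ i → (a (toℕ i) - b (toℕ i)) * (-1ℤ ^ toℕ i * q ^ (n ∸ toℕ i)))
      -- The head of the series `constant q` is literally `q * 1ℤ`.
      ≡⟨ sum-cong-≗ {suc n} (λ i → cong ((a (toℕ i) - b (toℕ i)) *_) (cong (λ p → -1ℤ ^ toℕ i * p ^ (n ∸ toℕ i)) (sym (ℤ.*-identityʳ q)))) ⟩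
    sum {suc n} (λ i → (a (toℕ i) - b (toℕ i)) * (-1ℤ ^ toℕ i * (q * 1ℤ) ^ (n ∸ toℕ i)))
      ≡⟨ form-head (λ i → a i - b i) n x y ⟨
    form (λ i → a i - b i) n x y 0
      ≡⟨ form-+ a (λ i → - b i) n x y 0 ⟩
    form a n x y 0 + form (λ i → - b i) n x y 0
      ≡⟨ cong₂ _+_ (eq k) (form-cong n x y (λ i _ → sym (ℤ.-1*i≡-i (b i))) 0) ⟩
    form b n x y 0 + form (λ i → -1ℤ * b i) n x y 0
      ≡⟨ cong (form b n x y 0 +_) (form-· -1ℤ b n x y 0) ⟩
    form b n x y 0 + -1ℤ * form b n x y 0
      ≡⟨ cancel (form b n x y 0) ⟩
    0ℤ ∎
    where
    q : ℤ
    q = ℤ.+ suc k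
    x y : Series
    x = constant -1ℤ
    y = constant q
    cancel : ∀ z → z + -1ℤ * z ≡ 0ℤ
    cancel = solve-∀

-- Whitney's broken circuit theorem

private variable
  m n q v N : ℕ

∑-allSubsets : ∀ m (f : Subset (suc m) → ℤ) →
               ∑ₗ (allSubsets (suc m)) f ≡
               ∑ₗ (allSubsets m) (f ∘ (outside ∷_)) + ∑ₗ (allSubsets m) (f ∘ (inside ∷_))
∑-allSubsets m f =
  trans (∑ₗ-++ (map (outside ∷_) (allSubsets m)) (map (inside ∷_) (allSubsets m)) f)
        (cong₂ _+_ (∑ₗ-map (outside ∷_) (allSubsets m) f) (∑ₗ-map (inside ∷_) (allSubsets m) f))

toggle : ∀ {m} → Fin m → Subset m → Subset m
toggle e S = updateAt S e not

toggle-involutive : ∀ {m} (e : Fin m) S → toggle e (toggle e S) ≡ S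
toggle-involutive e S = trans (Vec.updateAt-updateAt e S)
  (trans (Vec.updateAt-cong e Bool.not-involutive S) (Vec.updateAt-id e S))

∈-toggle : ∀ {m} {e f : Fin m} S → f ≢ e → f ∈ S → f ∈ toggle e S
∈-toggle {e = e} {f} S f≢e = Vec.updateAt-minimal f e S f≢e

∈-toggle⁻ : ∀ {m} {e f : Fin m} S → f ≢ e → f ∈ toggle e S → f ∈ S
∈-toggle⁻ {e = e} S f≢e f∈ = subst (_ ∈_) (toggle-involutive e S) (∈-toggle (toggle e S) f≢e f∈)

∑-toggle : ∀ {m} (e : Fin m) (f : Subset m → ℤ) →
           ∑ₗ (allSubsets m) (f ∘ toggle e) ≡ ∑ₗ (allSubsets m) f
∑-toggle {suc m} zero f = begin
  ∑ₗ (allSubsets (suc m)) (f ∘ toggle zero) ≡⟨ ∑-allSubsets m (f ∘ toggle zero) ⟩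
  ∑ₗ (allSubsets m) (f ∘ (inside ∷_)) + ∑ₗ (allSubsets m) (f ∘ (outside ∷_))
    ≡⟨ ℤ.+-comm (∑ₗ (allSubsets m) (f ∘ (inside ∷_))) _ ⟩
  ∑ₗ (allSubsets m) (f ∘ (outside ∷_)) + ∑ₗ (allSubsets m) (f ∘ (inside ∷_))
    ≡⟨ ∑-allSubsets m f ⟨
  ∑ₗ (allSubsets (suc m)) f ∎
  where open ≡-Reasoning
∑-toggle {suc m} (suc e) f =
  trans (∑-allSubsets m (f ∘ toggle (suc e)))
 (trans (cong₂ _+_ (∑-toggle e (f ∘ (outside ∷_))) (∑-toggle e (f ∘ (inside ∷_))))
        (sym (∑-allSubsets m f)))

i≡-i⇒i≡0 : ∀ {i} → i ≡ - i → i ≡ 0ℤ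
i≡-i⇒i≡0 {ℤ.+ zero} eq = refl

-- Toggling e permutes the subsets, so the sum equals its own negative.
∑-toggle-odd : ∀ {m} (e : Fin m) (f : Subset m → ℤ) → (∀ S → f (toggle e S) ≡ - f S) →
               ∑ₗ (allSubsets m) f ≡ 0ℤ
∑-toggle-odd {m} e f odd = i≡-i⇒i≡0
  (trans (sym (∑-toggle e f)) (trans (∑ₗ-cong (allSubsets m) odd) (∑ₗ-neg (allSubsets m) f)))

sgn : ∀ {m} → Subset m → ℤ
sgn S = -1ℤ ^ ∣ S ∣

sgn-toggle : ∀ {m} (e : Fin m) S → sgn (toggle e S) ≡ - sgn S
sgn-toggle zero    (outside ∷ S) = ℤ.-1*i≡-i (sgn S)
sgn-toggle zero    (inside ∷ S)  = sym (trans (cong -_ (ℤ.-1*i≡-i (sgn S))) (ℤ.neg-involutive (sgn S)))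
sgn-toggle (suc e) (outside ∷ S) = sgn-toggle e S
sgn-toggle (suc e) (inside ∷ S)  =
  trans (cong (-1ℤ *_) (sgn-toggle e S)) (sym (ℤ.neg-distribʳ-* -1ℤ (sgn S)))

∏ : ∀ {m} → (Fin m → ℤ) → ℤ
∏ {zero}  w = 1ℤ
∏ {suc m} w = w zero * ∏ (w ∘ suc)

∏-cong : ∀ {m} {w w′ : Fin m → ℤ} → w ≗ w′ → ∏ w ≡ ∏ w′
∏-cong {zero}  w≗ = refl
∏-cong {suc m} w≗ = cong₂ _*_ (w≗ zero) (∏-cong (w≗ ∘ suc))

Lift-∷-outside : ∀ {m} {P : Fin (suc m) → Set ℓp} {S} → Lift (P ∘ suc) S → Lift P (outside ∷ S)
Lift-∷-outside lift (there x∈) = lift x∈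

Lift-∷-inside : ∀ {m} {P : Fin (suc m) → Set ℓp} {S} → P zero → Lift (P ∘ suc) S → Lift P (inside ∷ S)
Lift-∷-inside p lift here       = p
Lift-∷-inside p lift (there x∈) = lift x∈

⟦Lift?⟧-outside : ∀ {m} {P : Fin (suc m) → Set ℓp} (P? : U.Decidable P) S →
                  ⟦ Lift? P? (outside ∷ S) ⟧ ≡ ⟦ Lift? (P? ∘ suc) S ⟧
⟦Lift?⟧-outside P? S = ⟦⟧-cong (Lift? P? (outside ∷ S)) (Lift? (P? ∘ suc) S)
  (λ lift x∈ → lift (there x∈)) Lift-∷-outside

⟦Lift?⟧-inside : ∀ {m} {P : Fin (suc m) → Set ℓp} (P? : U.Decidable P) S →
                 ⟦ Lift? P? (inside ∷ S) ⟧ ≡ ⟦ P? zero ⟧ * ⟦ Lift? (P? ∘ suc) S ⟧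
⟦Lift?⟧-inside {P = P} P? S = trans
  (⟦⟧-cong (Lift? P? (inside ∷ S)) (P? zero ×-dec Lift? (P? ∘ suc) S)
    (λ lift → lift here , λ x∈ → lift (there x∈)) (λ (p , lift) → Lift-∷-inside {P = P} p lift))
  (⟦⟧-× (P? zero) (Lift? (P? ∘ suc) S))

-- Inclusion-exclusion: in the expansion of the product, S collects the factors from which the term
-- -⟦ P? e ⟧ is taken.
∑-sgn-Lift : ∀ {m} {P : Fin m → Set ℓp} (P? : U.Decidable P) →
             ∑ₗ (allSubsets m) (λ S → sgn S * ⟦ Lift? P? S ⟧) ≡ ∏ (λ e → 1ℤ - ⟦ P? e ⟧)
∑-sgn-Lift {m = zero}  P? = cong (_+ 0ℤ) (trans (ℤ.*-identityˡ _) (⟦⟧-yes (Lift? P? []) λ ()))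
∑-sgn-Lift {m = suc m} P? = begin
  ∑ₗ (allSubsets (suc m)) (λ S → sgn S * ⟦ Lift? P? S ⟧)
    ≡⟨ ∑-allSubsets m (λ S → sgn S * ⟦ Lift? P? S ⟧) ⟩
  ∑ₗ (allSubsets m) (λ S → sgn S * ⟦ Lift? P? (outside ∷ S) ⟧)
    + ∑ₗ (allSubsets m) (λ S → -1ℤ * sgn S * ⟦ Lift? P? (inside ∷ S) ⟧)
    ≡⟨ cong₂ _+_ (∑ₗ-cong (allSubsets m) out) (trans (∑ₗ-cong (allSubsets m) ins) (sym (*-∑ₗ (- d) (allSubsets m) rest))) ⟩
  ∑ₗ (allSubsets m) rest + - d * ∑ₗ (allSubsets m) rest
    ≡⟨ cong (λ s → s + - d * s) (∑-sgn-Lift (P? ∘ suc)) ⟩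
  Π + - d * Π        ≡⟨ factor d Π ⟩
  (1ℤ - d) * Π       ∎
  where
  open ≡-Reasoning
  d Π : ℤ
  d = ⟦ P? zero ⟧
  Π = ∏ (λ e → 1ℤ - ⟦ P? (suc e) ⟧)
  rest : Subset m → ℤ
  rest S = sgn S * ⟦ Lift? (P? ∘ suc) S ⟧
  out : ∀ S → sgn S * ⟦ Lift? P? (outside ∷ S) ⟧ ≡ rest S
  out S = cong (sgn S *_) (⟦Lift?⟧-outside P? S)
  regroup : ∀ s d l → -1ℤ * s * (d * l) ≡ - d * (s * l)
  regroup = solve-∀
  ins : ∀ S → -1ℤ * sgn S * ⟦ Lift? P? (inside ∷ S) ⟧ ≡ - d * rest S
  ins S = trans (cong (-1ℤ * sgn S *_) (⟦Lift?⟧-inside P? S)) (regroup (sgn S) d _)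
  factor : ∀ d x → x + - d * x ≡ (1ℤ - d) * x
  factor = solve-∀

-- Cyclic sequences, edge sets of cycles and monochromatic edges

next-inject₁ : ∀ {k} (i : Fin k) → next (inject₁ i) ≡ suc i
next-inject₁ {k} i = Fin.toℕ-injective (begin
  toℕ (next (inject₁ i))             ≡⟨ Fin.toℕ-fromℕ< (m%n<n (suc (toℕ (inject₁ i))) (suc k)) ⟩
  suc (toℕ (inject₁ i)) ℕ.% suc k    ≡⟨ cong (λ j → suc j ℕ.% suc k) (Fin.toℕ-inject₁ i) ⟩
  suc (toℕ i) ℕ.% suc k              ≡⟨ m<n⇒m%n≡m (ℕ.s≤s (Fin.toℕ<n i)) ⟩
  suc (toℕ i)                        ∎)
  where open ≡-Reasoning

next-fromℕ : ∀ k → next (fromℕ k) ≡ zero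
next-fromℕ k = Fin.toℕ-injective (begin
  toℕ (next (fromℕ k))             ≡⟨ Fin.toℕ-fromℕ< (m%n<n (suc (toℕ (fromℕ k))) (suc k)) ⟩
  suc (toℕ (fromℕ k)) ℕ.% suc k    ≡⟨ cong (λ j → suc j ℕ.% suc k) (Fin.toℕ-fromℕ k) ⟩
  suc k ℕ.% suc k                  ≡⟨ n%n≡0 (suc k) ⟩
  0                                ∎)
  where open ≡-Reasoning

sum-next : ∀ {k} (g : Fin (suc k) → ℤ) → sum (g ∘ next) ≡ sum g
sum-next {k} g = begin
  sum (g ∘ next)                                       ≡⟨ sum-init-last (g ∘ next) ⟩
  sum (λ i → g (next (inject₁ i))) + g (next (fromℕ k))
    ≡⟨ cong₂ _+_ (sum-cong-≗ {k} λ i → cong g (next-inject₁ i)) (cong g (next-fromℕ k)) ⟩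
  sum (g ∘ suc) + g zero                               ≡⟨ ℤ.+-comm (sum (g ∘ suc)) (g zero) ⟩
  g zero + sum (g ∘ suc)                               ∎
  where open ≡-Reasoning

-- The differences of the indicator of {i ∣ f i ≡ f j} around the cycle sum to 0.
cyclic-≡ : ∀ {k} {K : Set ℓp} (_≟_ : Binary.DecidableEquality K) (f : Fin (suc k) → K) j →
           (∀ i → i ≢ j → f i ≡ f (next i)) → f j ≡ f (next j)
cyclic-≡ {k = k} _≟_ f j eq = sym (decidable-stable (f (next j) ≟ f j) λ f≢ →
  contradiction (trans (sym difference-0) (difference-1 f≢)) λ ())
  where
  open ≡-Reasoning
  g : Fin (suc k) → ℤ
  g i = ⟦ f i ≟ f j ⟧
  difference : ℤ
  difference = g j + -1ℤ * g (next j)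
  cancel : ∀ x → x + -1ℤ * x ≡ 0ℤ
  cancel = solve-∀
  difference-0 : difference ≡ 0ℤ
  difference-0 = begin
    difference
      ≡⟨ sum-singleton j (λ i i≢j → trans (cong (λ x → g i + -1ℤ * ⟦ x ≟ f j ⟧) (sym (eq i i≢j))) (cancel (g i))) ⟨
    sum {suc k} (λ i → g i + -1ℤ * g (next i))
      ≡⟨ ∑-distrib-+ {suc k} g (λ i → -1ℤ * g (next i)) ⟩
    sum g + sum {suc k} (λ i → -1ℤ * g (next i))
      ≡⟨ cong (sum g +_) (*-distribˡ-sum {suc k} -1ℤ (g ∘ next)) ⟨
    sum g + -1ℤ * sum (g ∘ next)
      ≡⟨ cong (λ x → sum g + -1ℤ * x) (sum-next g) ⟩
    sum g + -1ℤ * sum g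
      ≡⟨ cancel (sum g) ⟩
    0ℤ ∎
  difference-1 : f (next j) ≢ f j → difference ≡ 1ℤ
  difference-1 f≢ = cong₂ (λ x y → x + -1ℤ * y) (⟦⟧-yes (f j ≟ f j) refl) (⟦⟧-no (f (next j) ≟ f j) f≢)

x∉p-x : ∀ {m} (x : Fin m) p → x ∉ p ∖ x
x∉p-x zero    (s ∷ p) ()
x∉p-x (suc x) (s ∷ p) (there x∈) = x∉p-x x p x∈

∈-edgeSet⁺ : ∀ {m n} (es : Vec (Fin m) n) i → lookup es i ∈ edgeSet es
∈-edgeSet⁺ (e ∷ es) zero    = x∈p∪q⁺ (inj₁ (x∈⁅x⁆ e))
∈-edgeSet⁺ (e ∷ es) (suc i) = x∈p∪q⁺ (inj₂ (∈-edgeSet⁺ es i))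

∈-edgeSet⁻ : ∀ {m n} (es : Vec (Fin m) n) {e} → e ∈ edgeSet es → ∃ λ i → lookup es i ≡ e
∈-edgeSet⁻ []       e∈ = contradiction e∈ ∉⊥
∈-edgeSet⁻ (f ∷ es) e∈ with x∈p∪q⁻ ⁅ f ⁆ (edgeSet es) e∈
... | inj₁ e∈f  = zero , sym (x∈⁅y⁆⇒x≡y f e∈f)
... | inj₂ e∈es with i , eq ← ∈-edgeSet⁻ es e∈es = suc i , eq

module _ {A : Set} {r} {_≤_ : Rel A r} (ord : IsTotalOrder _≡_ _≤_) where
  private module ≤ = IsTotalOrder ord

  none∨least : ∀ {P : A → Set ℓp} → U.Decidable P → (xs : List A) →
               All (λ x → ¬ P x) xs ⊎ ∃ λ x → P x × All (λ y → P y → x ≤ y) xs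
  none∨least P? [] = inj₁ []
  none∨least P? (x ∷ xs) with P? x | none∨least P? xs
  ... | no ¬px | inj₁ none             = inj₁ (¬px ∷ none)
  ... | no ¬px | inj₂ (y , py , least) = inj₂ (y , py , (λ px → contradiction px ¬px) ∷ least)
  ... | yes px | inj₁ none             =
    inj₂ (x , px , (λ _ → ≤.refl) ∷ All.map (λ ¬py py → contradiction py ¬py) none)
  ... | yes px | inj₂ (y , py , least) with ≤.total x y
  ...   | inj₁ x≤y = inj₂ (x , px , (λ _ → ≤.refl) ∷ All.map (λ y≤ pz → ≤.trans x≤y (y≤ pz)) least)
  ...   | inj₂ y≤x = inj₂ (y , py , (λ _ → y≤x) ∷ least)

least-Fin : ∀ {m r} {_≤_ : Rel (Fin m) r} → IsTotalOrder _≡_ _≤_ →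
            {P : Fin m → Set ℓp} → U.Decidable P → ∃ P → ∃ λ x → P x × ∀ y → P y → x ≤ y
least-Fin {m = m} ord P? (x , px) with none∨least ord P? (allFin m)
... | inj₁ none            = contradiction px (All.lookup none (∈-allFin x))
... | inj₂ (y , py , least) = y , py , λ z → All.lookup least (∈-allFin z)

module _ (G : Graph) {K : Set} (_≟_ : Binary.DecidableEquality K) (c : Vec K (#V G)) where

  Mono : Edge G → Set
  Mono e = lookup c (proj₁ (ends G e)) ≡ lookup c (proj₂ (ends G e))

  mono? : U.Decidable Mono
  mono? e = lookup c (proj₁ (ends G e)) ≟ lookup c (proj₂ (ends G e))

  Mono-joins : ∀ {e u v} → Joins G e u v → Mono e → lookup c u ≡ lookup c v
  Mono-joins (inj₁ eq) m = subst (λ (u , v) → lookup c u ≡ lookup c v) eq m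
  Mono-joins (inj₂ eq) m = sym (subst (λ (u , v) → lookup c u ≡ lookup c v) eq m)

  joins-Mono : ∀ {e u v} → Joins G e u v → lookup c u ≡ lookup c v → Mono e
  joins-Mono (inj₁ eq) m = subst (λ (u , v) → lookup c u ≡ lookup c v) (sym eq) m
  joins-Mono (inj₂ eq) m = subst (λ (u , v) → lookup c u ≡ lookup c v) (sym eq) (sym m)

  -- Around a cycle the colour cannot change at exactly one edge. Consequently, adding the edge that
  -- closes a broken circuit of S puts no further condition on a colouring constant on the edges of
  -- S.
  cycle-Mono : ∀ {C e} → IsCycleEdgeSet G C → e ∈ C → Lift Mono (C ∖ e) → Mono e
  cycle-Mono (k , vs , es , (_ , es! , joins) , refl) e∈C mono with j , refl ← ∈-edgeSet⁻ es e∈C =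
    joins-Mono (joins j) (cyclic-≡ _≟_ (lookup c ∘ lookup vs) j λ i i≢j →
      Mono-joins (joins i) (mono (x∈p∧x≢y⇒x∈p-y (∈-edgeSet⁺ es i) (i≢j ∘ lookup-injective es! i j))))

module BrokenCircuits (G : Graph) {ℓ} {_≤_ : Rel (Edge G) ℓ} (ord : IsTotalOrder _≡_ _≤_) where
  private module ≤ = IsTotalOrder ord

  _≤?_ : Binary.Decidable _≤_
  _≤?_ = total∧dec⇒dec ≤.reflexive ≤.antisym ≤.total Fin._≟_

  -- The edge e may or may not belong to S. This freedom is what makes toggling e compatible with
  -- the notion.
  Closes : Subset (#E G) → Edge G → Set ℓ
  Closes S e = Σ (Subset (#E G)) λ C → IsCycleEdgeSet G C × IsMax G _≤_ C e × C ∖ e ⊆ S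

  closes? : ∀ S → U.Decidable (Closes S)
  closes? S e = anySubset? λ C →
    isCycleEdgeSet? G C ×-dec
    ((e ∈? C) ×-dec Fin.all? λ f → (f ∈? C) →-dec (f ≤? e)) ×-dec
    (C ∖ e ⊆? S)

  LeastClosing : Subset (#E G) → Edge G → Set ℓ
  LeastClosing S e = Closes S e × ∀ f → Closes S f → e ≤ f

  leastClosing? : ∀ S → U.Decidable (LeastClosing S)
  leastClosing? S e = closes? S e ×-dec Fin.all? λ f → closes? S f →-dec (e ≤? f)

  closes⇒¬face : ∀ {S e} → Closes S e → ¬ IsFace G _≤_ S
  closes⇒¬face (C , cyc , max , C-e⊆S) face = face (C ∖ _ , (C , _ , cyc , max , refl) , C-e⊆S)

  face∨closes : ∀ S → IsFace G _≤_ S ⊎ ∃ (Closes S)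
  face∨closes S with Fin.any? (closes? S)
  ... | yes closes = inj₂ closes
  ... | no ¬closes = inj₁ λ { (_ , (C , e , cyc , max , refl) , ⊆S) → ¬closes (e , C , cyc , max , ⊆S) }

  -- A nonface has a closing edge, and the least one is unique by antisymmetry. So the subsets split
  -- into the faces and, for each edge e, those whose least closing edge is e.
  ∑-leastClosing : ∀ S → ⟦ isFace? G ord S ⟧ + sum (λ e → ⟦ leastClosing? S e ⟧) ≡ 1ℤ
  ∑-leastClosing S = [ is-face , is-not-face ∘ least-Fin ord (closes? S) ]′ (face∨closes S)
    where
    is-face : IsFace G _≤_ S → ⟦ isFace? G ord S ⟧ + sum (λ e → ⟦ leastClosing? S e ⟧) ≡ 1ℤ
    is-face face = cong₂ _+_ (⟦⟧-yes (isFace? G ord S) face)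
      (sum-zero (#E G) λ e → ⟦⟧-no (leastClosing? S e) λ (cl , _) → closes⇒¬face cl face)

    is-not-face : ∃ (LeastClosing S) → ⟦ isFace? G ord S ⟧ + sum (λ e → ⟦ leastClosing? S e ⟧) ≡ 1ℤ
    is-not-face (e , cl , least) =
      cong₂ _+_ (⟦⟧-no (isFace? G ord S) (closes⇒¬face cl))
        (trans (sum-singleton e λ f f≢e → ⟦⟧-no (leastClosing? S f) λ (cl′ , least′) →
                 f≢e (≤.antisym (least′ e cl) (least f cl′)))
               (⟦⟧-yes (leastClosing? S e) (cl , least)))

  -- The edges of C ∖ f lie strictly below f, hence strictly below e: the broken circuit avoids e
  -- and survives the toggle.
  closes-toggle : ∀ {S e f} → f ≤ e → Closes S f → Closes (toggle e S) f
  closes-toggle {S} {e} {f} f≤e (C , cyc , max@(f∈C , ≤f) , C-f⊆S) =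
    C , cyc , max , λ x∈ → ∈-toggle S (λ { refl → e∉ x∈ }) (C-f⊆S x∈)
    where
    e∉ : e ∉ C ∖ f
    e∉ e∈ = x∉p-x f C (subst (_∈ C ∖ f) (≤.antisym (≤f e (p─q⊆p C ⁅ f ⁆ e∈)) f≤e) e∈)

  -- Closing edges f ≤ e persist under the toggle in both directions, so no smaller one can appear.
  -- This is why the least closing edge is the one to toggle.
  leastClosing-toggle : ∀ {S e} → LeastClosing S e → LeastClosing (toggle e S) e
  leastClosing-toggle {S} {e} (cl , least) = closes-toggle ≤.refl cl , least′
    where
    least′ : ∀ f → Closes (toggle e S) f → e ≤ f
    least′ f cl′ with ≤.total e f
    ... | inj₁ e≤f = e≤f
    ... | inj₂ f≤e = least f (subst (λ S → Closes S f) (toggle-involutive e S) (closes-toggle f≤e cl′))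

  leastClosing-toggle⁻ : ∀ {S e} → LeastClosing (toggle e S) e → LeastClosing S e
  leastClosing-toggle⁻ {S} {e} lc =
    subst (λ S → LeastClosing S e) (toggle-involutive e S) (leastClosing-toggle lc)

  module _ {K : Set} (_≟_ : Binary.DecidableEquality K) (c : Vec K (#V G)) where
    private
      M : Edge G → Set
      M = Mono G _≟_ c
      M? : U.Decidable M
      M? = mono? G _≟_ c

    closes-Mono : ∀ {S e} → Closes S e → Lift M S → Lift M (toggle e S)
    closes-Mono {S} {e} (C , cyc , (e∈C , _) , C-e⊆S) mono {x} x∈ with x Fin.≟ e
    ... | yes refl = cycle-Mono G _≟_ c cyc e∈C (mono ∘ C-e⊆S)
    ... | no x≢e   = mono (∈-toggle⁻ S x≢e x∈)

    closes-Mono⁻ : ∀ {S e} → Closes S e → Lift M (toggle e S) → Lift M S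
    closes-Mono⁻ {S} {e} cl mono =
      subst (Lift M) (toggle-involutive e S) (closes-Mono (closes-toggle ≤.refl cl) mono)

    private
      W : Subset (#E G) → ℤ
      W S = sgn S * ⟦ Lift? M? S ⟧

      closing : Edge G → Subset (#E G) → ℤ
      closing e S = ⟦ leastClosing? S e ⟧ * W S

      closing-odd : ∀ e S → closing e (toggle e S) ≡ - closing e S
      closing-odd e S = begin
        ⟦ leastClosing? (toggle e S) e ⟧ * W (toggle e S)
          ≡⟨ cong (_* W (toggle e S)) (⟦⟧-cong (leastClosing? (toggle e S) e) (leastClosing? S e)
               leastClosing-toggle⁻ leastClosing-toggle) ⟩
        ⟦ leastClosing? S e ⟧ * W (toggle e S)
          ≡⟨ ⟦⟧-*-cong (leastClosing? S e) (λ (cl , _) →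
               cong₂ _*_ (sgn-toggle e S) (⟦⟧-cong (Lift? M? (toggle e S)) (Lift? M? S) (closes-Mono⁻ cl) (closes-Mono cl))) ⟩
        ⟦ leastClosing? S e ⟧ * (- sgn S * ⟦ Lift? M? S ⟧)
          ≡⟨ pull ⟦ leastClosing? S e ⟧ (sgn S) ⟦ Lift? M? S ⟧ ⟩
        - closing e S ∎
        where
        open ≡-Reasoning
        pull : ∀ x y z → x * (- y * z) ≡ - (x * (y * z))
        pull = solve-∀

    -- Whitney's broken circuit theorem, one colouring at a time: toggling the least
    -- edge that closes a broken circuit of S cancels the sets that are not faces.
    ∑-faces-Mono : ∑ₗ (allSubsets (#E G)) (λ S → ⟦ isFace? G ord S ⟧ * (sgn S * ⟦ Lift? M? S ⟧)) ≡
                   ∏ (λ e → 1ℤ - ⟦ M? e ⟧)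
    ∑-faces-Mono = begin
      ∑ₗ Ss (λ S → ⟦ isFace? G ord S ⟧ * W S)
        ≡⟨ ℤ.+-identityʳ _ ⟨
      ∑ₗ Ss (λ S → ⟦ isFace? G ord S ⟧ * W S) + 0ℤ
        ≡⟨ cong (_+_ (∑ₗ Ss λ S → ⟦ isFace? G ord S ⟧ * W S)) nonfaces ⟨
      ∑ₗ Ss (λ S → ⟦ isFace? G ord S ⟧ * W S) + ∑ₗ Ss (λ S → sum (λ e → closing e S))
        ≡⟨ ∑ₗ-+ Ss (λ S → ⟦ isFace? G ord S ⟧ * W S) (λ S → sum (λ e → closing e S)) ⟨
      ∑ₗ Ss (λ S → ⟦ isFace? G ord S ⟧ * W S + sum (λ e → closing e S))
        ≡⟨ ∑ₗ-cong Ss total ⟩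
      ∑ₗ Ss W
        ≡⟨ ∑-sgn-Lift M? ⟩
      ∏ (λ e → 1ℤ - ⟦ M? e ⟧) ∎
      where
      open ≡-Reasoning
      Ss : List (Subset (#E G))
      Ss = allSubsets (#E G)

      nonfaces : ∑ₗ Ss (λ S → sum (λ e → closing e S)) ≡ 0ℤ
      nonfaces = trans (sym (sum-∑ₗ-swap Ss closing))
                       (sum-zero (#E G) λ e → ∑-toggle-odd e (closing e) (closing-odd e))

      total : ∀ S → ⟦ isFace? G ord S ⟧ * W S + sum (λ e → closing e S) ≡ W S
      total S = begin
        f * W S + sum (λ e → closing e S)
          ≡⟨ cong (f * W S +_) (*-distribʳ-sum (W S) (λ e → ⟦ leastClosing? S e ⟧)) ⟨
        f * W S + sum (λ e → ⟦ leastClosing? S e ⟧) * W S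
          ≡⟨ ℤ.*-distribʳ-+ (W S) f _ ⟨
        (f + sum (λ e → ⟦ leastClosing? S e ⟧)) * W S
          ≡⟨ cong (_* W S) (∑-leastClosing S) ⟩
        1ℤ * W S
          ≡⟨ ℤ.*-identityˡ (W S) ⟩
        W S ∎
        where
        f : ℤ
        f = ⟦ isFace? G ord S ⟧

-- Colourings constant on a forest

∑ₗ-cartesianProductWith : (h : A → B → C) (xs : List A) (ys : List B) (f : C → ℤ) →
  ∑ₗ (cartesianProductWith h xs ys) f ≡ ∑ₗ xs (λ x → ∑ₗ ys (λ y → f (h x y)))
∑ₗ-cartesianProductWith h []       ys f = refl
∑ₗ-cartesianProductWith h (x ∷ xs) ys f =
  trans (∑ₗ-++ (map (h x) ys) _ f) (cong₂ _+_ (∑ₗ-map (h x) ys f) (∑ₗ-cartesianProductWith h xs ys f))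

sum-const : ∀ n x → sum {n} (λ _ → x) ≡ ℤ.+ n * x
sum-const zero    x = sym (ℤ.*-zeroˡ x)
sum-const (suc n) x = trans (cong (x +_) (sum-const n x)) (sym (ℤ.suc-* (ℤ.+ n) x))

sum-indicator : (i : Fin n) (f : Fin n → ℤ) → sum (λ j → ⟦ i Fin.≟ j ⟧ * f j) ≡ f i
sum-indicator i f = begin
  sum (λ j → ⟦ i Fin.≟ j ⟧ * f j)
    ≡⟨ sum-singleton i (λ j j≢i → trans (cong (_* f j) (⟦⟧-no (i Fin.≟ j) (j≢i ∘ sym))) (ℤ.*-zeroˡ (f j))) ⟩
  ⟦ i Fin.≟ i ⟧ * f i ≡⟨ cong (_* f i) (⟦⟧-yes (i Fin.≟ i) refl) ⟩
  1ℤ * f i            ≡⟨ ℤ.*-identityˡ (f i) ⟩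
  f i                 ∎
  where open ≡-Reasoning

colourings : ∀ q v → List (Vec (Fin q) v)
colourings q zero    = [] ∷ []
colourings q (suc v) = cartesianProductWith _∷_ (allFin q) (colourings q v)

∑-colourings : ∀ q v (f : Vec (Fin q) (suc v) → ℤ) →
               ∑ₗ (colourings q (suc v)) f ≡ sum (λ a → ∑ₗ (colourings q v) (f ∘ (a ∷_)))
∑-colourings q v f = trans
  (∑ₗ-cartesianProductWith _∷_ (allFin q) (colourings q v) f)
  (∑ₗ-tabulate {n = q} id (λ a → ∑ₗ (colourings q v) (f ∘ (a ∷_))))

∑-colourings-1 : ∀ q v → ∑ₗ (colourings q v) (λ _ → 1ℤ) ≡ (ℤ.+ q) ^ v
∑-colourings-1 q zero    = refl
∑-colourings-1 q (suc v) = begin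
  ∑ₗ (colourings q (suc v)) (λ _ → 1ℤ)        ≡⟨ ∑-colourings q v (λ _ → 1ℤ) ⟩
  sum {q} (λ _ → ∑ₗ (colourings q v) (λ _ → 1ℤ)) ≡⟨ sum-const q (∑ₗ (colourings q v) (λ _ → 1ℤ)) ⟩
  ℤ.+ q * ∑ₗ (colourings q v) (λ _ → 1ℤ)      ≡⟨ cong (ℤ.+ q *_) (∑-colourings-1 q v) ⟩
  ℤ.+ q * (ℤ.+ q) ^ v                         ∎
  where open ≡-Reasoning

-- One permutation per vertex, so that a single component can be recoloured while all others stay
-- fixed.
recolour : (Fin v → Permutation′ q) → Vec (Fin q) v → Vec (Fin q) v
recolour π []      = []
recolour π (a ∷ c) = (π zero ⟨$⟩ʳ a) ∷ recolour (π ∘ suc) c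

lookup-recolour : (π : Fin v → Permutation′ q) (c : Vec (Fin q) v) (x : Fin v) →
                  lookup (recolour π c) x ≡ π x ⟨$⟩ʳ lookup c x
lookup-recolour π (a ∷ c) zero    = refl
lookup-recolour π (a ∷ c) (suc x) = lookup-recolour (π ∘ suc) c x

∑-recolour : (π : Fin v → Permutation′ q) (f : Vec (Fin q) v → ℤ) →
             ∑ₗ (colourings q v) (f ∘ recolour π) ≡ ∑ₗ (colourings q v) f
∑-recolour {zero}  {q} π f = refl
∑-recolour {suc v} {q} π f = begin
  ∑ₗ (colourings q (suc v)) (f ∘ recolour π)
    ≡⟨ ∑-colourings q v (f ∘ recolour π) ⟩
  sum (λ a → ∑ₗ (colourings q v) (λ c → f ((π zero ⟨$⟩ʳ a) ∷ recolour (π ∘ suc) c)))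
    ≡⟨ sum-cong-≗ {q} (λ a → ∑-recolour (π ∘ suc) (λ c → f ((π zero ⟨$⟩ʳ a) ∷ c))) ⟩
  sum (λ a → ∑ₗ (colourings q v) (λ c → f ((π zero ⟨$⟩ʳ a) ∷ c)))
    ≡⟨ sum-permute (λ a → ∑ₗ (colourings q v) (λ c → f (a ∷ c))) (π zero) ⟨
  sum (λ a → ∑ₗ (colourings q v) (λ c → f (a ∷ c)))
    ≡⟨ ∑-colourings q v f ⟨
  ∑ₗ (colourings q (suc v)) f ∎
  where open ≡-Reasoning

permutation-injective : (π : Permutation′ n) {i j : Fin n} → π ⟨$⟩ʳ i ≡ π ⟨$⟩ʳ j → i ≡ j
permutation-injective π = Injection.injective (↔⇒↣ π)

transpose-second : (a b : Fin n) → transpose a b ⟨$⟩ʳ b ≡ a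
transpose-second a b with b Fin.≟ a
... | yes b≡a = b≡a
... | no _ with b Fin.≟ b
...   | yes _  = refl
...   | no b≢b = contradiction refl b≢b

transpose-first : (a b : Fin n) → transpose a b ⟨$⟩ʳ a ≡ b
transpose-first a b with a Fin.≟ a
... | yes _  = refl
... | no a≢a = contradiction refl a≢a

swapIf : Dec P → Fin q → Fin q → Permutation′ q
swapIf (yes _) a b = transpose a b
swapIf (no _)  a b = Perm.id

-- Swapping colours on the ρ-class of u equidistributes the colour of u given that of v.
∑-identify : (ρ : Fin v → Fin v) (x y : Fin v) → ρ x ≢ ρ y → (F : Vec (Fin q) v → ℤ) →
  (∀ a b c → F (recolour (λ z → swapIf (ρ z Fin.≟ ρ x) a b) c) ≡ F c) →
  ∑ₗ (colourings q v) F ≡ ℤ.+ q * ∑ₗ (colourings q v) (λ c → ⟦ lookup c x Fin.≟ lookup c y ⟧ * F c)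
∑-identify {v} {q} ρ x y ρx≢ρy F invariant = begin
  ∑ₗ cs F
    ≡⟨ ∑ₗ-cong cs (λ c → sum-indicator (lookup c y) (λ _ → F c)) ⟨
  ∑ₗ cs (λ c → sum (λ b → ⟦ lookup c y Fin.≟ b ⟧ * F c))
    ≡⟨ sum-∑ₗ-swap {n = q} cs (λ b c → ⟦ lookup c y Fin.≟ b ⟧ * F c) ⟨
  sum (λ b → ∑ₗ cs (λ c → ⟦ lookup c y Fin.≟ b ⟧ * F c))
    ≡⟨ sum-cong-≗ {q} (λ b → ∑ₗ-cong cs λ c → sum-indicator (lookup c x) (λ _ → ⟦ lookup c y Fin.≟ b ⟧ * F c)) ⟨
  sum (λ b → ∑ₗ cs (λ c → sum (λ a → term a b c)))
    ≡⟨ sum-cong-≗ {q} (λ b → sum-∑ₗ-swap {n = q} cs (λ a → term a b)) ⟨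
  sum (λ b → sum (λ a → ∑ₗ cs (term a b)))
    ≡⟨ sum-cong-≗ {q} (λ b → sum-cong-≗ {q} λ a → same-colour a b) ⟩
  sum (λ b → sum {q} (λ a → ∑ₗ cs (term b b)))
    ≡⟨ sum-cong-≗ {q} (λ b → sum-const q (∑ₗ cs (term b b))) ⟩
  sum (λ b → ℤ.+ q * ∑ₗ cs (term b b))
    ≡⟨ *-distribˡ-sum {q} (ℤ.+ q) (λ b → ∑ₗ cs (term b b)) ⟨
  ℤ.+ q * sum (λ b → ∑ₗ cs (term b b))
    ≡⟨ cong (ℤ.+ q *_) (sum-∑ₗ-swap {n = q} cs (λ b → term b b)) ⟩
  ℤ.+ q * ∑ₗ cs (λ c → sum (λ b → term b b c))
    ≡⟨ cong (ℤ.+ q *_) (∑ₗ-cong cs λ c → sum-indicator (lookup c x) (λ b → ⟦ lookup c y Fin.≟ b ⟧ * F c)) ⟩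
  ℤ.+ q * ∑ₗ cs (λ c → ⟦ lookup c y Fin.≟ lookup c x ⟧ * F c)
    ≡⟨ cong (ℤ.+ q *_) (∑ₗ-cong cs λ c → cong (_* F c)
         (⟦⟧-cong (lookup c y Fin.≟ lookup c x) (lookup c x Fin.≟ lookup c y) sym sym)) ⟩
  ℤ.+ q * ∑ₗ cs (λ c → ⟦ lookup c x Fin.≟ lookup c y ⟧ * F c) ∎
  where
  open ≡-Reasoning
  cs : List (Vec (Fin q) v)
  cs = colourings q v

  term : Fin q → Fin q → Vec (Fin q) v → ℤ
  term a b c = ⟦ lookup c x Fin.≟ a ⟧ * (⟦ lookup c y Fin.≟ b ⟧ * F c)

  π : Fin q → Fin q → Fin v → Permutation′ q
  π a b z = swapIf (ρ z Fin.≟ ρ x) a b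

  at-x : ∀ a b c → lookup (recolour (π a b) c) x ≡ transpose a b ⟨$⟩ʳ lookup c x
  at-x a b c = trans (lookup-recolour (π a b) c x) (swap (ρ x Fin.≟ ρ x))
    where
    swap : (d : Dec (ρ x ≡ ρ x)) → swapIf d a b ⟨$⟩ʳ lookup c x ≡ transpose a b ⟨$⟩ʳ lookup c x
    swap (yes _) = refl
    swap (no ¬p) = contradiction refl ¬p

  at-y : ∀ a b c → lookup (recolour (π a b) c) y ≡ lookup c y
  at-y a b c = trans (lookup-recolour (π a b) c y) (fixed (ρ y Fin.≟ ρ x))
    where
    fixed : (d : Dec (ρ y ≡ ρ x)) → swapIf d a b ⟨$⟩ʳ lookup c y ≡ lookup c y
    fixed (yes eq) = contradiction (sym eq) ρx≢ρy
    fixed (no _)   = refl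

  same-colour : ∀ a b → ∑ₗ cs (term a b) ≡ ∑ₗ cs (term b b)
  same-colour a b = trans (sym (∑-recolour (π a b) (term a b))) (∑ₗ-cong cs λ c →
    cong₂ _*_
      (⟦⟧-cong (lookup (recolour (π a b) c) x Fin.≟ a) (lookup c x Fin.≟ b)
        (λ eq → permutation-injective (transpose a b)
                  (trans (sym (at-x a b c)) (trans eq (sym (transpose-second a b)))))
        (λ { refl → trans (at-x a b c) (transpose-second a b) }))
      (cong₂ _*_ (cong (λ z → ⟦ z Fin.≟ b ⟧) (at-y a b c)) (invariant a b c)))

-- Lists of edges, simple paths and components of forests

elements : Subset m → List (Fin m)
elements []            = []
elements (outside ∷ S) = map suc (elements S)
elements (inside ∷ S)  = zero ∷ map suc (elements S)

length-elements : (S : Subset m) → length (elements S) ≡ ∣ S ∣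
length-elements []            = refl
length-elements (outside ∷ S) = trans (List.length-map suc (elements S)) (length-elements S)
length-elements (inside ∷ S)  = cong suc (trans (List.length-map suc (elements S)) (length-elements S))

∈-elements⁺ : ∀ {S : Subset m} {e} → e ∈ S → e ∈ₗ elements S
∈-elements⁺ {S = inside ∷ S}  here       = here refl
∈-elements⁺ {S = inside ∷ S}  (there e∈) = there (∈-map⁺ suc (∈-elements⁺ e∈))
∈-elements⁺ {S = outside ∷ S} (there e∈) = ∈-map⁺ suc (∈-elements⁺ e∈)

∈-elements⁻ : ∀ (S : Subset m) {e} → e ∈ₗ elements S → e ∈ S
∈-elements⁻ (outside ∷ S) e∈ with _ , f∈ , refl ← ∈-map⁻ suc e∈ = there (∈-elements⁻ S f∈)
∈-elements⁻ (inside ∷ S) (here refl) = here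
∈-elements⁻ (inside ∷ S) (there e∈) with _ , f∈ , refl ← ∈-map⁻ suc e∈ = there (∈-elements⁻ S f∈)

elements-! : (S : Subset m) → List.Unique (elements S)
elements-! []            = []
elements-! (outside ∷ S) = List.map⁺ Fin.suc-injective (elements-! S)
elements-! (inside ∷ S)  =
  All.tabulate (λ e∈ → λ { refl → 0∉ e∈ }) ∷ List.map⁺ Fin.suc-injective (elements-! S)
  where
  0∉ : zero ∉ₗ map suc (elements S)
  0∉ 0∈ with () ← proj₂ (proj₂ (∈-map⁻ suc 0∈))

lookup-∷ʳ-inject₁ : (xs : Vec A n) (y : A) (i : Fin n) → lookup (xs ∷ʳ y) (inject₁ i) ≡ lookup xs i
lookup-∷ʳ-inject₁ (x ∷ xs) y zero    = refl
lookup-∷ʳ-inject₁ (x ∷ xs) y (suc i) = lookup-∷ʳ-inject₁ xs y i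

lookup-∷ʳ-fromℕ : (xs : Vec A n) (y : A) → lookup (xs ∷ʳ y) (fromℕ n) ≡ y
lookup-∷ʳ-fromℕ []       y = refl
lookup-∷ʳ-fromℕ (x ∷ xs) y = lookup-∷ʳ-fromℕ xs y

All-∷ʳ : ∀ {P : A → Set ℓp} {xs : Vec A n} {y} → VecAll.All P xs → P y → VecAll.All P (xs ∷ʳ y)
All-∷ʳ VecAll.[]         py = py VecAll.∷ VecAll.[]
All-∷ʳ (px VecAll.∷ pxs) py = px VecAll.∷ All-∷ʳ pxs py

Unique-∷ʳ : ∀ {xs : Vec A n} {y} → Unique xs → VecAll.All (_≢ y) xs → Unique (xs ∷ʳ y)
Unique-∷ʳ VecAllPairs.[]          VecAll.[]         = VecAll.[] VecAllPairs.∷ VecAllPairs.[]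
Unique-∷ʳ (x≢ VecAllPairs.∷ xs!) (x≢y VecAll.∷ ≢y) = All-∷ʳ x≢ x≢y VecAllPairs.∷ Unique-∷ʳ xs! ≢y

module Forests (G : Graph) where

  Joins-sym : ∀ {e x y} → Joins G e x y → Joins G e y x
  Joins-sym (inj₁ eq) = inj₂ eq
  Joins-sym (inj₂ eq) = inj₁ eq

  Joins-ends : ∀ e → Joins G e (proj₁ (ends G e)) (proj₂ (ends G e))
  Joins-ends e = inj₁ refl

  Joins-end : ∀ {e x y u v} → Joins G e x y → Joins G e u v → x ≡ u ⊎ x ≡ v
  Joins-end (inj₁ eq) (inj₁ eq′) = inj₁ (cong proj₁ (trans (sym eq) eq′))
  Joins-end (inj₁ eq) (inj₂ eq′) = inj₂ (cong proj₁ (trans (sym eq) eq′))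
  Joins-end (inj₂ eq) (inj₁ eq′) = inj₂ (cong proj₂ (trans (sym eq) eq′))
  Joins-end (inj₂ eq) (inj₂ eq′) = inj₁ (cong proj₂ (trans (sym eq) eq′))

  Step : List (Edge G) → Rel (Vertex G) _
  Step T x y = ∃ λ e → e ∈ₗ T × Joins G e x y

  Step-sym : ∀ {T x y} → Step T x y → Step T y x
  Step-sym (e , e∈T , joins) = e , e∈T , Joins-sym joins

  Step-∷ : ∀ {T e x y} → Step T x y → Step (e ∷ T) x y
  Step-∷ (f , f∈T , joins) = f , there f∈T , joins

  -- Indexed by the two vectors that `IsCycle` expects, one vertex more than edges: a single
  -- appended edge closes the path to a cycle.
  data Path (T : List (Edge G)) : ∀ {k} → Vertex G → Vertex G → Vec (Vertex G) (suc k) → Vec (Edge G) k → Set where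
    done : ∀ {x} → Path T x x (x ∷ []) []
    step : ∀ {k x y z e} {vs : Vec (Vertex G) (suc k)} {es} → Joins G e x y → e ∈ₗ T → VecAll.All (x ≢_) vs →
           Path T y z vs es → Path T x z (x ∷ vs) (e ∷ es)

  SimplePath : List (Edge G) → Vertex G → Vertex G → Set
  SimplePath T x z = ∃ λ k → Σ (Vec (Vertex G) (suc k)) λ vs → Σ (Vec (Edge G) k) λ es → Path T x z vs es

  -- Loop erasure: when x already lies on the path, the part from x onwards replaces the detour.
  avoids∨from : ∀ {T k y z vs} {es : Vec (Edge G) k} x → Path T y z vs es →
                VecAll.All (x ≢_) vs ⊎ SimplePath T x z
  avoids∨from x (done {y}) with x Fin.≟ y
  ... | yes refl = inj₂ (_ , _ , _ , done)
  ... | no x≢y   = inj₁ (x≢y VecAll.∷ VecAll.[])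
  avoids∨from x path@(step {x = y} _ _ _ path′) with x Fin.≟ y | avoids∨from x path′
  ... | yes refl | _           = inj₂ (_ , _ , _ , path)
  ... | no _     | inj₂ path″  = inj₂ path″
  ... | no x≢y   | inj₁ avoids = inj₁ (x≢y VecAll.∷ avoids)

  simplePath : ∀ {T x z} → Star (Step T) x z → SimplePath T x z
  simplePath ε = _ , _ , _ , done
  simplePath {x = x} ((e , e∈T , joins) ◅ walk) with _ , _ , _ , path ← simplePath walk with avoids∨from x path
  ... | inj₁ avoids = _ , _ , _ , step joins e∈T avoids path
  ... | inj₂ path′  = path′

  module _ {T : List (Edge G)} where

    path-first : ∀ {k x z vs} {es : Vec (Edge G) k} → Path T x z vs es → lookup vs zero ≡ x
    path-first done           = refl
    path-first (step _ _ _ _) = refl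

    path-last : ∀ {k x z vs} {es : Vec (Edge G) k} → Path T x z vs es → lookup vs (fromℕ k) ≡ z
    path-last done              = refl
    path-last (step _ _ _ path) = path-last path

    path-joins : ∀ {k x z vs} {es : Vec (Edge G) k} → Path T x z vs es →
                 ∀ i → Joins G (lookup es i) (lookup vs (inject₁ i)) (lookup vs (suc i))
    path-joins (step joins _ _ path) zero    = subst (Joins G _ _) (sym (path-first path)) joins
    path-joins (step _ _ _ path)     (suc i) = path-joins path i

    path-∈ : ∀ {k x z vs} {es : Vec (Edge G) k} → Path T x z vs es → ∀ i → lookup es i ∈ₗ T
    path-∈ (step _ e∈T _ path) zero    = e∈T
    path-∈ (step _ _ _ path)   (suc i) = path-∈ path i

    path-vertices-! : ∀ {k x z vs} {es : Vec (Edge G) k} → Path T x z vs es → Unique vs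
    path-vertices-! done                 = VecAll.[] VecAllPairs.∷ VecAllPairs.[]
    path-vertices-! (step _ _ x∉vs path) = x∉vs VecAllPairs.∷ path-vertices-! path

    -- If the first edge occurred again, its end x would be an end of a later edge and thus a later
    -- vertex of the path, against the distinctness of the vertices.
    path-edges-! : ∀ {k x z vs} {es : Vec (Edge G) k} → Path T x z vs es → Unique es
    path-edges-! done = VecAllPairs.[]
    path-edges-! (step joins _ x∉vs path) =
      VecAll.lookup⁻ (λ i e≡ → [ VecAll.lookup⁺ x∉vs (inject₁ i) , VecAll.lookup⁺ x∉vs (suc i) ]′
                       (Joins-end (subst (λ e → Joins G e _ _) e≡ joins) (path-joins path i)))
      VecAllPairs.∷ path-edges-! path

    close-path : ∀ {k x z vs} {es : Vec (Edge G) k} {e} → Path T x z vs es → e ∉ₗ T → Joins G e z x →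
                 IsCycle G vs (es ∷ʳ e)
    close-path {vs = vs} {es} {e} path e∉T joins =
        path-vertices-! path
      , Unique-∷ʳ (path-edges-! path) (VecAll.lookup⁻ λ { i refl → e∉T (path-∈ path i) })
      , consecutive
      where
      consecutive : ∀ i → Joins G (lookup (es ∷ʳ e) i) (lookup vs i) (lookup vs (next i))
      consecutive i with view i
      ... | ‵fromℕ {n = k} rewrite next-fromℕ k | lookup-∷ʳ-fromℕ es e | path-last path | path-first path = joins
      ... | ‵inject₁ j rewrite next-inject₁ j | lookup-∷ʳ-inject₁ es e j = path-joins path j

  Acyclic : List (Edge G) → Set
  Acyclic T = ∀ C → IsCycleEdgeSet G C → ¬ (∀ {e} → e ∈ C → e ∈ₗ T)

  -- The walk shortens to a simple path in T, which e closes to a cycle.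
  walk⇒¬acyclic : ∀ {T e} → e ∉ₗ T → Star (Step T) (proj₁ (ends G e)) (proj₂ (ends G e)) → ¬ Acyclic (e ∷ T)
  walk⇒¬acyclic {T} {e} e∉T walk acyclic with k , vs , es , path ← simplePath walk =
    acyclic (edgeSet (es ∷ʳ e)) (k , vs , es ∷ʳ e , close-path path e∉T (Joins-sym (Joins-ends e)) , refl) inT
    where
    member : ∀ i → lookup (es ∷ʳ e) i ∈ₗ (e ∷ T)
    member i with view i
    ... | ‵fromℕ rewrite lookup-∷ʳ-fromℕ es e = here refl
    ... | ‵inject₁ j rewrite lookup-∷ʳ-inject₁ es e j = there (path-∈ path j)
    inT : ∀ {f} → f ∈ edgeSet (es ∷ʳ e) → f ∈ₗ (e ∷ T)
    inT f∈ with i , refl ← ∈-edgeSet⁻ (es ∷ʳ e) f∈ = member i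

  count : ∀ q → List (Edge G) → ℤ
  count q T = ∑ₗ (colourings q (#V G)) λ c → ⟦ All.all? (mono? G Fin._≟_ c) T ⟧

  Mono-recolour : ∀ {q} (π : Vertex G → Permutation′ q) c {e} →
                  π (proj₁ (ends G e)) ≡ π (proj₂ (ends G e)) →
                  (Mono G Fin._≟_ (recolour π c) e → Mono G Fin._≟_ c e) ×
                  (Mono G Fin._≟_ c e → Mono G Fin._≟_ (recolour π c) e)
  Mono-recolour π c {e} same rewrite lookup-recolour π c (proj₁ (ends G e)) | lookup-recolour π c (proj₂ (ends G e)) | same =
    permutation-injective (π (proj₂ (ends G e))) , cong (π (proj₂ (ends G e)) ⟨$⟩ʳ_)

  all-mono-recolour : ∀ {q} (π : Vertex G → Permutation′ q) c {T} →
    (∀ {e} → e ∈ₗ T → π (proj₁ (ends G e)) ≡ π (proj₂ (ends G e))) →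
    ⟦ All.all? (mono? G Fin._≟_ (recolour π c)) T ⟧ ≡ ⟦ All.all? (mono? G Fin._≟_ c) T ⟧
  all-mono-recolour π c {T} same =
    ⟦⟧-cong (All.all? (mono? G Fin._≟_ (recolour π c)) T) (All.all? (mono? G Fin._≟_ c) T)
      (λ mono → All.tabulate λ e∈T → proj₁ (Mono-recolour π c (same e∈T)) (All.lookup mono e∈T))
      (λ mono → All.tabulate λ e∈T → proj₂ (Mono-recolour π c (same e∈T)) (All.lookup mono e∈T))

  count-∷ : ∀ {q} e T → count q (e ∷ T) ≡ ∑ₗ (colourings q (#V G)) λ c →
            ⟦ lookup c (proj₁ (ends G e)) Fin.≟ lookup c (proj₂ (ends G e)) ⟧ * ⟦ All.all? (mono? G Fin._≟_ c) T ⟧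
  count-∷ {q} e T = ∑ₗ-cong (colourings q (#V G)) λ c → trans
    (⟦⟧-cong (All.all? (mono? G Fin._≟_ c) (e ∷ T)) (mono? G Fin._≟_ c e ×-dec All.all? (mono? G Fin._≟_ c) T)
      (λ { (m ∷ ms) → m , ms }) (λ (m , ms) → m ∷ ms))
    (⟦⟧-× (mono? G Fin._≟_ c e) (All.all? (mono? G Fin._≟_ c) T))

  -- The fibres of ρ are the connected components of the graph with edge set T.
  record Components (T : List (Edge G)) : Set where
    field
      ρ         : Vertex G → Vertex G
      ρ-ends    : ∀ {e} → e ∈ₗ T → ρ (proj₁ (ends G e)) ≡ ρ (proj₂ (ends G e))
      connected : ∀ {x y} → ρ x ≡ ρ y → Star (Step T) x y
      -- Multiplicative, because the exponent of a quotient would presuppose a bound on the length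
      -- of T; that bound is itself deduced from this identity in `face-size`.
      counted   : ∀ q → (ℤ.+ q) ^ length T * count q T ≡ (ℤ.+ q) ^ #V G

  -- A new edge joins two different components, since otherwise it would close a cycle. The
  -- components are merged, and requiring equal colours at its ends divides the count by q, by
  -- `∑-identify`.
  components : ∀ T → List.Unique T → Acyclic T → Components T
  components [] _ _ = record
    { ρ = id ; ρ-ends = λ () ; connected = λ { refl → ε }
    ; counted = λ q → trans (ℤ.*-identityˡ (count q [])) (∑-colourings-1 q (#V G)) }
  components (e ∷ T) eT!@(_ ∷ T!) acyclic = record
    { ρ = merge ∘ ρ ; ρ-ends = merge-ends ; connected = λ {x} {y} → merge-connected x y ; counted = merge-counted }
    where
    open Components (components T T! λ C cyc C⊆T → acyclic C cyc (there ∘ C⊆T))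
    open ≡-Reasoning

    e∉T : e ∉ₗ T
    e∉T = List.Unique[x∷xs]⇒x∉xs eT!

    u w : Vertex G
    u = proj₁ (ends G e)
    w = proj₂ (ends G e)

    ρu≢ρw : ρ u ≢ ρ w
    ρu≢ρw eq = walk⇒¬acyclic e∉T (connected eq) acyclic

    merge : Vertex G → Vertex G
    merge z with z Fin.≟ ρ w
    ... | yes _ = ρ u
    ... | no _  = z

    merge-ends : ∀ {f} → f ∈ₗ (e ∷ T) → merge (ρ (proj₁ (ends G f))) ≡ merge (ρ (proj₂ (ends G f)))
    merge-ends (there f∈T) = cong merge (ρ-ends f∈T)
    merge-ends (here refl) with ρ u Fin.≟ ρ w | ρ w Fin.≟ ρ w
    ... | yes eq | _      = contradiction eq ρu≢ρw
    ... | no _   | yes _  = refl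
    ... | no _   | no ≢   = contradiction refl ≢

    weaken : ∀ {x y} → Star (Step T) x y → Star (Step (e ∷ T)) x y
    weaken = Star.map Step-∷

    u→w : Star (Step (e ∷ T)) u w
    u→w = (e , here refl , Joins-ends e) ◅ ε

    merge-connected : ∀ x y → merge (ρ x) ≡ merge (ρ y) → Star (Step (e ∷ T)) x y
    merge-connected x y eq with ρ x Fin.≟ ρ w | ρ y Fin.≟ ρ w
    ... | yes x~w | yes y~w = weaken (connected (trans x~w (sym y~w)))
    ... | yes x~w | no _    = weaken (connected x~w) ◅◅ Star.reverse Step-sym u→w ◅◅ weaken (connected eq)
    ... | no _    | yes y~w = weaken (connected eq) ◅◅ u→w ◅◅ weaken (connected (sym y~w))
    ... | no _    | no _    = weaken (connected eq)

    merge-counted : ∀ q → (ℤ.+ q) ^ suc (length T) * count q (e ∷ T) ≡ (ℤ.+ q) ^ #V G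
    merge-counted q = begin
      ℤ.+ q * (ℤ.+ q) ^ length T * count q (e ∷ T)
        ≡⟨ rotate (ℤ.+ q) ((ℤ.+ q) ^ length T) (count q (e ∷ T)) ⟩
      (ℤ.+ q) ^ length T * (ℤ.+ q * count q (e ∷ T))
        ≡⟨ cong (λ s → (ℤ.+ q) ^ length T * (ℤ.+ q * s)) (count-∷ e T) ⟩
      (ℤ.+ q) ^ length T * (ℤ.+ q * ∑ₗ (colourings q (#V G)) λ c →
        ⟦ lookup c u Fin.≟ lookup c w ⟧ * ⟦ All.all? (mono? G Fin._≟_ c) T ⟧)
        -- Recolouring a whole component keeps the edges of T monochromatic, as ρ agrees at their
        -- ends.
        ≡⟨ cong ((ℤ.+ q) ^ length T *_) (∑-identify {q = q} ρ u w ρu≢ρw (λ c → ⟦ All.all? (mono? G Fin._≟_ c) T ⟧) (λ a b c →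
             all-mono-recolour (λ z → swapIf (ρ z Fin.≟ ρ u) a b) c
               (λ f∈T → cong (λ z → swapIf (z Fin.≟ ρ u) a b) (ρ-ends f∈T)))) ⟨
      (ℤ.+ q) ^ length T * count q T
        ≡⟨ counted q ⟩
      (ℤ.+ q) ^ #V G ∎
      where
      rotate : ∀ x y z → x * y * z ≡ y * (x * z)
      rotate = solve-∀

-- Faces of the broken-circuit complex of a wheel

recolour-all : (π : Permutation′ q) → Vec (Fin q) v → Vec (Fin q) v
recolour-all π = recolour λ _ → π

-- The transposition of a and `zero` carries the colourings with first colour a to those with first
-- colour `zero`, so every first colour contributes equally to an invariant sum.
∑-fix-first : (F : Vec (Fin (suc q)) (suc n) → ℤ) → (∀ π c → F (recolour-all π c) ≡ F c) →
              ∑ₗ (colourings (suc q) (suc n)) F ≡ ℤ.+ suc q * ∑ₗ (colourings (suc q) n) (F ∘ (zero ∷_))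
∑-fix-first {q} {n} F invariant = begin
  ∑ₗ (colourings (suc q) (suc n)) F                           ≡⟨ ∑-colourings (suc q) n F ⟩
  sum (λ a → ∑ₗ (colourings (suc q) n) (F ∘ (a ∷_)))          ≡⟨ sum-cong-≗ {suc q} fix ⟩
  sum {suc q} (λ _ → ∑ₗ (colourings (suc q) n) (F ∘ (zero ∷_)))
    ≡⟨ sum-const (suc q) (∑ₗ (colourings (suc q) n) (F ∘ (zero ∷_))) ⟩
  ℤ.+ suc q * ∑ₗ (colourings (suc q) n) (F ∘ (zero ∷_))       ∎
  where
  open ≡-Reasoning
  fix : ∀ a → ∑ₗ (colourings (suc q) n) (F ∘ (a ∷_)) ≡ ∑ₗ (colourings (suc q) n) (F ∘ (zero ∷_))
  fix a = begin
    ∑ₗ cs (λ c → F (a ∷ c))                         ≡⟨ ∑ₗ-cong cs (λ c → invariant π (a ∷ c)) ⟨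
    ∑ₗ cs (λ c → F ((π ⟨$⟩ʳ a) ∷ recolour-all π c)) ≡⟨ ∑ₗ-cong cs (λ c → cong (λ b → F (b ∷ recolour-all π c)) (transpose-first a zero)) ⟩
    ∑ₗ cs (λ c → F (zero ∷ recolour-all π c))       ≡⟨ ∑-recolour (λ _ → π) (F ∘ (zero ∷_)) ⟩
    ∑ₗ cs (λ c → F (zero ∷ c))                      ∎
    where
    cs : List (Vec (Fin (suc q)) n)
    cs = colourings (suc q) n
    π : Permutation′ (suc q)
    π = transpose a zero

abs-^ : ∀ a n → ℤ.∣ (ℤ.+ a) ^ n ∣ ≡ a ℕ.^ n
abs-^ a zero    = refl
abs-^ a (suc n) = trans (ℤ.abs-* (ℤ.+ a) ((ℤ.+ a) ^ n)) (cong (a ℕ.*_) (abs-^ a n))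

^-*-cancelˡ : ∀ q s {x y} → (ℤ.+ suc q) ^ s * x ≡ (ℤ.+ suc q) ^ s * y → x ≡ y
^-*-cancelˡ q zero    {x} {y} eq = trans (sym (ℤ.*-identityˡ x)) (trans eq (ℤ.*-identityˡ y))
^-*-cancelˡ q (suc s) {x} {y} eq = ^-*-cancelˡ q s (ℤ.*-cancelˡ-≡ (ℤ.+ suc q) _ _
  (trans (sym (ℤ.*-assoc (ℤ.+ suc q) ((ℤ.+ suc q) ^ s) x))
         (trans eq (ℤ.*-assoc (ℤ.+ suc q) ((ℤ.+ suc q) ^ s) y))))

-- Since 2ⁿ is nonzero, |x| ≥ 1 and therefore 2^s ≤ 2ⁿ.
2^s*x≡2^n⇒s≤n : ∀ s n {x} → (ℤ.+ 2) ^ s * x ≡ (ℤ.+ 2) ^ n → s ℕ.≤ n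
2^s*x≡2^n⇒s≤n s n {x} eq = ℕ.≮⇒≥ λ n<s → ℕ.<-irrefl refl (begin-strict
  2 ℕ.^ n                   <⟨ ℕ.^-monoʳ-< 2 (ℕ.s≤s (ℕ.s≤s ℕ.z≤n)) n<s ⟩
  2 ℕ.^ s                   ≤⟨ at-least ℤ.∣ x ∣ nat-eq ⟩
  2 ℕ.^ s ℕ.* ℤ.∣ x ∣       ≡⟨ nat-eq ⟩
  2 ℕ.^ n                   ∎)
  where
  open ℕ.≤-Reasoning
  nat-eq : 2 ℕ.^ s ℕ.* ℤ.∣ x ∣ ≡ 2 ℕ.^ n
  nat-eq = trans (cong (ℕ._* ℤ.∣ x ∣) (sym (abs-^ 2 s)))
          (trans (sym (ℤ.abs-* ((ℤ.+ 2) ^ s) x)) (trans (cong ℤ.∣_∣ eq) (abs-^ 2 n)))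
  at-least : ∀ a → 2 ℕ.^ s ℕ.* a ≡ 2 ℕ.^ n → 2 ℕ.^ s ℕ.≤ 2 ℕ.^ s ℕ.* a
  at-least zero    eq = contradiction (trans (sym eq) (ℕ.*-zeroʳ (2 ℕ.^ s))) (ℕ.≢-nonZero⁻¹ (2 ℕ.^ n) {{ℕ.m^n≢0 2 n}})
  at-least (suc a) eq = ℕ.m≤m*n (2 ℕ.^ s) (suc a)

module Faces (G : Graph) {ℓ} {_≤_ : Rel (Edge G) ℓ} (ord : IsTotalOrder _≡_ _≤_) where
  open Forests G

  -- A cycle inside S would bring its broken circuit with it. The largest edge to remove is found as
  -- the least one for the reversed order.
  face-acyclic : ∀ {S} → IsFace G _≤_ S → Acyclic (elements S)
  face-acyclic {S} face C cyc@(_ , vs , es , _ , refl) C⊆S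
    with e , e∈C , max ← least-Fin (Flip.isTotalOrder ord) (_∈? C) (lookup es zero , ∈-edgeSet⁺ es zero) =
    face (C ∖ e , (C , e , cyc , (e∈C , max) , refl) , λ x∈ → ∈-elements⁻ S (C⊆S (p─q⊆p C ⁅ e ⁆ x∈)))

  count-elements : ∀ q S → count q (elements S) ≡ ∑ₗ (colourings q (#V G)) λ c → ⟦ Lift? (mono? G Fin._≟_ c) S ⟧
  count-elements q S = ∑ₗ-cong (colourings q (#V G)) λ c →
    ⟦⟧-cong (All.all? (mono? G Fin._≟_ c) (elements S)) (Lift? (mono? G Fin._≟_ c) S)
      (λ all x∈ → All.lookup all (∈-elements⁺ x∈)) (λ lift → All.tabulate λ x∈ → lift (∈-elements⁻ S x∈))

  face-count : ∀ {S} → IsFace G _≤_ S → ∀ q → (ℤ.+ q) ^ ∣ S ∣ * count q (elements S) ≡ (ℤ.+ q) ^ #V G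
  face-count {S} face q = subst (λ s → (ℤ.+ q) ^ s * count q (elements S) ≡ (ℤ.+ q) ^ #V G) (length-elements S)
    (Components.counted (components (elements S) (elements-! S) (face-acyclic face)) q)

  Lift-recolour : ∀ {q} S (π : Permutation′ q) c →
    ⟦ Lift? (mono? G Fin._≟_ (recolour-all π c)) S ⟧ ≡ ⟦ Lift? (mono? G Fin._≟_ c) S ⟧
  Lift-recolour S π c = ⟦⟧-cong (Lift? (mono? G Fin._≟_ (recolour-all π c)) S) (Lift? (mono? G Fin._≟_ c) S)
    (λ lift x∈ → proj₁ (Mono-recolour (λ _ → π) c refl) (lift x∈))
    (λ lift x∈ → proj₂ (Mono-recolour (λ _ → π) c refl) (lift x∈))

module WheelFaces (k : ℕ) {ℓ} {_≤_ : Rel (Edge (wheel (suc k))) ℓ} (ord : IsTotalOrder _≡_ _≤_) where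
  private
    W : Graph
    W = wheel (suc k)
  open Faces W ord
  open Forests W

  mono-hub? : (c : Vec (Fin (suc q)) (suc k)) → U.Decidable (Mono W Fin._≟_ (zero ∷ c))
  mono-hub? c = mono? W Fin._≟_ (zero ∷ c)

  -- Only the rim is coloured freely. There are `suc q` colours, so the hub's colour `zero` always
  -- exists.
  hub-count : ∀ q → Subset (#E W) → ℤ
  hub-count q S = ∑ₗ (colourings (suc q) (suc k)) λ c → ⟦ Lift? (mono-hub? c) S ⟧

  face-hub-count : ∀ {S} → IsFace W _≤_ S → ∀ q → (ℤ.+ suc q) ^ ∣ S ∣ * hub-count q S ≡ (ℤ.+ suc q) ^ suc k
  face-hub-count {S} face q = ℤ.*-cancelˡ-≡ (ℤ.+ suc q) _ _ (begin
    ℤ.+ suc q * ((ℤ.+ suc q) ^ ∣ S ∣ * hub-count q S)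
      ≡⟨ pull (ℤ.+ suc q) ((ℤ.+ suc q) ^ ∣ S ∣) (hub-count q S) ⟩
    (ℤ.+ suc q) ^ ∣ S ∣ * (ℤ.+ suc q * hub-count q S)
      ≡⟨ cong ((ℤ.+ suc q) ^ ∣ S ∣ *_) (∑-fix-first (λ c → ⟦ Lift? (mono? W Fin._≟_ c) S ⟧) (Lift-recolour S)) ⟨
    (ℤ.+ suc q) ^ ∣ S ∣ * ∑ₗ (colourings (suc q) (suc (suc k))) (λ c → ⟦ Lift? (mono? W Fin._≟_ c) S ⟧)
      ≡⟨ cong ((ℤ.+ suc q) ^ ∣ S ∣ *_) (count-elements (suc q) S) ⟨
    (ℤ.+ suc q) ^ ∣ S ∣ * count (suc q) (elements S)
      ≡⟨ face-count face (suc q) ⟩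
    ℤ.+ suc q * (ℤ.+ suc q) ^ suc k ∎)
    where
    open ≡-Reasoning
    pull : ∀ x y z → x * (y * z) ≡ y * (x * z)
    pull = solve-∀

  -- Two colours suffice: the count makes 2^|S| a divisor of 2ⁿ with n = k + 1. This stands in for a
  -- rank argument on forests.
  face-size : ∀ {S} → IsFace W _≤_ S → ∣ S ∣ ℕ.≤ suc k
  face-size {S} face = 2^s*x≡2^n⇒s≤n ∣ S ∣ (suc k) (face-hub-count face 1)

  face-hub-count′ : ∀ {S} → IsFace W _≤_ S → ∀ q → hub-count q S ≡ (ℤ.+ suc q) ^ (suc k ∸ ∣ S ∣)
  face-hub-count′ {S} face q = ^-*-cancelˡ q ∣ S ∣ (begin
    (ℤ.+ suc q) ^ ∣ S ∣ * hub-count q S                    ≡⟨ face-hub-count face q ⟩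
    (ℤ.+ suc q) ^ suc k                                       ≡⟨ cong ((ℤ.+ suc q) ^_) (ℕ.m+[n∸m]≡n (face-size face)) ⟨
    (ℤ.+ suc q) ^ (∣ S ∣ ℕ.+ (suc k ∸ ∣ S ∣))                 ≡⟨ ℤ.^-distribˡ-+-* (ℤ.+ suc q) ∣ S ∣ (suc k ∸ ∣ S ∣) ⟩
    (ℤ.+ suc q) ^ ∣ S ∣ * (ℤ.+ suc q) ^ (suc k ∸ ∣ S ∣)       ∎)
    where open ≡-Reasoning

  ∑-faces : ∀ q → ∑ₗ (allSubsets (#E W)) (λ S → ⟦ isFace? W ord S ⟧ * (sgn S * (ℤ.+ suc q) ^ (suc k ∸ ∣ S ∣))) ≡
            ∑ₗ (colourings (suc q) (suc k)) (λ c → ∏ (λ e → 1ℤ - ⟦ mono-hub? c e ⟧))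
  ∑-faces q = begin
    ∑ₗ Ss (λ S → ⟦ isFace? W ord S ⟧ * (sgn S * (ℤ.+ suc q) ^ (suc k ∸ ∣ S ∣)))
      ≡⟨ ∑ₗ-cong Ss (λ S → ⟦⟧-*-cong (isFace? W ord S) λ face → cong (sgn S *_) (sym (face-hub-count′ face q))) ⟩
    ∑ₗ Ss (λ S → ⟦ isFace? W ord S ⟧ * (sgn S * hub-count q S))
      ≡⟨ ∑ₗ-cong Ss (λ S → trans (cong (⟦ isFace? W ord S ⟧ *_) (*-∑ₗ (sgn S) cs λ c → ⟦ Lift? (mono-hub? c) S ⟧))
                                 (*-∑ₗ ⟦ isFace? W ord S ⟧ cs λ c → sgn S * ⟦ Lift? (mono-hub? c) S ⟧)) ⟩
    ∑ₗ Ss (λ S → ∑ₗ cs (λ c → ⟦ isFace? W ord S ⟧ * (sgn S * ⟦ Lift? (mono-hub? c) S ⟧)))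
      ≡⟨ ∑ₗ-swap Ss cs (λ S c → ⟦ isFace? W ord S ⟧ * (sgn S * ⟦ Lift? (mono-hub? c) S ⟧)) ⟩
    ∑ₗ cs (λ c → ∑ₗ Ss (λ S → ⟦ isFace? W ord S ⟧ * (sgn S * ⟦ Lift? (mono-hub? c) S ⟧)))
      ≡⟨ ∑ₗ-cong cs (λ c → BrokenCircuits.∑-faces-Mono W ord Fin._≟_ (zero ∷ c)) ⟩
    ∑ₗ cs (λ c → ∏ (λ e → 1ℤ - ⟦ mono-hub? c e ⟧)) ∎
    where
    open ≡-Reasoning
    Ss : List (Subset (#E W))
    Ss = allSubsets (#E W)
    cs : List (Vec (Fin (suc q)) (suc k))
    cs = colourings (suc q) (suc k)

-- Proper colourings of the wheel

∏-↑ : ∀ m {n} (w : Fin (m ℕ.+ n) → ℤ) → ∏ w ≡ ∏ (w ∘ (_↑ˡ n)) * ∏ (w ∘ (m ↑ʳ_))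
∏-↑ zero    w = sym (ℤ.*-identityˡ (∏ w))
∏-↑ (suc m) w = trans (cong (w zero *_) (∏-↑ m (w ∘ suc))) (sym (ℤ.*-assoc (w zero) _ _))

∏-init-last : (w : Fin (suc n) → ℤ) → ∏ w ≡ ∏ (w ∘ inject₁) * w (fromℕ n)
∏-init-last {zero}  w = ℤ.*-comm (w zero) 1ℤ
∏-init-last {suc n} w = trans (cong (w zero *_) (∏-init-last (w ∘ suc))) (sym (ℤ.*-assoc (w zero) _ _))

δ : Fin q → Fin q → ℤ
δ a b = ⟦ a Fin.≟ b ⟧

δ-sym : (a b : Fin q) → δ a b ≡ δ b a
δ-sym a b = ⟦⟧-cong (a Fin.≟ b) (b Fin.≟ a) sym sym

-- The edges of the join are numbered as no edges of K₁, then the n rim edges, then 1 · n spokes. As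
-- 1 · n unfolds to n + 0, an empty last factor has to be split off.
∏-wheel : ∀ n (c : Vec (Fin (suc q)) n) →
  ∏ (λ e → 1ℤ - ⟦ mono? (wheel n) Fin._≟_ (zero ∷ c) e ⟧) ≡
  ∏ (λ i → 1ℤ - δ (lookup c i) (lookup c (next i))) * ∏ (λ i → 1ℤ - δ zero (lookup c i))
∏-wheel n c = trans (∏-↑ n w) (cong₂ _*_ (∏-cong rim) (trans (∏-↑ n (w ∘ (n ↑ʳ_)))
  (trans (ℤ.*-identityʳ (∏ (w ∘ (n ↑ʳ_) ∘ (_↑ˡ 0)))) (∏-cong spoke))))
  where
  c′ : Vec _ (suc n)
  c′ = zero ∷ c
  w : Edge (wheel n) → ℤ
  w e = 1ℤ - ⟦ mono? (wheel n) Fin._≟_ (zero ∷ c) e ⟧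
  colours : ∀ e u v → ends (wheel n) e ≡ (u , v) → w e ≡ 1ℤ - δ (lookup c′ u) (lookup c′ v)
  colours e u v eq = cong (λ (u , v) → 1ℤ - δ (lookup c′ u) (lookup c′ v)) eq
  rim : ∀ i → w (i ↑ˡ (1 ℕ.* n)) ≡ 1ℤ - δ (lookup c i) (lookup c (next i))
  rim i = colours (i ↑ˡ (1 ℕ.* n)) (suc i) (suc (next i)) ends-rim
    where
    ends-rim : ends (wheel n) (i ↑ˡ (1 ℕ.* n)) ≡ (suc i , suc (next i))
    ends-rim rewrite Fin.splitAt-↑ˡ n i (1 ℕ.* n) = refl
  spoke : ∀ i → w (n ↑ʳ (i ↑ˡ 0)) ≡ 1ℤ - δ zero (lookup c i)
  spoke i = colours (n ↑ʳ (i ↑ˡ 0)) zero (suc i) ends-spoke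
    where
    ends-spoke : ends (wheel n) (n ↑ʳ (i ↑ˡ 0)) ≡ (zero , suc i)
    ends-spoke rewrite Fin.splitAt-↑ʳ n (1 ℕ.* n) (i ↑ˡ 0) | Fin.splitAt-↑ˡ n i 0 = refl

-- The product of the edge weights of the rim path x, c, closed up with first colour a,
-- and of the spokes to all vertices but the first.
chain : Fin (suc q) → Fin (suc q) → Vec (Fin (suc q)) n → ℤ
chain a x []      = 1ℤ - δ x a
chain a x (y ∷ c) = (1ℤ - δ x y) * ((1ℤ - δ zero y) * chain a y c)

∏-chain : (a x : Fin (suc q)) (c : Vec (Fin (suc q)) n) →
  ∏ (λ i → 1ℤ - δ (lookup (x ∷ c) (inject₁ i)) (lookup c i)) * (1ℤ - δ (lookup (x ∷ c) (fromℕ n)) a) *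
  ∏ (λ i → 1ℤ - δ zero (lookup (x ∷ c) i)) ≡ (1ℤ - δ zero x) * chain a x c
∏-chain a x []      = base (1ℤ - δ x a) (1ℤ - δ zero x)
  where
  base : ∀ d e → 1ℤ * d * (e * 1ℤ) ≡ e * d
  base = solve-∀
∏-chain {n = suc n} a x (y ∷ c) =
  trans (regroup (1ℤ - δ x y) Π d (1ℤ - δ zero x) Π′)
        (cong (λ s → (1ℤ - δ zero x) * ((1ℤ - δ x y) * s)) (∏-chain a y c))
  where
  Π d Π′ : ℤ
  Π = ∏ (λ i → 1ℤ - δ (lookup (y ∷ c) (inject₁ i)) (lookup c i))
  d = 1ℤ - δ (lookup (y ∷ c) (fromℕ n)) a
  Π′ = ∏ (λ i → 1ℤ - δ zero (lookup (y ∷ c) i))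
  regroup : ∀ u Π d e Π′ → u * Π * d * (e * Π′) ≡ e * (u * (Π * d * Π′))
  regroup = solve-∀

-- The rim edge from the last vertex back to the first becomes the final factor of `chain`; this is
-- why a is both the starting and the closing colour.
∏-wheel-chain : ∀ k (a : Fin (suc q)) (c : Vec (Fin (suc q)) k) →
  ∏ (λ e → 1ℤ - ⟦ mono? (wheel (suc k)) Fin._≟_ (zero ∷ a ∷ c) e ⟧) ≡ (1ℤ - δ zero a) * chain a a c
∏-wheel-chain k a c = begin
  ∏ (λ e → 1ℤ - ⟦ mono? (wheel (suc k)) Fin._≟_ (zero ∷ a ∷ c) e ⟧)
    ≡⟨ ∏-wheel (suc k) (a ∷ c) ⟩
  ∏ rim * Π′
    ≡⟨ cong (_* Π′) (∏-init-last rim) ⟩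
  ∏ (rim ∘ inject₁) * rim (fromℕ k) * Π′
    ≡⟨ cong (_* Π′) (cong₂ _*_ (∏-cong λ i → cong (edge (inject₁ i)) (next-inject₁ i))
                               (cong (edge (fromℕ k)) (next-fromℕ k))) ⟩
  ∏ (λ i → edge (inject₁ i) (suc i)) * edge (fromℕ k) zero * Π′
    ≡⟨ ∏-chain a a c ⟩
  (1ℤ - δ zero a) * chain a a c ∎
  where
  open ≡-Reasoning
  edge : Fin (suc k) → Fin (suc k) → ℤ
  edge i j = 1ℤ - δ (lookup (a ∷ c) i) (lookup (a ∷ c) j)
  rim : Fin (suc k) → ℤ
  rim i = edge i (next i)
  Π′ : ℤ
  Π′ = ∏ (λ i → 1ℤ - δ zero (lookup (a ∷ c) i))

-- Inclusion-exclusion for the two excluded colours; the last term restores what is subtracted twice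
-- when x = y.
sum-avoiding : (x y : Fin q) (f : Fin q → ℤ) →
  sum (λ z → (1ℤ - δ x z) * ((1ℤ - δ y z) * f z)) ≡ sum f - f x - f y + δ y x * f x
sum-avoiding {q} x y f = begin
  sum (λ z → (1ℤ - δ x z) * ((1ℤ - δ y z) * f z))
    ≡⟨ sum-cong-≗ {q} (λ z → expand (δ x z) (δ y z) (f z)) ⟩
  sum (λ z → f z + (δ x z * (-1ℤ * f z) + (δ y z * (-1ℤ * f z) + δ x z * (δ y z * f z))))
    ≡⟨ ∑-distrib-+ {q} f (λ z → δ x z * (-1ℤ * f z) + (δ y z * (-1ℤ * f z) + δ x z * (δ y z * f z))) ⟩
  sum f + sum (λ z → δ x z * (-1ℤ * f z) + (δ y z * (-1ℤ * f z) + δ x z * (δ y z * f z)))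
    ≡⟨ cong (_+_ (sum f)) (∑-distrib-+ {q} (λ z → δ x z * (-1ℤ * f z)) (λ z → δ y z * (-1ℤ * f z) + δ x z * (δ y z * f z))) ⟩
  sum f + (sum (λ z → δ x z * (-1ℤ * f z)) + sum (λ z → δ y z * (-1ℤ * f z) + δ x z * (δ y z * f z)))
    ≡⟨ cong₂ (λ s t → sum f + (s + t)) (sum-indicator x (λ z → -1ℤ * f z))
         (trans (∑-distrib-+ {q} (λ z → δ y z * (-1ℤ * f z)) (λ z → δ x z * (δ y z * f z)))
                (cong₂ _+_ (sum-indicator y (λ z → -1ℤ * f z)) (sum-indicator x (λ z → δ y z * f z)))) ⟩
  sum f + (-1ℤ * f x + (-1ℤ * f y + δ y x * f x))
    ≡⟨ collect (sum f) (f x) (f y) (δ y x * f x) ⟩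
  sum f - f x - f y + δ y x * f x ∎
  where
  open ≡-Reasoning
  expand : ∀ s t u → (1ℤ - s) * ((1ℤ - t) * u) ≡ u + (s * (-1ℤ * u) + (t * (-1ℤ * u) + s * (t * u)))
  expand = solve-∀
  collect : ∀ s t u v → s + (-1ℤ * t + (-1ℤ * u + v)) ≡ s - t - u + v
  collect = solve-∀

-- β k counts the sequences of k colours, none of them 0 and consecutive ones distinct,
-- that follow a colour x and precede a colour a, for distinct nonzero x and a; p = q − 2.
β : ℤ → ℕ → ℤ
β p zero    = 1ℤ
β p (suc k) = p * β p k - -1ℤ ^ k

-- The factor p + 1 avoids a division. It is the number of nonzero colours, which `∑-proper-wheel`
-- supplies as the number of choices for the first rim vertex.
β-closed : ∀ p k → (p + 1ℤ) * β p k ≡ p ^ suc k + -1ℤ ^ k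
β-closed p zero    = base p
  where
  base : ∀ p → (p + 1ℤ) * 1ℤ ≡ p * 1ℤ + 1ℤ
  base = solve-∀
β-closed p (suc k) = begin
  (p + 1ℤ) * (p * β p k - s)        ≡⟨ expand p (β p k) s ⟩
  p * ((p + 1ℤ) * β p k) - (p + 1ℤ) * s ≡⟨ cong (λ x → p * x - (p + 1ℤ) * s) (β-closed p k) ⟩
  p * (p ^ suc k + s) - (p + 1ℤ) * s  ≡⟨ collect p (p ^ suc k) s ⟩
  p * p ^ suc k + -1ℤ * s           ∎
  where
  open ≡-Reasoning
  s : ℤ
  s = -1ℤ ^ k
  expand : ∀ p b s → (p + 1ℤ) * (p * b - s) ≡ p * ((p + 1ℤ) * b) - (p + 1ℤ) * s
  expand = solve-∀
  collect : ∀ p P s → p * (P + s) - (p + 1ℤ) * s ≡ p * P + -1ℤ * s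
  collect = solve-∀

module _ (q : ℕ) where
  private
    p : ℤ
    p = ℤ.+ suc q - ℤ.+ 2

    nonzero-*-cong : (y : Fin (suc q)) {s t : ℤ} → (zero ≢ y → s ≡ t) →
                     (1ℤ - δ zero y) * s ≡ (1ℤ - δ zero y) * t
    nonzero-*-cong zero    eq = refl
    nonzero-*-cong (suc y) eq = cong ((1ℤ - δ zero (suc y)) *_) (eq λ ())

  -- There are p colours y other than 0 and x, and a is among them exactly when x ≠ a. Summing the
  -- case k over these y gives p β - (-1)ᵏ (1 - δ x a), which is also the origin of the recursion
  -- for β.
  ∑-chain : ∀ k (a x : Fin (suc q)) → zero ≢ a → zero ≢ x →
            ∑ₗ (colourings (suc q) k) (chain a x) ≡ β p k - -1ℤ ^ k * δ x a
  ∑-chain zero    a x 0≢a 0≢x = base (δ x a)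
    where
    base : ∀ d → 1ℤ - d + 0ℤ ≡ 1ℤ - 1ℤ * d
    base = solve-∀
  ∑-chain (suc k) a x 0≢a 0≢x = begin
    ∑ₗ (colourings (suc q) (suc k)) (chain a x)
      ≡⟨ ∑-colourings (suc q) k (chain a x) ⟩
    sum (λ y → ∑ₗ cs (λ c → (1ℤ - δ x y) * ((1ℤ - δ zero y) * chain a y c)))
      ≡⟨ sum-cong-≗ {suc q} (λ y → trans
           (sym (trans (cong ((1ℤ - δ x y) *_) (*-∑ₗ (1ℤ - δ zero y) cs (chain a y)))
                       (*-∑ₗ (1ℤ - δ x y) cs (λ c → (1ℤ - δ zero y) * chain a y c))))
           (cong ((1ℤ - δ x y) *_) (nonzero-*-cong y (∑-chain k a y 0≢a)))) ⟩
    sum (λ y → (1ℤ - δ x y) * ((1ℤ - δ zero y) * f y))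
      ≡⟨ sum-avoiding x zero f ⟩
    sum f - f x - f zero + δ zero x * f x
      ≡⟨ cong₂ (λ σ d → sum f - f x - (b - s * σ) + d * f x) (⟦⟧-no (zero Fin.≟ a) 0≢a) (⟦⟧-no (zero Fin.≟ x) 0≢x) ⟩
    sum f - f x - (b - s * 0ℤ) + 0ℤ * f x
      ≡⟨ cong (λ S → S - f x - (b - s * 0ℤ) + 0ℤ * f x) sum-f ⟩
    ℤ.+ suc q * b - s - (b - s * δ x a) - (b - s * 0ℤ) + 0ℤ * (b - s * δ x a)
      ≡⟨ collect (ℤ.+ suc q) b s (δ x a) ⟩
    p * b - s - -1ℤ * s * δ x a ∎
    where
    open ≡-Reasoning
    cs : List (Vec (Fin (suc q)) k)
    cs = colourings (suc q) k
    b s : ℤ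
    b = β p k
    s = -1ℤ ^ k
    -- The inductive formula, extended to y = `zero`, where the factor 1 - δ zero y vanishes;
    -- `sum-avoiding` takes the extra term out of the full sum again.
    f : Fin (suc q) → ℤ
    f y = b - s * δ y a
    rewrite-term : ∀ b s d → b - s * d ≡ b + d * (-1ℤ * s)
    rewrite-term = solve-∀
    sum-f : sum f ≡ ℤ.+ suc q * b - s
    sum-f = begin
      sum f ≡⟨ sum-cong-≗ {suc q} (λ y → trans (cong (λ d → b - s * d) (δ-sym y a)) (rewrite-term b s (δ a y))) ⟩
      sum (λ y → b + δ a y * (-1ℤ * s)) ≡⟨ ∑-distrib-+ {suc q} (λ _ → b) (λ y → δ a y * (-1ℤ * s)) ⟩
      sum {suc q} (λ _ → b) + sum (λ y → δ a y * (-1ℤ * s))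
        ≡⟨ cong₂ _+_ (sum-const (suc q) b) (sum-indicator a (λ _ → -1ℤ * s)) ⟩
      ℤ.+ suc q * b + -1ℤ * s ≡⟨ cong (_+_ (ℤ.+ suc q * b)) (ℤ.-1*i≡-i s) ⟩
      ℤ.+ suc q * b - s ∎
    collect : ∀ Q b s d → Q * b - s - (b - s * d) - (b - s * 0ℤ) + 0ℤ * (b - s * d) ≡
                          (Q - ℤ.+ 2) * b - s - -1ℤ * s * d
    collect = solve-∀

  -- With the hub's colour removed, p + 1 colours remain for the rim: this is the chromatic
  -- polynomial of the cycle with k + 1 vertices at p + 1.
  ∑-proper-wheel : ∀ k → ∑ₗ (colourings (suc q) (suc k)) (λ c →
    ∏ (λ e → 1ℤ - ⟦ mono? (wheel (suc k)) Fin._≟_ (zero ∷ c) e ⟧)) ≡ p ^ suc k - -1ℤ ^ k * p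
  ∑-proper-wheel k = begin
    ∑ₗ (colourings (suc q) (suc k)) F
      ≡⟨ ∑-colourings (suc q) k F ⟩
    sum (λ a → ∑ₗ cs (λ c → F (a ∷ c)))
      ≡⟨ sum-cong-≗ {suc q} (λ a → trans (∑ₗ-cong cs (∏-wheel-chain k a)) (sym (*-∑ₗ (1ℤ - δ zero a) cs (chain a a)))) ⟩
    sum {suc q} (λ a → (1ℤ - δ zero a) * ∑ₗ cs (chain a a))
      ≡⟨ sum-cong-≗ {suc q} (λ a → nonzero-*-cong a λ 0≢a → trans (∑-chain k a a 0≢a 0≢a)
           (cong (λ d → b - s * d) (⟦⟧-yes (a Fin.≟ a) refl))) ⟩
    sum {suc q} (λ a → (1ℤ - δ zero a) * (b - s * 1ℤ))
      ≡⟨ *-distribʳ-sum {suc q} (b - s * 1ℤ) (λ a → 1ℤ - δ zero a) ⟨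
    sum {suc q} (λ a → 1ℤ - δ zero a) * (b - s * 1ℤ)
      ≡⟨ cong (λ t → t * (b - s * 1ℤ)) nonzero-colours ⟩
    (ℤ.+ suc q - 1ℤ) * (b - s * 1ℤ)
      ≡⟨ expand (ℤ.+ suc q) b s ⟩
    (p + 1ℤ) * b - (p + 1ℤ) * s
      ≡⟨ cong (_- (p + 1ℤ) * s) (β-closed p k) ⟩
    p ^ suc k + s - (p + 1ℤ) * s
      ≡⟨ collect (p ^ suc k) s p ⟩
    p ^ suc k - s * p ∎
    where
    open ≡-Reasoning
    F : Vec (Fin (suc q)) (suc k) → ℤ
    F c = ∏ (λ e → 1ℤ - ⟦ mono? (wheel (suc k)) Fin._≟_ (zero ∷ c) e ⟧)
    cs : List (Vec (Fin (suc q)) k)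
    cs = colourings (suc q) k
    b s : ℤ
    b = β p k
    s = -1ℤ ^ k
    split : ∀ d → 1ℤ - d ≡ 1ℤ + d * -1ℤ
    split = solve-∀
    nonzero-colours : sum {suc q} (λ a → 1ℤ - δ zero a) ≡ ℤ.+ suc q - 1ℤ
    nonzero-colours = begin
      sum {suc q} (λ a → 1ℤ - δ zero a) ≡⟨ sum-cong-≗ {suc q} (λ a → split (δ zero a)) ⟩
      sum {suc q} (λ a → 1ℤ + δ zero a * -1ℤ) ≡⟨ ∑-distrib-+ {suc q} (λ _ → 1ℤ) (λ a → δ zero a * -1ℤ) ⟩
      sum {suc q} (λ _ → 1ℤ) + sum {suc q} (λ a → δ zero a * -1ℤ)
        ≡⟨ cong₂ _+_ (sum-const (suc q) 1ℤ) (sum-indicator {suc q} zero (λ _ → -1ℤ)) ⟩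
      ℤ.+ suc q * 1ℤ + -1ℤ ≡⟨ cong (_- 1ℤ) (ℤ.*-identityʳ (ℤ.+ suc q)) ⟩
      ℤ.+ suc q - 1ℤ ∎
    expand : ∀ Q b s → (Q - 1ℤ) * (b - s * 1ℤ) ≡ (Q - ℤ.+ 2 + 1ℤ) * b - (Q - ℤ.+ 2 + 1ℤ) * s
    expand = solve-∀
    collect : ∀ P s p → P + s - (p + 1ℤ) * s ≡ P - s * p
    collect = solve-∀

-- The h-polynomial of the wheel

-- Groups the faces by size; the bound ensures that the indices i ≤ n reach every face. It serves at
-- the constants -1 and q as well as at z and 1 - z.
form-faces : (G : Graph) {ℓ : _} {_≤_ : Rel (Edge G) ℓ} (ord : IsTotalOrder _≡_ _≤_) (n : ℕ) →
  (∀ {S} → IsFace G _≤_ S → ∣ S ∣ ℕ.≤ n) → ∀ x y d →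
  form (λ i → ℤ.+ #faces G ord i) n x y d ≡
  ∑ₗ (allSubsets (#E G)) (λ S → ⟦ isFace? G ord S ⟧ * (x ^ˢ ∣ S ∣ ⊛ y ^ˢ (n ∸ ∣ S ∣)) d)
form-faces G ord n size x y d = begin
  sum {suc n} (λ i → ℤ.+ #faces G ord (toℕ i) * term (toℕ i))
    ≡⟨ sum-cong-≗ {suc n} (λ i → expand (toℕ i)) ⟩
  sum {suc n} (λ i → ∑ₗ Ss (λ S → face S * (⟦ ∣ S ∣ ℕ.≟ toℕ i ⟧ * term (toℕ i))))
    ≡⟨ sum-∑ₗ-swap {n = suc n} Ss (λ i S → face S * (⟦ ∣ S ∣ ℕ.≟ toℕ i ⟧ * term (toℕ i))) ⟩
  ∑ₗ Ss (λ S → sum {suc n} (λ i → face S * (⟦ ∣ S ∣ ℕ.≟ toℕ i ⟧ * term (toℕ i))))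
    ≡⟨ ∑ₗ-cong Ss (λ S → sym (*-distribˡ-sum {suc n} (face S) (λ i → ⟦ ∣ S ∣ ℕ.≟ toℕ i ⟧ * term (toℕ i)))) ⟩
  ∑ₗ Ss (λ S → face S * form (λ i → ⟦ ∣ S ∣ ℕ.≟ i ⟧) n x y d)
    ≡⟨ ∑ₗ-cong Ss (λ S → ⟦⟧-*-cong (isFace? G ord S) λ isFace → form-monomial n x y (size isFace) d) ⟩
  ∑ₗ Ss (λ S → face S * term ∣ S ∣) ∎
  where
  open ≡-Reasoning
  Ss : List (Subset (#E G))
  Ss = allSubsets (#E G)
  face : Subset (#E G) → ℤ
  face S = ⟦ isFace? G ord S ⟧
  term : ℕ → ℤ
  term i = (x ^ˢ i ⊛ y ^ˢ (n ∸ i)) d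
  rotate : ∀ a b c → a * b * c ≡ b * (a * c)
  rotate = solve-∀
  expand : ∀ i → ℤ.+ #faces G ord i * term i ≡ ∑ₗ Ss (λ S → face S * (⟦ ∣ S ∣ ℕ.≟ i ⟧ * term i))
  expand i = begin
    ℤ.+ #faces G ord i * term i
      ≡⟨ cong (_* term i) (length-filter-∑ₗ (λ S → (∣ S ∣ ℕ.≟ i) ×-dec isFace? G ord S) Ss) ⟩
    ∑ₗ Ss (λ S → ⟦ (∣ S ∣ ℕ.≟ i) ×-dec isFace? G ord S ⟧) * term i
      ≡⟨ ∑ₗ-* (term i) Ss (λ S → ⟦ (∣ S ∣ ℕ.≟ i) ×-dec isFace? G ord S ⟧) ⟩
    ∑ₗ Ss (λ S → ⟦ (∣ S ∣ ℕ.≟ i) ×-dec isFace? G ord S ⟧ * term i)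
      ≡⟨ ∑ₗ-cong Ss (λ S → trans (cong (_* term i) (⟦⟧-× (∣ S ∣ ℕ.≟ i) (isFace? G ord S)))
                                 (rotate ⟦ ∣ S ∣ ℕ.≟ i ⟧ (face S) (term i))) ⟩
    ∑ₗ Ss (λ S → face S * (⟦ ∣ S ∣ ℕ.≟ i ⟧ * term i)) ∎

^ˢ-⊛-head : ∀ x y i j → (x ^ˢ i ⊛ y ^ˢ j) 0 ≡ x 0 ^ i * y 0 ^ j
^ˢ-⊛-head x y i j = trans (⊛-head (x ^ˢ i) (y ^ˢ j)) (cong₂ _*_ (^ˢ-head x i) (^ˢ-head y j))

-- The coefficients of (y + 2x)ⁿ − xᵏ y − 2xⁿ, where n = k + 1.
wheelCoefficient : ℕ → ℕ → ℤ
wheelCoefficient k i = ℤ.+ (suc k ℕ.C i) * (ℤ.+ 2) ^ i + (-1ℤ * ⟦ k ℕ.≟ i ⟧ + (- (ℤ.+ 2)) * ⟦ suc k ℕ.≟ i ⟧)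

form-wheelCoefficient : ∀ k x y → form (wheelCoefficient k) (suc k) x y ≗
  (ℤ.+ 2 · x ⊕ y) ^ˢ suc k ⊕ (-1ℤ · (x ^ˢ k ⊛ y ^ˢ 1) ⊕ (- (ℤ.+ 2)) · (x ^ˢ suc k ⊛ 𝟙))
form-wheelCoefficient k x y d = begin
  form (wheelCoefficient k) (suc k) x y d
    ≡⟨ form-+ binomials (λ i → -1ℤ * δₖ i + (- (ℤ.+ 2)) * δₙ i) (suc k) x y d ⟩
  form binomials (suc k) x y d + form (λ i → -1ℤ * δₖ i + (- (ℤ.+ 2)) * δₙ i) (suc k) x y d
    ≡⟨ cong₂ _+_ (form-binomial (ℤ.+ 2) (suc k) x y d)
         (trans (form-+ (λ i → -1ℤ * δₖ i) (λ i → (- (ℤ.+ 2)) * δₙ i) (suc k) x y d)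
                (cong₂ _+_ (form-· -1ℤ δₖ (suc k) x y d) (form-· (- (ℤ.+ 2)) δₙ (suc k) x y d))) ⟩
  ((ℤ.+ 2 · x ⊕ y) ^ˢ suc k) d + (-1ℤ * form δₖ (suc k) x y d + (- (ℤ.+ 2)) * form δₙ (suc k) x y d)
    ≡⟨ cong₂ (λ s t → ((ℤ.+ 2 · x ⊕ y) ^ˢ suc k) d + (-1ℤ * s + (- (ℤ.+ 2)) * t)) at-k at-n ⟩
  ((ℤ.+ 2 · x ⊕ y) ^ˢ suc k) d + (-1ℤ * (x ^ˢ k ⊛ y ^ˢ 1) d + (- (ℤ.+ 2)) * (x ^ˢ suc k ⊛ 𝟙) d) ∎
  where
  open ≡-Reasoning
  binomials δₖ δₙ : ℕ → ℤ
  binomials i = ℤ.+ (suc k ℕ.C i) * (ℤ.+ 2) ^ i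
  δₖ i = ⟦ k ℕ.≟ i ⟧
  δₙ i = ⟦ suc k ℕ.≟ i ⟧
  at-k : form δₖ (suc k) x y d ≡ (x ^ˢ k ⊛ y ^ˢ 1) d
  at-k = trans (form-monomial (suc k) x y (ℕ.n≤1+n k) d)
    (cong (λ j → (x ^ˢ k ⊛ y ^ˢ j) d) (trans (ℕ.+-∸-assoc 1 (ℕ.≤-refl {k})) (cong suc (ℕ.n∸n≡0 k))))
  at-n : form δₙ (suc k) x y d ≡ (x ^ˢ suc k ⊛ 𝟙) d
  at-n = trans (form-monomial (suc k) x y (ℕ.≤-refl {suc k}) d) (cong (λ j → (x ^ˢ suc k ⊛ y ^ˢ j) d) (ℕ.n∸n≡0 k))

module _ (k : ℕ) {ℓ} {_≤_ : Rel (Edge (wheel (suc k))) ℓ} (ord : IsTotalOrder _≡_ _≤_) where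
  private
    b : ℕ → ℤ
    b i = ℤ.+ #faces (wheel (suc k)) ord i

    size : ∀ {S} → IsFace (wheel (suc k)) _≤_ S → ∣ S ∣ ℕ.≤ suc k
    size = WheelFaces.face-size k ord

  -- At x = -1, y = κ the number κ - 2 is y + 2x and (-1)ᵏ is xᵏ, so the count of proper colourings
  -- is the value of (y + 2x)ⁿ - xᵏ (y + 2x). This is the origin of `wheelCoefficient`.
  form-#faces-values : ∀ q → form b (suc k) (constant -1ℤ) (constant (ℤ.+ suc q)) 0 ≡
                             form (wheelCoefficient k) (suc k) (constant -1ℤ) (constant (ℤ.+ suc q)) 0
  form-#faces-values q = begin
    form b (suc k) x y 0
      ≡⟨ form-faces (wheel (suc k)) ord (suc k) size x y 0 ⟩
    ∑ₗ Ss (λ S → ⟦ isFace? (wheel (suc k)) ord S ⟧ * (x ^ˢ ∣ S ∣ ⊛ y ^ˢ (suc k ∸ ∣ S ∣)) 0)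
      ≡⟨ ∑ₗ-cong Ss (λ S → cong (⟦ isFace? (wheel (suc k)) ord S ⟧ *_) (trans (^ˢ-⊛-head x y ∣ S ∣ (suc k ∸ ∣ S ∣))
           (cong (λ z → -1ℤ ^ ∣ S ∣ * z ^ (suc k ∸ ∣ S ∣)) (ℤ.*-identityʳ κ)))) ⟩
    ∑ₗ Ss (λ S → ⟦ isFace? (wheel (suc k)) ord S ⟧ * (-1ℤ ^ ∣ S ∣ * κ ^ (suc k ∸ ∣ S ∣)))
      ≡⟨ WheelFaces.∑-faces k ord q ⟩
    ∑ₗ (colourings (suc q) (suc k)) (λ c → ∏ (λ e → 1ℤ - ⟦ mono? (wheel (suc k)) Fin._≟_ (zero ∷ c) e ⟧))
      ≡⟨ ∑-proper-wheel q k ⟩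
    (κ - ℤ.+ 2) ^ suc k - -1ℤ ^ k * (κ - ℤ.+ 2)
      ≡⟨ cong₂ (λ u v → u ^ suc k + v) (base κ) (rest (-1ℤ ^ k) κ) ⟩
    (- (ℤ.+ 2) + κ * 1ℤ) ^ suc k + (-1ℤ * (-1ℤ ^ k * ((κ * 1ℤ) * 1ℤ)) + (- (ℤ.+ 2)) * (-1ℤ * -1ℤ ^ k * 1ℤ))
      ≡⟨ cong₂ (λ u v → u + v) (^ˢ-head (ℤ.+ 2 · x ⊕ y) (suc k))
           (cong₂ (λ u v → -1ℤ * u + (- (ℤ.+ 2)) * v) (^ˢ-⊛-head x y k 1) (^ˢ-⊛-head x y (suc k) 0)) ⟨
    ((ℤ.+ 2 · x ⊕ y) ^ˢ suc k) 0 + (-1ℤ * (x ^ˢ k ⊛ y ^ˢ 1) 0 + (- (ℤ.+ 2)) * (x ^ˢ suc k ⊛ 𝟙) 0)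
      ≡⟨ form-wheelCoefficient k x y 0 ⟨
    form (wheelCoefficient k) (suc k) x y 0 ∎
    where
    open ≡-Reasoning
    κ : ℤ
    κ = ℤ.+ suc q
    x y : Series
    x = constant -1ℤ
    y = constant κ
    Ss : List (Subset (#E (wheel (suc k))))
    Ss = allSubsets (#E (wheel (suc k)))
    base : ∀ κ → κ - ℤ.+ 2 ≡ - (ℤ.+ 2) + κ * 1ℤ
    base = solve-∀
    rest : ∀ s κ → - (s * (κ - ℤ.+ 2)) ≡ -1ℤ * (s * ((κ * 1ℤ) * 1ℤ)) + (- (ℤ.+ 2)) * (-1ℤ * s * 1ℤ)
    rest = solve-∀

  form-#faces : ∀ x y → form b (suc k) x y ≗ form (wheelCoefficient k) (suc k) x y
  form-#faces x y = form-cong (suc k) x y (form-injective b (wheelCoefficient k) (suc k) form-#faces-values)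

-- For x = z and y = 1 - z, y + 2x becomes 1 + z, and xᵏ y + 2xⁿ becomes zᵏ - zⁿ + 2zⁿ = zᵏ + zⁿ.
numerator-form : ∀ k → form (wheelCoefficient k) (suc k) 𝕫 (𝟙 ⊖ 𝕫) ≗ (𝟙 ⊕ 𝕫) ^ˢ suc k ⊖ 𝕫 ^ˢ k ⊖ 𝕫 ^ˢ suc k
numerator-form k d = begin
  form (wheelCoefficient k) (suc k) 𝕫 (𝟙 ⊖ 𝕫) d
    ≡⟨ form-wheelCoefficient k 𝕫 (𝟙 ⊖ 𝕫) d ⟩
  ((ℤ.+ 2 · 𝕫 ⊕ (𝟙 ⊖ 𝕫)) ^ˢ suc k) d + (-1ℤ * (𝕫 ^ˢ k ⊛ (𝟙 ⊖ 𝕫) ^ˢ 1) d + (- (ℤ.+ 2)) * (𝕫 ^ˢ suc k ⊛ 𝟙) d)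
    ≡⟨ cong₂ _+_ (^ˢ-cong (suc k) (λ e → base (𝟙 e) (𝕫 e)) d)
         (cong₂ (λ u v → -1ℤ * u + (- (ℤ.+ 2)) * v) middle (𝕊.*-identityʳ (𝕫 ^ˢ suc k) d)) ⟩
  ((𝟙 ⊕ 𝕫) ^ˢ suc k) d + (-1ℤ * ((𝕫 ^ˢ k) d - (𝕫 ^ˢ suc k) d) + (- (ℤ.+ 2)) * (𝕫 ^ˢ suc k) d)
    ≡⟨ collect (((𝟙 ⊕ 𝕫) ^ˢ suc k) d) ((𝕫 ^ˢ k) d) ((𝕫 ^ˢ suc k) d) ⟩
  ((𝟙 ⊕ 𝕫) ^ˢ suc k) d - (𝕫 ^ˢ k) d - (𝕫 ^ˢ suc k) d ∎
  where
  open ≡-Reasoning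
  base : ∀ u z → ℤ.+ 2 * z + (u - z) ≡ u + z
  base = solve-∀
  collect : ∀ a b c → a + (-1ℤ * (b - c) + (- (ℤ.+ 2)) * c) ≡ a - b - c
  collect = solve-∀
  middle : (𝕫 ^ˢ k ⊛ (𝟙 ⊖ 𝕫) ^ˢ 1) d ≡ (𝕫 ^ˢ k) d - (𝕫 ^ˢ suc k) d
  middle = begin
    (𝕫 ^ˢ k ⊛ (𝟙 ⊖ 𝕫) ^ˢ 1) d  ≡⟨ ⊛-congˡ (𝕫 ^ˢ k) (𝕊.*-identityʳ (𝟙 ⊖ 𝕫)) d ⟩
    (𝕫 ^ˢ k ⊛ (𝟙 ⊖ 𝕫)) d       ≡⟨ ⊛-comm (𝕫 ^ˢ k) (𝟙 ⊖ 𝕫) d ⟩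
    ((𝟙 ⊖ 𝕫) ⊛ 𝕫 ^ˢ k) d       ≡⟨ 1-z-⊛ (𝕫 ^ˢ k) d ⟩
    (𝕫 ^ˢ k) d - (𝕫 ^ˢ suc k) d ∎

-- Monomials with given support

support : Monomial N → Subset N
support []          = []
support (zero ∷ m)  = outside ∷ support m
support (suc _ ∷ m) = inside ∷ support m

indicator : Subset N → Monomial N
indicator = Vec.map (λ b → if b then 1 else 0)

support-indicator : (S : Subset N) → support (indicator S) ≡ S
support-indicator []            = refl
support-indicator (outside ∷ S) = cong (outside ∷_) (support-indicator S)
support-indicator (inside ∷ S)  = cong (inside ∷_) (support-indicator S)

infixl 6 _+ᵐ_
_+ᵐ_ : Monomial N → Monomial N → Monomial N
_+ᵐ_ = zipWith ℕ._+_

∷-⊆ : ∀ {s} {S T : Subset N} → S ⊆ T → s ∷ S ⊆ inside ∷ T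
∷-⊆ S⊆T here       = here
∷-⊆ S⊆T (there x∈) = there (S⊆T x∈)

support-⊆ : (m m′ : Monomial N) → support m′ ⊆ support (m +ᵐ m′)
support-⊆ (zero ∷ m)  (zero ∷ m′)  (there x∈) = there (support-⊆ m m′ x∈)
support-⊆ (zero ∷ m)  (suc _ ∷ m′) = ∷-⊆ (support-⊆ m m′)
support-⊆ (suc _ ∷ m) (zero ∷ m′)  = ∷-⊆ (support-⊆ m m′)
support-⊆ (suc _ ∷ m) (suc _ ∷ m′) = ∷-⊆ (support-⊆ m m′)

drop-support-⊆ : ∀ {s} {S : Subset N} e m → s ∷ S ⊆ support (e ∷ m) → S ⊆ support m
drop-support-⊆ zero    m = drop-∷-⊆
drop-support-⊆ (suc e) m = drop-∷-⊆

indicator-divides : (S : Subset N) (m : Monomial N) → S ⊆ support m → ∃ λ m′ → m′ +ᵐ indicator S ≡ m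
indicator-divides []            []      S⊆ = [] , refl
indicator-divides (outside ∷ S) (e ∷ m) S⊆ with m′ , eq ← indicator-divides S m (drop-support-⊆ e m S⊆) =
  e ∷ m′ , cong₂ _∷_ (ℕ.+-identityʳ e) eq
indicator-divides (inside ∷ S) (zero ∷ m)  S⊆ with () ← S⊆ here
indicator-divides (inside ∷ S) (suc e ∷ m) S⊆ with m′ , eq ← indicator-divides S m (drop-∷-⊆ S⊆) =
  e ∷ m′ , cong₂ _∷_ (ℕ.+-comm e 1) eq

divides? : (m₁ m : Monomial N) → Dec (∃ λ m₂ → m₁ +ᵐ m₂ ≡ m)
divides? []       []      = yes ([] , refl)
divides? (e ∷ m₁) (f ∷ m) with e ℕ.≤? f | divides? m₁ m
... | yes e≤f | yes (m₂ , eq) = yes (f ∸ e ∷ m₂ , cong₂ _∷_ (ℕ.m+[n∸m]≡n e≤f) eq)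
... | no e≰f  | _      = no λ { (g ∷ m₂ , eq) → e≰f (subst (e ℕ.≤_) (Vec.∷-injectiveˡ eq) (ℕ.m≤m+n e g)) }
... | yes _   | no ¬∣  = no λ { (g ∷ m₂ , eq) → ¬∣ (m₂ , Vec.∷-injectiveʳ eq) }

+ᵐ-cancelˡ : (m : Monomial N) {m₁ m₂ : Monomial N} → m +ᵐ m₁ ≡ m +ᵐ m₂ → m₁ ≡ m₂
+ᵐ-cancelˡ []      {[]}     {[]}     eq = refl
+ᵐ-cancelˡ (e ∷ m) {f ∷ m₁} {g ∷ m₂} eq =
  cong₂ _∷_ (ℕ.+-cancelˡ-≡ e f g (Vec.∷-injectiveˡ eq)) (+ᵐ-cancelˡ m (Vec.∷-injectiveʳ eq))

∈-allSubsets : (S : Subset N) → S ∈ₗ allSubsets N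
∈-allSubsets []            = here refl
∈-allSubsets (outside ∷ S) = ∈-++⁺ˡ (∈-map⁺ (outside ∷_) (∈-allSubsets S))
∈-allSubsets {suc N} (inside ∷ S) =
  ∈-++⁺ʳ (map (outside ∷_) (allSubsets N)) (∈-map⁺ (inside ∷_) (∈-allSubsets S))

allSubsets-! : ∀ N → List.Unique (allSubsets N)
allSubsets-! zero    = [] ∷ []
allSubsets-! (suc N) = List.++⁺ (List.map⁺ Vec.∷-injectiveʳ (allSubsets-! N))
                                (List.map⁺ Vec.∷-injectiveʳ (allSubsets-! N)) disjoint
  where
  disjoint : ∀ {S} → ¬ (S ∈ₗ map (outside ∷_) (allSubsets N) × S ∈ₗ map (inside ∷_) (allSubsets N))
  disjoint (∈out , ∈in) with _ , _ , refl ← ∈-map⁻ (outside ∷_) ∈out with () ← proj₂ (proj₂ (∈-map⁻ (inside ∷_) ∈in))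

increment : Monomial (suc N) → Monomial (suc N)
increment (e ∷ m) = suc e ∷ m

increment-injective : {m₁ m₂ : Monomial (suc N)} → increment m₁ ≡ increment m₂ → m₁ ≡ m₂
increment-injective {m₁ = _ ∷ _} {_ ∷ _} refl = refl

-- A positive exponent is 1 or the successor of a positive one. With this split the recursion on d
-- is, coefficient by coefficient, the equation of `1-z-⊛-monomialSeries`.
monomialsOn : Subset N → ℕ → List (Monomial N)
monomialsOn []            zero    = [] ∷ []
monomialsOn []            (suc d) = []
monomialsOn (outside ∷ S) d       = map (0 ∷_) (monomialsOn S d)
monomialsOn (inside ∷ S)  zero    = []
monomialsOn (inside ∷ S)  (suc d) = map (1 ∷_) (monomialsOn S d) ++ map increment (monomialsOn (inside ∷ S) d)

∈-monomialsOn⁻ : ∀ (S : Subset N) d {m} → m ∈ₗ monomialsOn S d → support m ≡ S × degree m ≡ d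
∈-monomialsOn⁻ []            zero    (here refl) = refl , refl
∈-monomialsOn⁻ (outside ∷ S) d       m∈ with m′ , m′∈ , refl ← ∈-map⁻ (0 ∷_) m∈
  with refl , refl ← ∈-monomialsOn⁻ S d m′∈ = refl , refl
∈-monomialsOn⁻ (inside ∷ S)  (suc d) m∈ with ∈-++⁻ (map (1 ∷_) (monomialsOn S d)) m∈
... | inj₁ m∈₁ with m′ , m′∈ , refl ← ∈-map⁻ (1 ∷_) m∈₁ with refl , refl ← ∈-monomialsOn⁻ S d m′∈ = refl , refl
... | inj₂ m∈₂ with m′ , m′∈ , refl ← ∈-map⁻ increment m∈₂ = ∈-increment m′ (∈-monomialsOn⁻ (inside ∷ S) d m′∈)
  where
  ∈-increment : ∀ m′ → support m′ ≡ inside ∷ S × degree m′ ≡ d →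
                support (increment m′) ≡ inside ∷ S × degree (increment m′) ≡ suc d
  ∈-increment (suc e ∷ m′) (refl , refl) = refl , refl

∈-monomialsOn⁺ : (m : Monomial N) → m ∈ₗ monomialsOn (support m) (degree m)
∈-monomialsOn⁺ []                = here refl
∈-monomialsOn⁺ (zero ∷ m)        = ∈-map⁺ (0 ∷_) (∈-monomialsOn⁺ m)
∈-monomialsOn⁺ (suc zero ∷ m)    = ∈-++⁺ˡ (∈-map⁺ (1 ∷_) (∈-monomialsOn⁺ m))
∈-monomialsOn⁺ (suc (suc e) ∷ m) =
  ∈-++⁺ʳ (map (1 ∷_) (monomialsOn (support m) (suc e ℕ.+ degree m))) (∈-map⁺ increment (∈-monomialsOn⁺ (suc e ∷ m)))

monomialsOn-! : (S : Subset N) (d : ℕ) → List.Unique (monomialsOn S d)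
monomialsOn-! []            zero    = [] ∷ []
monomialsOn-! []            (suc d) = []
monomialsOn-! (outside ∷ S) d       = List.map⁺ Vec.∷-injectiveʳ (monomialsOn-! S d)
monomialsOn-! (inside ∷ S)  zero    = []
monomialsOn-! (inside ∷ S)  (suc d) =
  List.++⁺ (List.map⁺ Vec.∷-injectiveʳ (monomialsOn-! S d))
           (List.map⁺ increment-injective (monomialsOn-! (inside ∷ S) d)) disjoint
  where
  disjoint : ∀ {m} → ¬ (m ∈ₗ map (1 ∷_) (monomialsOn S d) × m ∈ₗ map increment (monomialsOn (inside ∷ S) d))
  disjoint (m∈₁ , m∈₂) with _ , _ , refl ← ∈-map⁻ (1 ∷_) m∈₁ with zero ∷ _ , m∈ , refl ← ∈-map⁻ increment m∈₂
    with () ← proj₁ (∈-monomialsOn⁻ (inside ∷ S) d m∈)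

lookup-injectiveₗ : {xs : List A} → List.Unique xs → ∀ i j → List.lookup xs i ≡ List.lookup xs j → i ≡ j
lookup-injectiveₗ (_ ∷ _)     zero    zero    eq = refl
lookup-injectiveₗ (x≢ ∷ _)    zero    (suc j) eq = contradiction eq (All.lookup x≢ (∈-lookup j))
lookup-injectiveₗ (x≢ ∷ _)    (suc i) zero    eq = contradiction (sym eq) (All.lookup x≢ (∈-lookup i))
lookup-injectiveₗ (_ ∷ xs!)   (suc i) (suc j) eq = cong suc (lookup-injectiveₗ xs! i j eq)

module _ {p} {P : Subset N → Set p} (P? : U.Decidable P) where

  monomialsWith : ℕ → List (Monomial N)
  monomialsWith d = concatMap (λ S → monomialsOn S d) (filter P? (allSubsets N))

  monomialsWith-! : ∀ d → List.Unique (monomialsWith d)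
  monomialsWith-! d = List.concat⁺
    (All.map⁺ (All.universal (λ S → monomialsOn-! S d) (filter P? (allSubsets N))))
    (AllPairs.map⁺ (AllPairs.map disjoint (List.filter⁺ P? (allSubsets-! N))))
    where
    disjoint : ∀ {S T} → S ≢ T → ∀ {m} → ¬ (m ∈ₗ monomialsOn S d × m ∈ₗ monomialsOn T d)
    disjoint S≢T (m∈S , m∈T) = S≢T (trans (sym (proj₁ (∈-monomialsOn⁻ _ d m∈S))) (proj₁ (∈-monomialsOn⁻ _ d m∈T)))

  ∈-monomialsWith⁻ : ∀ {d m} → m ∈ₗ monomialsWith d → P (support m) × degree m ≡ d
  ∈-monomialsWith⁻ {d} {m} m∈ = map₁ (λ eq → subst P (sym eq) (proj₂ (∈-filter⁻ P? {xs = allSubsets N} (proj₁ (proj₂ found)))))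
      (∈-monomialsOn⁻ (proj₁ found) d (proj₂ (proj₂ found)))
    where
    found : ∃ λ S → S ∈ₗ filter P? (allSubsets N) × m ∈ₗ monomialsOn S d
    found = find (∈-concatMap⁻ (λ S → monomialsOn S d) m∈)

  ∈-monomialsWith⁺ : ∀ {m} → P (support m) → m ∈ₗ monomialsWith (degree m)
  ∈-monomialsWith⁺ {m} p = ∈-concatMap⁺ (λ S → monomialsOn S (degree m))
    (lose (∈-filter⁺ P? (∈-allSubsets (support m)) p) (∈-monomialsOn⁺ m))

  length-monomialsWith : ∀ d → ℤ.+ length (monomialsWith d) ≡
    ∑ₗ (allSubsets N) (λ S → ⟦ P? S ⟧ * ℤ.+ length (monomialsOn S d))
  length-monomialsWith d =
    trans (length-∑ₗ (monomialsWith d))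
   (trans (∑ₗ-concatMap (λ S → monomialsOn S d) (filter P? (allSubsets N)) (λ _ → 1ℤ))
   (trans (∑ₗ-filter P? (allSubsets N) (λ S → ∑ₗ (monomialsOn S d) (λ _ → 1ℤ)))
          (∑ₗ-cong (allSubsets N) λ S → cong (⟦ P? S ⟧ *_) (sym (length-∑ₗ (monomialsOn S d))))))

-- Generating functions of the monomials with given support

monomialSeries : Subset N → Series
monomialSeries S d = ℤ.+ length (monomialsOn S d)

monomialSeries-outside : (S : Subset N) → monomialSeries (outside ∷ S) ≗ monomialSeries S
monomialSeries-outside S d = cong ℤ.+_ (List.length-map (0 ∷_) (monomialsOn S d))

monomialSeries-inside : (S : Subset N) → ∀ d →
  monomialSeries (inside ∷ S) (suc d) ≡ monomialSeries S d + monomialSeries (inside ∷ S) d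
monomialSeries-inside S d = cong ℤ.+_ (trans (List.length-++ (map (1 ∷_) (monomialsOn S d)))
  (cong₂ ℕ._+_ (List.length-map (1 ∷_) (monomialsOn S d)) (List.length-map increment (monomialsOn (inside ∷ S) d))))

1-z-⊛-monomialSeries : (S : Subset N) → (𝟙 ⊖ 𝕫) ⊛ monomialSeries (inside ∷ S) ≗ 𝕫 ⊛ monomialSeries S
1-z-⊛-monomialSeries S zero    = refl
1-z-⊛-monomialSeries S (suc d) = begin
  ((𝟙 ⊖ 𝕫) ⊛ L) (suc d)           ≡⟨ 1-z-⊛ L (suc d) ⟩
  L (suc d) - (𝕫 ⊛ L) (suc d)     ≡⟨ cong₂ _-_ (monomialSeries-inside S d) (𝕫-⊛-tail L d) ⟩
  monomialSeries S d + L d - L d  ≡⟨ cancel (monomialSeries S d) (L d) ⟩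
  monomialSeries S d              ≡⟨ 𝕫-⊛-tail (monomialSeries S) d ⟨
  (𝕫 ⊛ monomialSeries S) (suc d)  ∎
  where
  open ≡-Reasoning
  L : Series
  L = monomialSeries (inside ∷ S)
  cancel : ∀ x y → x + y - y ≡ x
  cancel = solve-∀

monomialSeries-closed : (S : Subset N) → (𝟙 ⊖ 𝕫) ^ˢ ∣ S ∣ ⊛ monomialSeries S ≗ 𝕫 ^ˢ ∣ S ∣
monomialSeries-closed []            = 𝕊.trans (⊛-identityˡ (monomialSeries [])) λ { zero → refl ; (suc _) → refl }
monomialSeries-closed (outside ∷ S) = 𝕊.trans
  (⊛-congˡ ((𝟙 ⊖ 𝕫) ^ˢ ∣ S ∣) (monomialSeries-outside S)) (monomialSeries-closed S)
monomialSeries-closed (inside ∷ S) =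
  𝕊.trans (⊛-congʳ L (⊛-comm u (u ^ˢ ∣ S ∣)))
 (𝕊.trans (⊛-assoc (u ^ˢ ∣ S ∣) u L)
 (𝕊.trans (⊛-congˡ (u ^ˢ ∣ S ∣) (1-z-⊛-monomialSeries S))
 (𝕊.trans (𝕊.sym (⊛-assoc (u ^ˢ ∣ S ∣) 𝕫 (monomialSeries S)))
 (𝕊.trans (⊛-congʳ (monomialSeries S) (⊛-comm (u ^ˢ ∣ S ∣) 𝕫))
 (𝕊.trans (⊛-assoc 𝕫 (u ^ˢ ∣ S ∣) (monomialSeries S))
          (⊛-congˡ 𝕫 (monomialSeries-closed S)))))))
  where
  u L : Series
  u = 𝟙 ⊖ 𝕫
  L = monomialSeries (inside ∷ S)

^ˢ-+ : ∀ f i j → f ^ˢ (i ℕ.+ j) ≗ f ^ˢ i ⊛ f ^ˢ j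
^ˢ-+ f zero    j = 𝕊.sym (⊛-identityˡ (f ^ˢ j))
^ˢ-+ f (suc i) j = 𝕊.trans (⊛-congˡ f (^ˢ-+ f i j)) (𝕊.sym (⊛-assoc f (f ^ˢ i) (f ^ˢ j)))

-- Over the common denominator (1 - z)ⁿ a face contributes exactly its term of the h-polynomial.
monomialSeries-⊛ : (S : Subset N) → ∣ S ∣ ℕ.≤ n →
                   monomialSeries S ⊛ (𝟙 ⊖ 𝕫) ^ˢ n ≗ 𝕫 ^ˢ ∣ S ∣ ⊛ (𝟙 ⊖ 𝕫) ^ˢ (n ∸ ∣ S ∣)
monomialSeries-⊛ {n = n} S S≤n =
  𝕊.trans (⊛-congˡ L (λ e → cong (λ j → (u ^ˢ j) e) (sym (ℕ.m+[n∸m]≡n S≤n))))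
 (𝕊.trans (⊛-congˡ L (^ˢ-+ u ∣ S ∣ (n ∸ ∣ S ∣)))
 (𝕊.trans (𝕊.sym (⊛-assoc L (u ^ˢ ∣ S ∣) (u ^ˢ (n ∸ ∣ S ∣))))
          (⊛-congʳ (u ^ˢ (n ∸ ∣ S ∣)) (𝕊.trans (⊛-comm L (u ^ˢ ∣ S ∣)) (monomialSeries-closed S)))))
  where
  u L : Series
  u = 𝟙 ⊖ 𝕫
  L = monomialSeries S

∑ₗ-⊛ : (xs : List A) (w : A → ℤ) (F : A → Series) (g : Series) →
       (λ d → ∑ₗ xs (λ x → w x * F x d)) ⊛ g ≗ λ d → ∑ₗ xs (λ x → w x * (F x ⊛ g) d)
∑ₗ-⊛ []       w F g   = ⊛-zeroˡ g
∑ₗ-⊛ (x ∷ xs) w F g d = trans (⊛-distribʳ g (w x · F x) (λ d → ∑ₗ xs (λ x → w x * F x d)) d)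
  (cong₂ _+_ (·-⊛ (w x) (F x) g d) (∑ₗ-⊛ xs w F g d))

-- Stanley–Reisner rings

module PolynomialProperties {c ℓ} (R : CommutativeRing c ℓ) (N : ℕ) where
  private module R = CommutativeRing R
  open RingProperties R.ring using (-0#≈0#; -‿+-comm)
  open Polynomials R N
  open SetoidReasoning R.setoid

  _≟ᵐ_ : (m m′ : Monomial N) → Dec (m ≡ m′)
  _≟ᵐ_ = Vec.≡-dec ℕ._≟_

  coeff-∷-≡ : ∀ a p m → coeff ((a , m) ∷ p) m R.≈ a R.+ coeff p m
  coeff-∷-≡ a p m with m ≟ᵐ m
  ... | yes _  = R.refl
  ... | no m≢m = contradiction refl m≢m

  coeff-∷-≢ : ∀ a p m′ m → m′ ≢ m → coeff ((a , m′) ∷ p) m R.≈ coeff p m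
  coeff-∷-≢ a p m′ m m′≢m with m′ ≟ᵐ m
  ... | yes m′≡m = contradiction m′≡m m′≢m
  ... | no _     = R.refl

  coeff-∷-cong : ∀ {a b p q} m′ m → a R.≈ b → coeff p m R.≈ coeff q m →
                 coeff ((a , m′) ∷ p) m R.≈ coeff ((b , m′) ∷ q) m
  coeff-∷-cong m′ m a≈b p≈q with m′ ≟ᵐ m
  ... | yes _ = R.+-cong a≈b p≈q
  ... | no _  = p≈q

  coeff-++ : ∀ p q m → coeff (p ++ q) m R.≈ coeff p m R.+ coeff q m
  coeff-++ []             q m = R.sym (R.+-identityˡ (coeff q m))
  coeff-++ ((a , m′) ∷ p) q m with m′ ≟ᵐ m
  ... | yes _ = R.trans (R.+-congˡ (coeff-++ p q m)) (R.sym (R.+-assoc a _ _))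
  ... | no _  = coeff-++ p q m

  coeff-- : ∀ p q m → coeff (p -ₚ q) m R.≈ coeff p m R.+ R.- coeff q m
  coeff-- p q m = R.trans (coeff-++ p _ m) (R.+-congˡ (negate q))
    where
    negate : ∀ q → coeff (map (λ (a , m) → R.- a , m) q) m R.≈ R.- coeff q m
    negate []             = R.sym -0#≈0#
    negate ((a , m′) ∷ q) with m′ ≟ᵐ m
    ... | yes _ = R.trans (R.+-congˡ (negate q)) (-‿+-comm a (coeff q m))
    ... | no _  = negate q

  -- Multiplication by a single term; by definition `p *ₚ q` is a concatenation of such shifts of q.
  shift : R.Carrier → Monomial N → Poly → Poly
  shift a m = map λ (b , m′) → a R.* b , m +ᵐ m′

  coeff-shift : ∀ a m₁ q m₂ → coeff (shift a m₁ q) (m₁ +ᵐ m₂) R.≈ a R.* coeff q m₂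
  coeff-shift a m₁ []             m₂ = R.sym (R.zeroʳ a)
  coeff-shift a m₁ ((b , m′) ∷ q) m₂ with (m₁ +ᵐ m′) ≟ᵐ (m₁ +ᵐ m₂) | m′ ≟ᵐ m₂
  ... | yes _  | yes _ = R.trans (R.+-congˡ (coeff-shift a m₁ q m₂)) (R.sym (R.distribˡ a b (coeff q m₂)))
  ... | no _   | no _  = coeff-shift a m₁ q m₂
  ... | yes eq | no ≢  = contradiction (+ᵐ-cancelˡ m₁ eq) ≢
  ... | no ≢   | yes eq = contradiction (cong (m₁ +ᵐ_) eq) ≢

  coeff-shift-∤ : ∀ a m₁ q {m} → ¬ (∃ λ m₂ → m₁ +ᵐ m₂ ≡ m) → coeff (shift a m₁ q) m R.≈ R.0#
  coeff-shift-∤ a m₁ []             ∤ = R.refl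
  coeff-shift-∤ a m₁ ((b , m′) ∷ q) {m} ∤ =
    R.trans (coeff-∷-≢ (a R.* b) (shift a m₁ q) (m₁ +ᵐ m′) m λ eq → ∤ (m′ , eq)) (coeff-shift-∤ a m₁ q ∤)

  module _ {p} {P : Monomial N → Set p} (P? : U.Decidable P) where

    restrict : Poly → Poly
    restrict = filter (P? ∘ proj₂)

    coeff-restrict-∈ : ∀ q {m} → P m → coeff (restrict q) m R.≈ coeff q m
    coeff-restrict-∈ []             pm = R.refl
    coeff-restrict-∈ ((a , m′) ∷ q) {m} pm with P? m′
    ... | yes _   = coeff-∷-cong m′ m R.refl (coeff-restrict-∈ q pm)
    ... | no ¬pm′ = R.trans (coeff-restrict-∈ q pm) (R.sym (coeff-∷-≢ a q m′ m λ { refl → ¬pm′ pm }))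

    coeff-restrict-∉ : ∀ q {m} → ¬ P m → coeff (restrict q) m R.≈ R.0#
    coeff-restrict-∉ []             ¬pm = R.refl
    coeff-restrict-∉ ((a , m′) ∷ q) {m} ¬pm with P? m′
    ... | yes pm′ = R.trans (coeff-∷-≢ a (restrict q) m′ m λ { refl → ¬pm pm′ }) (coeff-restrict-∉ q ¬pm)
    ... | no _    = coeff-restrict-∉ q ¬pm

  monomial : Monomial N → Poly
  monomial m = (R.1# , m) ∷ []

  coeff-linearCombination-∉ : ∀ {k} (a : Fin k → R.Carrier) (ms : Fin k → Monomial N) {m} →
    (∀ j → ms j ≢ m) → coeff (linearCombination a (monomial ∘ ms)) m R.≈ R.0#
  coeff-linearCombination-∉ {zero}  a ms ∉ = R.refl
  coeff-linearCombination-∉ {suc k} a ms {m} ∉ =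
    R.trans (coeff-∷-≢ (a zero R.* R.1#) (linearCombination (a ∘ suc) (monomial ∘ ms ∘ suc)) (ms zero) m (∉ zero))
            (coeff-linearCombination-∉ (a ∘ suc) (ms ∘ suc) (∉ ∘ suc))

  coeff-linearCombination : ∀ {k} (a : Fin k → R.Carrier) (ms : Fin k → Monomial N) →
    (∀ i j → ms i ≡ ms j → i ≡ j) → ∀ j → coeff (linearCombination a (monomial ∘ ms)) (ms j) R.≈ a j
  coeff-linearCombination a ms inj zero = begin
    coeff (linearCombination a (monomial ∘ ms)) (ms zero)
      ≈⟨ coeff-∷-≡ (a zero R.* R.1#) (linearCombination (a ∘ suc) (monomial ∘ ms ∘ suc)) (ms zero) ⟩
    a zero R.* R.1# R.+ coeff (linearCombination (a ∘ suc) (monomial ∘ ms ∘ suc)) (ms zero)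
      ≈⟨ R.+-cong (R.*-identityʳ (a zero)) (coeff-linearCombination-∉ (a ∘ suc) (ms ∘ suc) λ j eq →
           contradiction (inj (suc j) zero eq) λ ()) ⟩
    a zero R.+ R.0# ≈⟨ R.+-identityʳ (a zero) ⟩
    a zero ∎
  coeff-linearCombination a ms inj (suc j) =
    R.trans (coeff-∷-≢ (a zero R.* R.1#) (linearCombination (a ∘ suc) (monomial ∘ ms ∘ suc)) (ms zero) (ms (suc j))
              λ eq → contradiction (inj zero (suc j) eq) λ ())
            (coeff-linearCombination (a ∘ suc) (ms ∘ suc) (λ i j eq → Fin.suc-injective (inj (suc i) (suc j) eq)) j)

module StanleyReisnerBasis {c ℓ} (R : CommutativeRing c ℓ) (G : Graph) {o} {_≤_ : Rel (Edge G) o}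
                           (ord : IsTotalOrder _≡_ _≤_) where
  private module R = CommutativeRing R
  open StanleyReisner R G _≤_
  open PolynomialProperties R (#E G)
  open RingProperties R.ring using (-0#≈0#)
  open SetoidReasoning R.setoid
  open BrokenCircuits G ord using (face∨closes)

  Face : Monomial (#E G) → Set o
  Face m = IsFace G _≤_ (support m)

  face? : U.Decidable Face
  face? m = isFace? G ord (support m)

  face-⊆ : ∀ {S T} → S ⊆ T → IsFace G _≤_ T → IsFace G _≤_ S
  face-⊆ S⊆T face (B , broken , B⊆S) = face (B , broken , ⊆-trans B⊆S S⊆T)

  -- A divisor of a face monomial is a face monomial, because subsets of faces are faces. Hence the
  -- coefficient of a product at a face monomial involves only coefficients of q that already
  -- vanish.
  ideal-vanishes : ∀ {p} → I-BC p → ∀ m → Face m → coeff p m R.≈ R.0#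
  ideal-vanishes (gen (B , broken , refl)) m face = coeff-∷-≢ R.1# [] (indicator B) m λ { refl →
    face (B , broken , subst (B ⊆_) (sym (support-indicator B)) ⊆-refl) }
  ideal-vanishes zero m face = R.refl
  ideal-vanishes (add {p} {q} p∈I q∈I) m face = begin
    coeff (p ++ q) m          ≈⟨ coeff-++ p q m ⟩
    coeff p m R.+ coeff q m   ≈⟨ R.+-cong (ideal-vanishes p∈I m face) (ideal-vanishes q∈I m face) ⟩
    R.0# R.+ R.0#             ≈⟨ R.+-identityˡ R.0# ⟩
    R.0#                      ∎
  ideal-vanishes (mul p {q} q∈I) m face = product p
    where
    shifted : ∀ a m₁ → coeff (shift a m₁ q) m R.≈ R.0#
    shifted a m₁ with divides? m₁ m
    ... | yes (m₂ , refl) = R.trans (coeff-shift a m₁ q m₂)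
      (R.trans (R.*-congˡ (ideal-vanishes q∈I m₂ (face-⊆ (support-⊆ m₁ m₂) face))) (R.zeroʳ a))
    ... | no ∤ = coeff-shift-∤ a m₁ q ∤
    product : ∀ p → coeff (p *ₚ q) m R.≈ R.0#
    product []             = R.refl
    product ((a , m₁) ∷ p) = begin
      coeff (shift a m₁ q ++ p *ₚ q) m               ≈⟨ coeff-++ (shift a m₁ q) (p *ₚ q) m ⟩
      coeff (shift a m₁ q) m R.+ coeff (p *ₚ q) m    ≈⟨ R.+-cong (shifted a m₁) (product p) ⟩
      R.0# R.+ R.0#                                  ≈⟨ R.+-identityˡ R.0# ⟩
      R.0#                                           ∎
  ideal-vanishes (resp p≈q p∈I) m face = R.trans (R.sym (p≈q m)) (ideal-vanishes p∈I m face)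

  -- The support contains some broken circuit C ∖ e, so the generator of C ∖ e divides the monomial.
  nonface∈ideal : ∀ a m → ¬ Face m → I-BC ((a , m) ∷ [])
  nonface∈ideal a m ¬face with face∨closes (support m)
  ... | inj₁ face = contradiction face ¬face
  ... | inj₂ (e , C , cycle , max , C-e⊆) with m′ , refl ← indicator-divides (C ∖ e) m C-e⊆ =
    resp (λ m″ → coeff-∷-cong (m′ +ᵐ indicator (C ∖ e)) m″ (R.*-identityʳ a) R.refl)
         (mul ((a , m′) ∷ []) (gen (C ∖ e , (C , e , cycle , max , refl) , refl)))

  nonfaces∈ideal : ∀ p → All (λ (_ , m) → ¬ Face m) p → I-BC p
  nonfaces∈ideal []            []           = zero
  nonfaces∈ideal ((a , m) ∷ p) (¬face ∷ ¬f) = add (nonface∈ideal a m ¬face) (nonfaces∈ideal p ¬f)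

  -- As a formal sum, p may contain face terms that cancel each other. Dropping them changes no
  -- coefficient and leaves a sum of nonface terms.
  vanishes⇒∈ideal : ∀ p → (∀ m → Face m → coeff p m R.≈ R.0#) → I-BC p
  vanishes⇒∈ideal p vanishes =
    resp (λ m → agree m (face? m)) (nonfaces∈ideal (restrict nonface? p) (All.all-filter (nonface? ∘ proj₂) p))
    where
    nonface? : U.Decidable (¬_ ∘ Face)
    nonface? m = ¬? (face? m)
    agree : ∀ m → Dec (Face m) → coeff (restrict nonface? p) m R.≈ coeff p m
    agree m (yes face) = R.trans (coeff-restrict-∉ nonface? p λ ¬face → ¬face face) (R.sym (vanishes m face))
    agree m (no ¬face) = coeff-restrict-∈ nonface? p ¬face

  faceMonomials : ℕ → List (Monomial (#E G))
  faceMonomials = monomialsWith (isFace? G ord)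

  gradedDimension : ∀ d → GradedDimension I-BC d (length (faceMonomials d))
  gradedDimension d = record
    { basis       = monomial ∘ ms
    ; homogeneous = λ j m degree≢d → coeff-∷-≢ R.1# [] (ms j) m λ { refl → degree≢d (proj₂ (basis-face j)) }
    ; independent = λ a lc∈I j →
        R.trans (R.sym (coeff-linearCombination a ms ms-injective j)) (ideal-vanishes lc∈I (ms j) (proj₁ (basis-face j)))
    ; spanning    = λ p homogeneous → (λ j → coeff p (ms j)) , vanishes⇒∈ideal _ (remainder p homogeneous) }
    where
    ms : Fin (length (faceMonomials d)) → Monomial (#E G)
    ms = List.lookup (faceMonomials d)

    ms-injective : ∀ i j → ms i ≡ ms j → i ≡ j
    ms-injective = lookup-injectiveₗ (monomialsWith-! (isFace? G ord) d)

    basis-face : ∀ j → Face (ms j) × degree (ms j) ≡ d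
    basis-face j = ∈-monomialsWith⁻ (isFace? G ord) (∈-lookup {xs = faceMonomials d} j)

    remainder : ∀ p → Homogeneous d p → ∀ m → Face m →
                coeff (p -ₚ linearCombination (λ j → coeff p (ms j)) (monomial ∘ ms)) m R.≈ R.0#
    remainder p homogeneous m face = R.trans (coeff-- p lc m) (by-degree (degree m ℕ.≟ d))
      where
      lc : Poly
      lc = linearCombination (λ j → coeff p (ms j)) (monomial ∘ ms)
      by-degree : Dec (degree m ≡ d) → coeff p m R.+ R.- coeff lc m R.≈ R.0#
      by-degree (yes refl) = begin
        coeff p m R.+ R.- coeff lc m           ≡⟨ cong (λ m → coeff p m R.+ R.- coeff lc m) (Any.lookup-index m∈) ⟩
        coeff p (ms j) R.+ R.- coeff lc (ms j) ≈⟨ R.+-congˡ (R.-‿cong (coeff-linearCombination (λ j → coeff p (ms j)) ms ms-injective j)) ⟩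
        coeff p (ms j) R.+ R.- coeff p (ms j)  ≈⟨ R.-‿inverseʳ (coeff p (ms j)) ⟩
        R.0# ∎
        where
        m∈ : m ∈ₗ faceMonomials (degree m)
        m∈ = ∈-monomialsWith⁺ (isFace? G ord) face
        j : Fin (length (faceMonomials d))
        j = Any.index m∈
      by-degree (no degree≢d) = begin
        coeff p m R.+ R.- coeff lc m
          ≈⟨ R.+-cong (homogeneous m degree≢d) (R.-‿cong (coeff-linearCombination-∉ (λ j → coeff p (ms j)) ms
               λ { j refl → degree≢d (proj₂ (basis-face j)) })) ⟩
        R.0# R.+ R.- R.0# ≈⟨ R.-‿inverseʳ R.0# ⟩
        R.0#              ∎

theorem6p2 :
    (n : ℕ) → 3 ≤ n →
    {o : Level} (_≼_ : Rel (Edge (wheel n)) o) (ord : IsTotalOrder _≡_ _≼_) →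
    {c ℓ₁ ℓ₂ : Level} (𝕜 : HeytingField c ℓ₁ ℓ₂) →
    let numerator = (𝟙 ⊕ 𝕫) ^ˢ n ⊖ 𝕫 ^ˢ (n ∸ 1) ⊖ 𝕫 ^ˢ n
        open StanleyReisner (HeytingCommutativeRing.commutativeRing (HeytingField.heytingCommutativeRing 𝕜)) (wheel n) _≼_
    in (hPolynomial (wheel n) ord ≗ numerator)
       × (∃ λ (Hilb : Series) → IsHilbertSeries Hilb × (Hilb ⊛ (𝟙 ⊖ 𝕫) ^ˢ n ≗ numerator))
theorem6p2 (suc k) _ _≼_ ord 𝕜 =
  h , Hilb , ((λ d → length (faceMonomials d)) , gradedDimension , λ _ → refl) , quotient
  where
  open StanleyReisnerBasis
    (HeytingCommutativeRing.commutativeRing (HeytingField.heytingCommutativeRing 𝕜)) (wheel (suc k)) ord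
  open ≡-Reasoning
  numerator : Series
  numerator = (𝟙 ⊕ 𝕫) ^ˢ suc k ⊖ 𝕫 ^ˢ k ⊖ 𝕫 ^ˢ suc k
  face : Subset (#E (wheel (suc k))) → ℤ
  face S = ⟦ isFace? (wheel (suc k)) ord S ⟧
  Ss : List (Subset (#E (wheel (suc k))))
  Ss = allSubsets (#E (wheel (suc k)))
  size : ∀ {S} → IsFace (wheel (suc k)) _≼_ S → ∣ S ∣ ℕ.≤ suc k
  size = WheelFaces.face-size k ord

  -- By definition `hPolynomial` is this form, the rank of the wheel being n = k + 1; so `h` proves
  -- the first claim and also ends the computation of the second.
  h : form (λ i → ℤ.+ #faces (wheel (suc k)) ord i) (suc k) 𝕫 (𝟙 ⊖ 𝕫) ≗ numerator
  h d = trans (form-#faces k ord 𝕫 (𝟙 ⊖ 𝕫) d) (numerator-form k d)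

  Hilb : Series
  Hilb d = ℤ.+ length (faceMonomials d)

  quotient : Hilb ⊛ (𝟙 ⊖ 𝕫) ^ˢ suc k ≗ numerator
  quotient d = begin
    (Hilb ⊛ (𝟙 ⊖ 𝕫) ^ˢ suc k) d
      ≡⟨ ⊛-congʳ ((𝟙 ⊖ 𝕫) ^ˢ suc k) (length-monomialsWith (isFace? (wheel (suc k)) ord)) d ⟩
    ((λ e → ∑ₗ Ss (λ S → face S * monomialSeries S e)) ⊛ (𝟙 ⊖ 𝕫) ^ˢ suc k) d
      ≡⟨ ∑ₗ-⊛ Ss face monomialSeries ((𝟙 ⊖ 𝕫) ^ˢ suc k) d ⟩
    ∑ₗ Ss (λ S → face S * (monomialSeries S ⊛ (𝟙 ⊖ 𝕫) ^ˢ suc k) d)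
      ≡⟨ ∑ₗ-cong Ss (λ S → ⟦⟧-*-cong (isFace? (wheel (suc k)) ord S) λ isFace → monomialSeries-⊛ S (size isFace) d) ⟩
    ∑ₗ Ss (λ S → face S * (𝕫 ^ˢ ∣ S ∣ ⊛ (𝟙 ⊖ 𝕫) ^ˢ (suc k ∸ ∣ S ∣)) d)
      ≡⟨ form-faces (wheel (suc k)) ord (suc k) size 𝕫 (𝟙 ⊖ 𝕫) d ⟨
    form (λ i → ℤ.+ #faces (wheel (suc k)) ord i) (suc k) 𝕫 (𝟙 ⊖ 𝕫) d
      ≡⟨ h d ⟩
    numerator d ∎
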